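{- The $t$-uniform hypergraphicality problem, with the degree sequence given in compressed form, is fixed-parameter tractable parameterized by $(k,t)$. That is, there exist a function $f$, a polynomial $\mathrm{poly}$, and an algorithm which, given $t$ and an input $(\delta_1,n_1),\dots,(\delta_k,n_k)$ with pairwise distinct $\delta_1,\dots,\delta_k$, decides in time at most $f(k,t)\cdot \mathrm{poly}(L)$ whether the degree sequence of length $n=n_1+\cdots+n_k$ consisting of exactly $n_i$ terms equal to $\delta_i$ for each $i=1,\dots,k$ is $t$-hypergraphical, where $L$ is the total number of bits required to encode the integers $(\delta_1,n_1),\dots,(\delta_k,n_k)$.
   Context: A $t$-uniform hypergraph is a pair $H=(V,E)$ where $V$ is a finite set and $E\subseteq\binom{V}{t}$ (a set of $t$-element subsets of $V$, so no repeated hyperedges). The degree of a vertex $v$ is the number of hyperedges $e\in E$ with $v\in e$. A sequence $d=(d_1,\dots,d_n)$ of nonnegative integers is $t$-hypergraphical if there is a $t$-uniform hypergraph with vertex set $\{v_1,\dots,v_n\}$ in which $v_i$ has degree $d_i$ for all $i$. Compressed input: $\delta_1,\dots,\delta_k$ are the distinct degrees (nonnegative integers), and $n_i\ge 1$ is the number of vertices of degree $\delta_i$; all integers are written in binary. The input size $L$ is the total number of bits required to encode $(\delta_1,n_1),\dots,(\delta_k,n_k)$ (so $L$ is of order $\sum_i(\log\delta_i+\log n_i)$, not of order $n$). A problem is fixed-parameter tractable with parameter set $p$ if it can be solved in time $f(p)\cdot\mathrm{poly}(L)$; here $p=(k,t)$. -}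

module Defs where

open import Data.Bool.Base using (Bool; true; false)
open import Data.Digit using (Bit; Expansion; toDigits)
open import Data.Fin.Base using (Fin; zero; suc)
open import Data.Fin.Subset using (Subset; _∈_; ∣_∣)
open import Data.Fin.Subset.Properties using (_∈?_)
open import Data.List.Base using (List; length; filter; foldr)
open import Data.List.Relation.Unary.All using (All)
open import Data.List.Relation.Unary.Unique.Propositional using (Unique)
open import Data.Nat.Base using (ℕ; suc; _+_; _*_; _≤_)
open import Data.Product.Base using (_×_; _,_; ∃-syntax; proj₁; proj₂)
open import Data.Vec.Base as Vec using (Vec; []; _∷_; _++_; lookup; replicate; _[_]≔_; sum; toList)
open import Relation.Binary.PropositionalEquality.Core using (_≡_; _≢_)
open import Relation.Nullary.Reflects using (Reflects)

-- On the vertex set Fin n; a finite set of hyperedges is given as a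
-- duplicate-free list.

record UniformHypergraph (t n : ℕ) : Set where
  field
    edges   : List (Subset n)
    simple  : Unique edges
    uniform : All (λ e → ∣ e ∣ ≡ t) edges

  degree : Fin n → ℕ
  degree v = length (filter (v ∈?_) edges)

open UniformHypergraph public

Hypergraphical : (t : ℕ) {n : ℕ} → Vec ℕ n → Set
Hypergraphical t {n} d =
  ∃[ H ] ∀ (v : Fin n) → degree {t} H v ≡ lookup d v

degreeSequence : ∀ {k} (xs : Vec (ℕ × ℕ) k) → Vec ℕ (sum (Vec.map proj₂ xs))
degreeSequence []             = []
degreeSequence ((δ , n) ∷ xs) = replicate n δ ++ degreeSequence xs

-- Least significant bit first; no superfluous zeros, and 0 has one bit.

binary : ℕ → Expansion 2
binary n = proj₁ (toDigits 2 n)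

bitLength : ℕ → ℕ
bitLength n = length (binary n)

inputSize : ∀ {k} → Vec (ℕ × ℕ) k → ℕ
inputSize xs = sum (Vec.map (λ (δ , n) → bitLength δ + bitLength n) xs)

-- Machine model: Jones's language WHILE ("Computability and Complexity
-- from a Programming Perspective", 1997).
--
-- A program has finitely many registers holding binary trees.  Every
-- elementary operation is charged at least one time unit and is a
-- constant-time pointer operation on cons cells, so programs run on a
-- RAM with constant overhead.  WHILE and Turing machines simulate each
-- other with polynomial overhead; hence time bounds of the form
-- f(parameter) · poly(size) define the same class of problems.

infixr 5 _∙_

data Tree : Set where
  nil : Tree
  _∙_ : Tree → Tree → Tree

head tail : Tree → Tree
head nil     = nil
head (x ∙ y) = x
tail nil     = nil
tail (x ∙ y) = y

Store : ℕ → Set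
Store r = Vec Tree r

data Expr (r : ℕ) : Set where
  var   : Fin r → Expr r
  nil   : Expr r
  cons  : Expr r → Expr r → Expr r
  hd tl : Expr r → Expr r

infix  6 _:=_
infixr 5 _⨾_

data Command (r : ℕ) : Set where
  _:=_          : Fin r → Expr r → Command r
  _⨾_           : Command r → Command r → Command r
  if_then_else_ : Expr r → Command r → Command r → Command r
  while_loop_   : Expr r → Command r → Command r

eval : ∀ {r} → Expr r → Store r → Tree
eval (var x)    s = lookup s x
eval nil        s = nil
eval (cons a b) s = eval a s ∙ eval b s
eval (hd a)     s = head (eval a s)
eval (tl a)     s = tail (eval a s)

cost : ∀ {r} → Expr r → ℕ
cost (var x)    = 1
cost nil        = 1
cost (cons a b) = suc (cost a + cost b)
cost (hd a)     = suc (cost a)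
cost (tl a)     = suc (cost a)

-- ⟨ c , s ⟩⇓⟨ s′ , m ⟩: started in store s, the command c halts in
-- store s′ after m time units.  As a condition, nil means false and
-- every other tree means true.

infix 4 ⟨_,_⟩⇓⟨_,_⟩

data ⟨_,_⟩⇓⟨_,_⟩ {r : ℕ} : Command r → Store r → Store r → ℕ → Set where

  assign : ∀ {x a s} →
    ⟨ x := a , s ⟩⇓⟨ s [ x ]≔ eval a s , suc (cost a) ⟩

  seq : ∀ {c d s s′ s″ m n} →
    ⟨ c , s ⟩⇓⟨ s′ , m ⟩ →
    ⟨ d , s′ ⟩⇓⟨ s″ , n ⟩ →
    ⟨ c ⨾ d , s ⟩⇓⟨ s″ , m + n ⟩

  if-true : ∀ {a c d s s′ m} →
    eval a s ≢ nil →
    ⟨ c , s ⟩⇓⟨ s′ , m ⟩ →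
    ⟨ if a then c else d , s ⟩⇓⟨ s′ , suc (cost a) + m ⟩

  if-false : ∀ {a c d s s′ m} →
    eval a s ≡ nil →
    ⟨ d , s ⟩⇓⟨ s′ , m ⟩ →
    ⟨ if a then c else d , s ⟩⇓⟨ s′ , suc (cost a) + m ⟩

  while-true : ∀ {a c s s′ s″ m n} →
    eval a s ≢ nil →
    ⟨ c , s ⟩⇓⟨ s′ , m ⟩ →
    ⟨ while a loop c , s′ ⟩⇓⟨ s″ , n ⟩ →
    ⟨ while a loop c , s ⟩⇓⟨ s″ , suc (cost a) + m + n ⟩

  while-false : ∀ {a c s} →
    eval a s ≡ nil →
    ⟨ while a loop c , s ⟩⇓⟨ s , suc (cost a) ⟩

-- Register zero holds the input at the start and the output at the end;
-- all other registers are initially nil.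

record Program : Set where
  field
    {extra} : ℕ
    body    : Command (suc extra)

_on_outputs_inTime_ : Program → Tree → Tree → ℕ → Set
P on x outputs y inTime m =
  ∃[ s ] ⟨ body , x ∷ replicate extra nil ⟩⇓⟨ y ∷ s , m ⟩
  where open Program P

encodeBool : Bool → Tree
encodeBool false = nil
encodeBool true  = nil ∙ nil

encodeBit : Bit → Tree
encodeBit zero       = nil
encodeBit (suc zero) = nil ∙ nil

encodeList : ∀ {A : Set} → (A → Tree) → List A → Tree
encodeList enc = foldr (λ x rest → enc x ∙ rest) nil

encodeℕ : ℕ → Tree
encodeℕ n = encodeList encodeBit (binary n)

encodeInput : ∀ {k} → ℕ → Vec (ℕ × ℕ) k → Tree
encodeInput t xs =
  encodeℕ t ∙ encodeList (λ (δ , n) → encodeℕ δ ∙ encodeℕ n) (toList xs)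

_on_decides_within_ : Program → Tree → Set → ℕ → Set
P on x decides A within T =
  ∃[ b ] ∃[ m ] (P on x outputs encodeBool b inTime m) × m ≤ T × Reflects A b

-- Coefficients, constant term first.

Polynomial : Set
Polynomial = List ℕ

evalPoly : Polynomial → ℕ → ℕ
evalPoly p x = foldr (λ c acc → c + x * acc) 0 p

{-# OPTIONS --safe #-}
module Submission where

open import Defs
open import Data.Bool.Base using (Bool; true; false; T; _∧_; _∨_; not) renaming (if_then_else_ to ifᵇ_then_else_)
open import Data.Bool.Properties using (T-∧)
open import Data.Digit using (Bit; fromDigits; toDigits)
open import Data.Empty using (⊥; ⊥-elim)
open import Data.Fin.Base using (Fin; zero; suc; _↑ˡ_; _↑ʳ_; splitAt; toℕ)
open import Data.Fin.Properties using (any?; splitAt⁻¹-↑ˡ; splitAt⁻¹-↑ʳ)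
open import Data.Fin.Subset using (Subset; ∣_∣)
open import Data.Fin.Subset.Properties using (_∈?_)
open import Data.List.Base as List using (List; []; _∷_; _++_)
open import Data.List.Membership.Propositional using () renaming (_∈_ to _∈ˡ_)
open import Data.List.Membership.Propositional.Properties
  using (∈-filter⁺; ∈-filter⁻; ∈-map⁺; ∈-map⁻; ∈-++⁺ˡ; ∈-++⁺ʳ; ∈-++⁻)
open import Data.List.Properties
  using (++-identityʳ; length-++; length-filter; length-map; length-replicate; length-reverse; length-ʳ++; map-++; map-∘; reverse-foldl;
         ∷-injectiveˡ; ∷-injectiveʳ)
open import Data.List.Relation.Unary.All as All using ([]; _∷_)
import Data.List.Relation.Unary.All.Properties as All
open import Data.List.Relation.Unary.AllPairs using ([]; _∷_)
open import Data.List.Relation.Unary.Any using (here; there)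
open import Data.List.Relation.Unary.Any.Properties using (reverse⁻)
import Data.List.Relation.Unary.Unique.Propositional as Uniqueˡ
import Data.List.Relation.Unary.Unique.Propositional.Properties as Uniqueˡ
open import Data.Nat.Base
  using (ℕ; zero; suc; pred; _+_; _*_; _∸_; _^_; _⊔_; _⊓_; _≤_; _<_; _≡ᵇ_; _!; NonZero; z≤n; s≤s)
open import Data.Nat.DivMod using (_/_; _%_; m≡m%n+[m/n]*n; m%n<n)
open import Data.Nat.ListAction using () renaming (sum to sumˡ)
open import Data.Nat.Properties
open import Data.Nat.Tactic.RingSolver using (solve-∀)
open import Data.Product.Base using (_×_; _,_; proj₁; proj₂; ∃; Σ-syntax; ∃-syntax)
open import Data.Sum.Base using (_⊎_; inj₁; inj₂)
open import Data.Unit.Base using (⊤; tt)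
open import Data.Vec.Base as Vec using (Vec; []; _∷_; lookup; map; sum; toList; _[_]≔_)
open import Data.Vec.Properties using (lookup∘update; lookup-++ˡ; lookup-++ʳ; lookup-replicate; lookup⇒[]=; []=⇒lookup)
  renaming (∷-injectiveʳ to ∷-injectiveʳᵛ)
open import Data.Vec.Relation.Unary.All using (All)
open import Data.Vec.Relation.Unary.Unique.Propositional using (Unique)
open import Function.Base using (_$_; _∘_)
open import Function.Bundles using (Equivalence)
open import Relation.Binary.PropositionalEquality
  using (_≡_; _≢_; refl; sym; trans; cong; cong₂; subst; module ≡-Reasoning)
open import Relation.Nullary using (¬_; yes; no)
open import Relation.Nullary.Decidable.Core using (T?)
open import Relation.Nullary.Reflects using (Reflects; ofʸ; ofⁿ)

-- The type of an edge lists its numbers of vertices in the k classes; there are at most (t+1)^k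
-- types a.  By exchanging vertices of a class, every hypergraph can be made regular within the
-- classes without changing the total degrees of the classes.  Hence the sequence is hypergraphical
-- iff there are numbers x_a of edges of type a with ∑_a a_i x_a = n_i δ_i for all i and
-- x_a ≤ ∏_i C(n_i , a_i), that is, ∏_i a_i! x_a + s_a = ∏_i n_i (n_i - 1) ⋯ (n_i - a_i + 1) with a
-- slack s_a.  The size and the coefficients of this linear system are bounded in terms of (k , t), so
-- its solvability is decided by a finite automaton of that size, which reads the binary right-hand
-- side from the least significant bit and guesses the bits of the unknowns; its states are the carries.
--
-- The algorithm is written in a typed language of folds over lists, where all programs terminate and
-- running times are defined by recursion, and compiled to WHILE.

-- The number of vertices may be exponential in L, so a hypergraph cannot even be written down; the
-- exchange argument is what allows an algorithm to forget everything but the numbers x_a. Clearing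
-- the denominators of the binomial coefficients has two effects: the right-hand sides arise from
-- binary numbers by decrements and multiplications alone, and δ_i and n_i occur only there, while
-- the coefficients are functions of the parameters. Let M be the matrix and 1 the all-ones vector.
-- A carry that is at most M 1 is followed by one that is at most (M 1 + M 1) / 2 = M 1, so the
-- number of states does not depend on the length of the numbers read. As for time, everything
-- computed from k and t alone, and every single transition of the automaton, acts on data from a
-- finite set determined by the parameters. There a bound exists for trivial reasons, and f need not
-- be explicit. Polynomial estimates are needed only for the arithmetic on binary numbers, the
-- traversal of the rows and the number of rounds.

-- The typed language of folds

infixr 6 _⊗_

data Ty : Set where
  bool nat : Ty
  list     : Ty → Ty
  _⊗_      : Ty → Ty → Ty

⟦_⟧ : Ty → Set
⟦ bool ⟧   = Bool
⟦ nat ⟧    = ℕ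
⟦ list a ⟧ = List ⟦ a ⟧
⟦ a ⊗ b ⟧  = ⟦ a ⟧ × ⟦ b ⟧

-- Numbers of type `nat` are single digits or bounded in terms of the parameters, so unary notation
-- is affordable; the numbers of the input have type `list bool`, least significant bit first.
unary : ℕ → Tree
unary zero    = nil
unary (suc n) = nil ∙ unary n

enc : ∀ a → ⟦ a ⟧ → Tree
enc bool     b       = encodeBool b
enc nat      n       = unary n
enc (list a) xs      = encodeList (enc a) xs
enc (a ⊗ b)  (x , y) = enc a x ∙ enc b y

-- The value of `hd` at an empty list. With `false` and `0` as defaults, short numbers and vectors
-- behave as if padded with zeros.
default : ∀ a → ⟦ a ⟧
default bool     = false
default nat      = 0
default (list a) = []
default (a ⊗ b)  = default a , default b

truthy : ∀ a → ⟦ a ⟧ → Bool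
truthy bool     b       = b
truthy nat      zero    = false
truthy nat      (suc n) = true
truthy (list a) []      = false
truthy (list a) (x ∷ l) = true
truthy (a ⊗ b)  p       = true

headOr : ∀ a → List ⟦ a ⟧ → ⟦ a ⟧
headOr a []      = default a
headOr a (x ∷ l) = x

Ctx : Set
Ctx = List Ty

Env : Ctx → Set
Env []      = ⊤
Env (a ∷ Γ) = ⟦ a ⟧ × Env Γ

encEnv : ∀ Γ → Env Γ → Tree
encEnv []      _       = nil
encEnv (a ∷ Γ) (x , γ) = enc a x ∙ encEnv Γ γ

data Var : Ctx → Ty → Set where
  here  : ∀ {Γ a} → Var (a ∷ Γ) a
  there : ∀ {Γ a b} → Var Γ a → Var (b ∷ Γ) a

-- The tree of a number `n` is also the tree of a list of `n` zeros. Hence `units` merely copies,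
-- and folds over its result iterate `n` times.
data Op : Ty → Ty → Set where
  succ prec : Op nat nat
  units    : Op nat (list nat)
  fst      : ∀ {a b} → Op (a ⊗ b) a
  snd      : ∀ {a b} → Op (a ⊗ b) b
  tl       : ∀ {a} → Op (list a) (list a)

-- A `call` runs its term in an environment consisting of the arguments only; value and time of the
-- callee are thus analysed once, independently of the caller.
data Tm (Γ : Ctx) : Ty → Set
data Args (Γ : Ctx) : Ctx → Set

data Tm Γ where
  var    : ∀ {a} → Var Γ a → Tm Γ a
  con    : ∀ {a} → ⟦ a ⟧ → Tm Γ a
  op     : ∀ {a b} → Op a b → Tm Γ a → Tm Γ b
  pair   : ∀ {a b} → Tm Γ a → Tm Γ b → Tm Γ (a ⊗ b)
  cons   : ∀ {a} → Tm Γ a → Tm Γ (list a) → Tm Γ (list a)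
  cond   : ∀ {a b} → Tm Γ a → Tm Γ b → Tm Γ b → Tm Γ b
  hd     : ∀ {a} → Tm Γ (list a) → Tm Γ a
  bind   : ∀ {a b} → Tm Γ a → Tm (a ∷ Γ) b → Tm Γ b
  call   : ∀ {Δ b} → Tm Δ b → Args Γ Δ → Tm Γ b
  foldl  : ∀ {a b} → Tm (a ∷ b ∷ Γ) b → Tm Γ b → Tm Γ (list a) → Tm Γ b
  foldr  : ∀ {a b} → Tm (a ∷ b ∷ Γ) b → Tm Γ b → Tm Γ (list a) → Tm Γ b

infixr 5 _∷_
data Args Γ where
  []  : Args Γ []
  _∷_ : ∀ {a Δ} → Tm Γ a → Args Γ Δ → Args Γ (a ∷ Δ)

get : ∀ {Γ a} → Var Γ a → Env Γ → ⟦ a ⟧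
get here      (x , γ) = x
get (there i) (x , γ) = get i γ

runOp : ∀ {a b} → Op a b → ⟦ a ⟧ → ⟦ b ⟧
runOp succ  n = suc n
runOp prec  n = pred n
runOp units n = List.replicate n 0
runOp fst   p = proj₁ p
runOp snd   p = proj₂ p
runOp tl    l = List.drop 1 l

run     : ∀ {Γ a} → Tm Γ a → Env Γ → ⟦ a ⟧
runArgs : ∀ {Γ Δ} → Args Γ Δ → Env Γ → Env Δ

run (var i)          γ = get i γ
run (con x)          γ = x
run (op o t)         γ = runOp o (run t γ)
run (pair t u)       γ = run t γ , run u γ
run (cons t u)       γ = run t γ ∷ run u γ
run (cond {a} c t u) γ = ifᵇ truthy a (run c γ) then run t γ else run u γ
run (hd {a} t)       γ = headOr a (run t γ)
run (bind t u)       γ = run u (run t γ , γ)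
run (call f as)      γ = run f (runArgs as γ)
run (foldl f z l)    γ = List.foldl (λ y x → run f (x , y , γ)) (run z γ) (run l γ)
run (foldr f z l)    γ = List.foldr (λ x y → run f (x , y , γ)) (run z γ) (run l γ)

runArgs []       γ = tt
runArgs (t ∷ as) γ = run t γ , runArgs as γ

-- Terms are compiled to three registers: V receives the value of the
-- term, E holds the environment and K is a stack.

pattern V = zero
pattern E = suc zero
pattern K = suc (suc zero)

quoteTree : Tree → Expr 3
quoteTree nil     = nil
quoteTree (x ∙ y) = cons (quoteTree x) (quoteTree y)

tlⁿE : ∀ {Γ a} → Var Γ a → Expr 3 → Expr 3
tlⁿE here      e = hd e
tlⁿE (there i) e = tlⁿE i (tl e)

opExpr : ∀ {a b} → Op a b → Expr 3
opExpr succ  = cons nil (var V)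
opExpr prec  = tl (var V)
opExpr units = var V
opExpr fst   = hd (var V)
opExpr snd   = tl (var V)
opExpr tl    = tl (var V)

push pop : Command 3
push = K := cons (var V) (var K)
pop  = K := tl (var K)

-- Inside a loop the top of the stack is the list still to be traversed and `V` is the accumulator;
-- the body finds the next element and the accumulator in front of `E`. `store` extends the
-- environment of a callee, which is built on top of the stack.
load next leave store : Command 3
load  = E := cons (hd (hd (var K))) (cons (var V) (var E))
next  = K := cons (tl (hd (var K))) (tl (var K))
leave = E := tl (tl (var E))
store = K := cons (cons (var V) (hd (var K))) (tl (var K))

iterate : Command 3 → Command 3
iterate c = while hd (var K) loop (load ⨾ next ⨾ c ⨾ leave)

-- Loops consume a list from the front, so `foldr` has to run as a left fold over the reversed list.
reversal : Command 3
reversal =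
  V := nil ⨾
  while hd (var K) loop (V := cons (hd (hd (var K))) (var V) ⨾ next) ⨾
  K := cons (var V) (tl (var K))

compile     : ∀ {Γ a} → Tm Γ a → Command 3
compileArgs : ∀ {Γ Δ} → Args Γ Δ → Command 3

compile (var i)         = V := tlⁿE i (var E)
compile (con {a} x)     = V := quoteTree (enc a x)
compile (op o t)        = compile t ⨾ V := opExpr o
compile (pair t u)      = compile t ⨾ push ⨾ compile u ⨾ V := cons (hd (var K)) (var V) ⨾ pop
compile (cons t u)      = compile t ⨾ push ⨾ compile u ⨾ V := cons (hd (var K)) (var V) ⨾ pop
compile (cond c t u)    = compile c ⨾ if var V then compile t else compile u
compile (hd {a} t)      = compile t ⨾ if var V then (V := hd (var V)) else (V := quoteTree (enc a (default a)))
compile (bind t u)      = compile t ⨾ E := cons (var V) (var E) ⨾ compile u ⨾ E := tl (var E)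
-- The callee's environment grows on the stack from `nil`; when it is complete, the caller's
-- environment takes its place there until the callee has finished.
compile (call f as)     = K := cons nil (var K) ⨾ compileArgs as ⨾
                          V := hd (var K) ⨾ K := cons (var E) (tl (var K)) ⨾ E := var V ⨾
                          compile f ⨾ E := hd (var K) ⨾ pop
compile (foldl f z l)   = compile l ⨾ push ⨾ compile z ⨾ iterate (compile f) ⨾ pop
compile (foldr f z l)   = compile l ⨾ push ⨾ reversal ⨾ compile z ⨾ iterate (compile f) ⨾ pop

-- An assignment without effect serves as the empty command. The arguments are evaluated from the
-- last to the first because an environment is built from its tail.
compileArgs []       = K := var K
compileArgs (t ∷ as) = compileArgs as ⨾ compile t ⨾ store

-- Exact running times

assignTime : Expr 3 → ℕ
assignTime e = suc (cost e)

reversalTime : ∀ {A : Set} → List A → ℕ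
reversalTime []      = 3
reversalTime (x ∷ l) = 3 + (6 + 7) + reversalTime l

-- The numerals are the costs of the commands around the compiled subterms.
time     : ∀ {Γ a} → Tm Γ a → Env Γ → ℕ
timeArgs : ∀ {Γ Δ} → Args Γ Δ → Env Γ → ℕ

-- f is the time of the loop body and g its value.
loopTime : ∀ {A B : Set} → (A → B → ℕ) → (A → B → B) → B → List A → ℕ
loopTime f g y []      = 3
loopTime f g y (x ∷ l) = 3 + (8 + (7 + (f x y + 4))) + loopTime f g (g x y) l

time (var i)           γ = assignTime (tlⁿE i (var E))
time (con {a} x)       γ = assignTime (quoteTree (enc a x))
time (op o t)          γ = time t γ + assignTime (opExpr o)
time (pair t u)        γ = time t γ + (4 + (time u γ + (5 + 3)))
time (cons t u)        γ = time t γ + (4 + (time u γ + (5 + 3)))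
time (cond {a} c t u)  γ = time c γ + (2 + (ifᵇ truthy a (run c γ) then time t γ else time u γ))
time (hd {a} t)        γ = time t γ + (2 + (ifᵇ truthy (list a) (run t γ) then 3 else assignTime (quoteTree (enc a (default a)))))
time (bind t u)        γ = time t γ + (4 + (time u (run t γ , γ) + 3))
time (call f as)       γ = 4 + (timeArgs as γ + (3 + (5 + (2 + (time f (runArgs as γ) + (3 + 3))))))
time (foldl f z l)     γ =
  time l γ + (4 + (time z γ + (loopTime (λ x y → time f (x , y , γ)) (λ x y → run f (x , y , γ)) (run z γ) (run l γ) + 3)))
time (foldr f z l)     γ =
  time l γ + (4 + ((2 + (reversalTime (run l γ) + 5)) + (time z γ +
    (loopTime (λ x y → time f (x , y , γ)) (λ x y → run f (x , y , γ)) (run z γ) (List.reverse (run l γ)) + 3))))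

timeArgs []       γ = 2
timeArgs (t ∷ as) γ = timeArgs as γ + (time t γ + 8)

-- Correctness of the compiler

eval-quote : ∀ x s → eval (quoteTree x) s ≡ x
eval-quote nil     s = refl
eval-quote (x ∙ y) s = cong₂ _∙_ (eval-quote x s) (eval-quote y s)

eval-get : ∀ {Γ a} (i : Var Γ a) (γ : Env Γ) (e : Expr 3) (s : Store 3) →
  eval e s ≡ encEnv Γ γ → eval (tlⁿE i e) s ≡ enc a (get i γ)
eval-get here      γ e s p = cong head p
eval-get (there i) γ e s p = eval-get i (proj₂ γ) (tl e) s (cong tail p)

eval-op : ∀ {a b} (o : Op a b) x e k → eval (opExpr o) (enc a x ∷ e ∷ k ∷ []) ≡ enc b (runOp o x)
eval-op succ  x       e k = refl
eval-op prec  zero    e k = refl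
eval-op prec  (suc x) e k = refl
eval-op units x       e k = enc-units x
  where
  enc-units : ∀ n → unary n ≡ enc (list nat) (List.replicate n 0)
  enc-units zero    = refl
  enc-units (suc n) = cong (nil ∙_) (enc-units n)
eval-op fst   x       e k = refl
eval-op snd   x       e k = refl
eval-op tl    []      e k = refl
eval-op tl    (x ∷ l) e k = refl

enc-falsy : ∀ a x → truthy a x ≡ false → enc a x ≡ nil
enc-falsy bool     false   p = refl
enc-falsy nat      zero    p = refl
enc-falsy (list a) []      p = refl

enc-truthy : ∀ a x → truthy a x ≡ true → enc a x ≢ nil
enc-truthy bool     true    p ()
enc-truthy nat      (suc n) p ()
enc-truthy (list a) (x ∷ l) p ()
enc-truthy (a ⊗ b)  x       p ()

assign′ : ∀ {r} {x : Fin r} {e s v} → eval e s ≡ v → ⟨ x := e , s ⟩⇓⟨ s [ x ]≔ v , suc (cost e) ⟩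
assign′ refl = assign

-- The old content of `V` is arbitrary while `E` and `K` are restored; in this form subterms can be
-- run one after another with intermediate values kept on the stack.
compile-correct : ∀ {Γ a} (t : Tm Γ a) (γ : Env Γ) (v k : Tree) →
  ⟨ compile t , v ∷ encEnv Γ γ ∷ k ∷ [] ⟩⇓⟨ enc a (run t γ) ∷ encEnv Γ γ ∷ k ∷ [] , time t γ ⟩

-- The existential stands for what is left in `V`: the value of the argument evaluated last, or the
-- old content if there are no arguments.
args-correct : ∀ {Γ Δ} (as : Args Γ Δ) (γ : Env Γ) (v k : Tree) →
  ∃ λ v′ →
  ⟨ compileArgs as , v ∷ encEnv Γ γ ∷ (nil ∙ k) ∷ [] ⟩⇓⟨ v′ ∷ encEnv Γ γ ∷ (encEnv Δ (runArgs as γ) ∙ k) ∷ [] , timeArgs as γ ⟩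

loop-correct : ∀ {Γ a b} (f : Tm (a ∷ b ∷ Γ) b) (γ : Env Γ) (y : ⟦ b ⟧) (l : List ⟦ a ⟧) (k : Tree) →
  ⟨ iterate (compile f) , enc b y ∷ encEnv Γ γ ∷ (enc (list a) l ∙ k) ∷ [] ⟩⇓⟨
    enc b (List.foldl (λ y x → run f (x , y , γ)) y l) ∷ encEnv Γ γ ∷ (nil ∙ k) ∷ [] ,
    loopTime (λ x y → time f (x , y , γ)) (λ x y → run f (x , y , γ)) y l ⟩
loop-correct f γ y []      k = while-false refl
loop-correct f γ y (x ∷ l) k =
  while-true (λ ()) (seq assign (seq assign (seq (compile-correct f (x , y , γ) _ _) assign)))
    (loop-correct f γ (run f (x , y , γ)) l k)

reversal-correct : ∀ a (l : List ⟦ a ⟧) e k →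
  ⟨ reversal , enc (list a) l ∷ e ∷ (enc (list a) l ∙ k) ∷ [] ⟩⇓⟨
    enc (list a) (List.reverse l) ∷ e ∷ (enc (list a) (List.reverse l) ∙ k) ∷ [] , 2 + (reversalTime l + 5) ⟩
reversal-correct a l e k = seq assign (seq (go l []) assign)
  where
  go : ∀ (l r : List ⟦ a ⟧) →
    ⟨ while hd (var K) loop (V := cons (hd (hd (var K))) (var V) ⨾ next) ,
      enc (list a) r ∷ e ∷ (enc (list a) l ∙ k) ∷ [] ⟩⇓⟨
      enc (list a) (List.foldl (λ r x → x ∷ r) r l) ∷ e ∷ (nil ∙ k) ∷ [] , reversalTime l ⟩
  go []      r = while-false refl
  go (x ∷ l) r = while-true (λ ()) (seq assign assign) (go l (x ∷ r))

compile-correct (var i)    γ v k = assign′ (eval-get i γ _ _ refl)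
compile-correct (con x)    γ v k = assign′ (eval-quote _ _)
compile-correct (op o t)   γ v k = seq (compile-correct t γ v k) (assign′ (eval-op o _ _ _))
compile-correct (pair t u) γ v k =
  seq (compile-correct t γ _ _) (seq assign (seq (compile-correct u γ _ _) (seq assign assign)))
compile-correct (cons t u) γ v k =
  seq (compile-correct t γ _ _) (seq assign (seq (compile-correct u γ _ _) (seq assign assign)))
compile-correct (cond {a} c t u) γ v k with truthy a (run c γ) in eq
... | true  = seq (compile-correct c γ v k) (if-true (enc-truthy a _ eq) (compile-correct t γ _ k))
... | false = seq (compile-correct c γ v k) (if-false (enc-falsy a _ eq) (compile-correct u γ _ k))
compile-correct (hd t) γ v k with compile-correct t γ v k
... | p with run t γ
... | []    = seq p (if-false refl (assign′ (eval-quote _ _)))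
... | x ∷ l = seq p (if-true (λ ()) assign)
compile-correct (bind t u) γ v k =
  seq (compile-correct t γ _ _) (seq assign (seq (compile-correct u (run t γ , γ) _ _) assign))
compile-correct (call f as) γ v k =
  seq assign (seq (proj₂ (args-correct as γ v k)) (seq assign (seq assign (seq assign
    (seq (compile-correct f (runArgs as γ) _ _) (seq assign assign))))))
compile-correct (foldl f z l) γ v k =
  seq (compile-correct l γ _ _) (seq assign (seq (compile-correct z γ _ _)
    (seq (loop-correct f γ _ (run l γ) k) assign)))
compile-correct {Γ} (foldr {a} {b} f z l) γ v k =
  subst (λ y → ⟨ compile (foldr f z l) , v ∷ encEnv Γ γ ∷ k ∷ [] ⟩⇓⟨ enc b y ∷ encEnv Γ γ ∷ k ∷ [] , time (foldr f z l) γ ⟩)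
    (reverse-foldl (λ y x → run f (x , y , γ)) (run z γ) (run l γ))
    (seq (compile-correct l γ _ _) (seq assign (seq (reversal-correct a (run l γ) _ _) (seq (compile-correct z γ _ _)
      (seq (loop-correct f γ _ (List.reverse (run l γ)) k) assign)))))

args-correct []       γ v k = v , assign
args-correct (t ∷ as) γ v k =
  _ , seq (proj₂ (args-correct as γ v k)) (seq (compile-correct t γ _ _) assign)

-- Estimates of the running times

-- heavy t γ bounds the time spent in calls and folds, overhead t the rest.

overhead     : ∀ {Γ a} → Tm Γ a → ℕ
overheadArgs : ∀ {Γ Δ} → Args Γ Δ → ℕ

overhead (var i)       = assignTime (tlⁿE i (var E))
overhead (con {a} x)   = assignTime (quoteTree (enc a x))
overhead (op o t)      = overhead t + assignTime (opExpr o)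
overhead (pair t u)    = overhead t + (overhead u + 12)
overhead (cons t u)    = overhead t + (overhead u + 12)
overhead (cond c t u)  = overhead c + (2 + (overhead t + overhead u))
overhead (hd {a} t)    = overhead t + (2 + (3 + assignTime (quoteTree (enc a (default a)))))
overhead (bind t u)    = overhead t + (overhead u + 7)
overhead (call f as)   = overheadArgs as + 20
overhead (foldl f z l) = 0
overhead (foldr f z l) = 0

overheadArgs []       = 2
overheadArgs (t ∷ as) = overhead t + (overheadArgs as + 8)

heavy     : ∀ {Γ a} → Tm Γ a → Env Γ → ℕ
heavyArgs : ∀ {Γ Δ} → Args Γ Δ → Env Γ → ℕ

heavy (var i)       γ = 0
heavy (con x)       γ = 0
heavy (op o t)      γ = heavy t γ
heavy (pair t u)    γ = heavy t γ + heavy u γ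
heavy (cons t u)    γ = heavy t γ + heavy u γ
heavy (cond c t u)  γ = heavy c γ + (heavy t γ + heavy u γ)
heavy (hd t)        γ = heavy t γ
heavy (bind t u)    γ = heavy t γ + heavy u (run t γ , γ)
heavy (call f as)   γ = heavyArgs as γ + time f (runArgs as γ)
heavy (foldl f z l) γ = time (foldl f z l) γ
heavy (foldr f z l) γ = time (foldr f z l) γ

heavyArgs []       γ = 0
heavyArgs (t ∷ as) γ = heavy t γ + heavyArgs as γ

-- Charging both branches of a conditional makes `overhead` independent of the environment. For a
-- term without calls and folds `heavy` computes to 0, so such loop bodies take constant time.
time≤     : ∀ {Γ a} (t : Tm Γ a) → ∀ γ → time t γ ≤ overhead t + heavy t γ
timeArgs≤ : ∀ {Γ Δ} (as : Args Γ Δ) → ∀ γ → timeArgs as γ ≤ overheadArgs as + heavyArgs as γ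
time²≤ : ∀ {Γ Γ′ a b} (t : Tm Γ a) (u : Tm Γ′ b) c c′ γ γ′ →
  time t γ + (c + (time u γ′ + c′)) ≤ overhead t + (overhead u + (c + c′)) + (heavy t γ + heavy u γ′)

time²≤ t u c c′ γ γ′ = ≤-trans
  (+-mono-≤ (time≤ t γ) (+-monoʳ-≤ c (+-monoˡ-≤ c′ (time≤ u γ′))))
  (≤-reflexive (regroup (overhead t) (heavy t γ) (overhead u) (heavy u γ′) c c′))
  where
  regroup : ∀ a b a′ b′ c c′ → a + b + (c + (a′ + b′ + c′)) ≡ a + (a′ + (c + c′)) + (b + b′)
  regroup = solve-∀

time≤ (var i)        γ = m≤m+n _ 0
time≤ (con x)        γ = m≤m+n _ 0
time≤ (op o t)       γ = ≤-trans (+-monoˡ-≤ _ (time≤ t γ)) (≤-reflexive (regroup (overhead t) (heavy t γ) _))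
  where
  regroup : ∀ a b c → a + b + c ≡ a + c + b
  regroup = solve-∀
time≤ (pair t u)     γ = time²≤ t u 4 8 γ γ
time≤ (cons t u)     γ = time²≤ t u 4 8 γ γ
time≤ (cond {a} c t u) γ = ≤-trans
  (+-mono-≤ (time≤ c γ) (+-monoʳ-≤ 2 (branch {truthy a (run c γ)})))
  (≤-reflexive (regroup (overhead c) (heavy c γ) (overhead t) (heavy t γ) (overhead u) (heavy u γ)))
  where
  branch : ∀ {b} → (ifᵇ b then time t γ else time u γ) ≤ overhead t + heavy t γ + (overhead u + heavy u γ)
  branch {true}  = ≤-trans (time≤ t γ) (m≤m+n _ _)
  branch {false} = ≤-trans (time≤ u γ) (m≤n+m _ (overhead t + heavy t γ))
  regroup : ∀ a b c d e f → a + b + (2 + (c + d + (e + f))) ≡ a + (2 + (c + e)) + (b + (d + f))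
  regroup = solve-∀
time≤ (hd {a} t)     γ = ≤-trans
  (+-mono-≤ (time≤ t γ) (+-monoʳ-≤ 2 (branch {truthy (list a) (run t γ)})))
  (≤-reflexive (regroup (overhead t) (heavy t γ) _))
  where
  branch : ∀ {b n} → (ifᵇ b then 3 else n) ≤ 3 + n
  branch {true}  = m≤m+n _ _
  branch {false} = m≤n+m _ 3
  regroup : ∀ a b c → a + b + c ≡ a + c + b
  regroup = solve-∀
time≤ (bind t u)     γ = time²≤ t u 4 3 γ _
time≤ (call f as)    γ = ≤-trans
  (+-monoʳ-≤ 4 (+-monoˡ-≤ _ (timeArgs≤ as γ)))
  (≤-reflexive (regroup (overheadArgs as) (heavyArgs as γ) (time f (runArgs as γ))))
  where
  regroup : ∀ a b c → 4 + (a + b + (3 + (5 + (2 + (c + 6))))) ≡ a + 20 + (b + c)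
  regroup = solve-∀
time≤ (foldl f z l)  γ = ≤-refl
time≤ (foldr f z l)  γ = ≤-refl

timeArgs≤ []       γ = ≤-refl
timeArgs≤ (t ∷ as) γ = ≤-trans (+-mono-≤ (timeArgs≤ as γ) (+-monoˡ-≤ 8 (time≤ t γ)))
  (≤-reflexive (regroup (overheadArgs as) (heavyArgs as γ) (overhead t) (heavy t γ)))
  where
  regroup : ∀ a b c d → a + b + (c + d + 8) ≡ c + (a + 8) + (d + b)
  regroup = solve-∀

-- P j y constrains the accumulator y when j list elements remain.

loopTime≤ : ∀ {A B : Set} {f : A → B → ℕ} {g : A → B → B} {Q : A → Set} (P : ℕ → B → Set) (c : ℕ) →
  (∀ {j x y} → Q x → P (suc j) y → f x y ≤ c × P j (g x y)) →
  ∀ l {y} → All.All Q l → P (List.length l) y →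
  loopTime f g y l ≤ 3 + List.length l * (22 + c) × P 0 (List.foldl (λ y x → g x y) y l)
-- The final test costs 3; each round costs 22 = 3 + 8 + 7 + 4 besides its body.
loopTime≤ P c h []      []       p = ≤-refl , p
loopTime≤ {f = f} {g} P c h (x ∷ l) {y} (q ∷ qs) p =
  let f≤c , p′ = h q p
      le  , p″ = loopTime≤ P c h l qs p′
  in (begin
    3 + (8 + (7 + (f x y + 4))) + loopTime f g (g x y) l ≤⟨ +-mono-≤ (+-monoʳ-≤ 18 (+-monoˡ-≤ 4 f≤c)) le ⟩
    18 + (c + 4) + (3 + List.length l * (22 + c))        ≡⟨ regroup c (List.length l) ⟩
    3 + (22 + c + List.length l * (22 + c)) ∎) , p″
  where
  open ≤-Reasoning
  regroup : ∀ c n → 18 + (c + 4) + (3 + n * (22 + c)) ≡ 3 + (22 + c + n * (22 + c))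
  regroup = solve-∀

reversalTime≡ : ∀ {A : Set} (l : List A) → reversalTime l ≡ 3 + List.length l * 16
reversalTime≡ []      = refl
reversalTime≡ (x ∷ l) rewrite reversalTime≡ l = cong (13 +_) (sym (+-assoc 3 3 _))

-- As f is arbitrary in f(k,t) · poly(L), bounded replaces the analysis of all computations on
-- data whose size depends on the parameters only.

Within : ∀ a → ℕ → ⟦ a ⟧ → Set
Within bool     h b       = ⊤
Within nat      h n       = n ≤ h
Within (list a) h l       = List.length l ≤ h × All.All (Within a h) l
Within (a ⊗ b)  h (x , y) = Within a h x × Within b h y

-- Only finitely many values lie within `h`, so nothing has to be known about `g`. For pairs and
-- nonempty lists a bound is taken over the second component with the first one fixed, and then over
-- the first.
bounded : ∀ a h (g : ⟦ a ⟧ → ℕ) → ∃[ B ] ∀ x → Within a h x → g x ≤ B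
bounded bool h g = g true + g false , λ { true _ → m≤m+n _ _ ; false _ → m≤n+m _ _ }
bounded nat zero g = g 0 , λ { zero z≤n → ≤-refl }
bounded nat (suc h) g =
  let B , le = bounded nat h (λ n → g (suc n))
  in g 0 + B , λ { zero _ → m≤m+n _ _ ; (suc n) (s≤s n≤h) → ≤-trans (le n n≤h) (m≤n+m _ _) }
bounded (list a) h g = let B , le = go h g in B , λ { l (len , all) → le l len all }
  where
  go : ∀ m (g : List ⟦ a ⟧ → ℕ) → ∃[ B ] ∀ l → List.length l ≤ m → All.All (Within a h) l → g l ≤ B
  go zero    g = g [] , λ { [] _ _ → ≤-refl }
  go (suc m) g =
    let tails       = λ x → go m (λ l → g (x ∷ l))
        B , le      = bounded a h (λ x → proj₁ (tails x))
    in g [] + B , λ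
      { []      _         _        → m≤m+n _ _
      ; (x ∷ l) (s≤s len) (p ∷ ps) → ≤-trans (proj₂ (tails x) l len ps) (≤-trans (le x p) (m≤n+m _ _)) }
bounded (a ⊗ b) h g =
  let second = λ x → bounded b h (λ y → g (x , y))
      B , le = bounded a h (λ x → proj₁ (second x))
  in B , λ { (x , y) (p , q) → ≤-trans (proj₂ (second x) y q) (le x p) }

size : ∀ a → ⟦ a ⟧ → ℕ
size bool     b       = 0
size nat      n       = n
size (list a) l       = List.foldr (λ x s → suc (size a x + s)) 0 l
size (a ⊗ b)  (x , y) = size a x + size b y

Within-mono : ∀ a {h h′} x → h ≤ h′ → Within a h x → Within a h′ x
Within-mono bool     x       le w = tt
Within-mono nat      x       le w = ≤-trans w le
Within-mono (list a) l       le (len , ws) = ≤-trans len le , All.map (Within-mono a _ le) ws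
Within-mono (a ⊗ b)  (x , y) le (w , w′) = Within-mono a x le w , Within-mono b y le w′

within-size : ∀ a x → Within a (size a x) x
within-size bool     b       = tt
within-size nat      n       = ≤-refl
within-size (list a) []      = z≤n , []
within-size (list a) (x ∷ l) =
  let len , ws = within-size (list a) l
  in s≤s (≤-trans len (m≤n+m _ _)) ,
     Within-mono a x (≤-trans (m≤m+n _ _) (n≤1+n _)) (within-size a x) ∷
     All.map (Within-mono a _ (≤-trans (m≤n+m _ _) (n≤1+n _))) ws
within-size (a ⊗ b)  (x , y) =
  Within-mono a x (m≤m+n _ _) (within-size a x) , Within-mono b y (m≤n+m _ _) (within-size b y)

foldl-time : ∀ {Γ a b} (f : Tm (a ∷ b ∷ Γ) b) z l γ {Q : ⟦ a ⟧ → Set} (P : ℕ → ⟦ b ⟧ → Set) c →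
  (∀ {j x y} → Q x → P (suc j) y → time f (x , y , γ) ≤ c × P j (run f (x , y , γ))) →
  All.All Q (run l γ) → P (List.length (run l γ)) (run z γ) →
  time (foldl f z l) γ ≤ time l γ + (time z γ + (10 + List.length (run l γ) * (22 + c)))
    × P 0 (run (foldl f z l) γ)
foldl-time f z l γ P c h qs p = let le , p′ = loopTime≤ P c h (run l γ) qs p in
  +-monoʳ-≤ (time l γ) (≤-trans (+-monoʳ-≤ 4 (+-monoʳ-≤ (time z γ) (+-monoˡ-≤ 3 le)))
    (≤-reflexive (regroup (time z γ) _))) , p′
  where
  regroup : ∀ a b → 4 + (a + (3 + b + 3)) ≡ a + (10 + b)
  regroup = solve-∀

foldr-time : ∀ {Γ a b} (f : Tm (a ∷ b ∷ Γ) b) z l γ {Q : ⟦ a ⟧ → Set} (P : ℕ → ⟦ b ⟧ → Set) c →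
  (∀ {j x y} → Q x → P (suc j) y → time f (x , y , γ) ≤ c × P j (run f (x , y , γ))) →
  All.All Q (run l γ) → P (List.length (run l γ)) (run z γ) →
  time (foldr f z l) γ ≤ time l γ + (time z γ + (20 + List.length (run l γ) * (38 + c)))
    × P 0 (run (foldr f z l) γ)
foldr-time {b = b} f z l γ P c h qs p
  with loopTime≤ P c h (List.reverse (run l γ)) {run z γ} (All.tabulate (λ i → All.lookup qs (reverse⁻ i))) (subst (λ n → P n (run z γ)) (sym (length-reverse (run l γ))) p)
... | le , p′ =
  +-monoʳ-≤ (time l γ) (≤-trans (+-monoʳ-≤ 4 (+-mono-≤ (≤-reflexive (cong (λ n → 2 + (n + 5)) (reversalTime≡ (run l γ))))
    (+-monoʳ-≤ (time z γ) (+-monoˡ-≤ 3 (≤-trans le (≤-reflexive (cong (λ n → 3 + n * (22 + c)) (length-reverse (run l γ)))))))))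
    (≤-reflexive (regroup (time z γ) (List.length (run l γ)) c))) ,
  subst (P 0) (reverse-foldl (λ y x → run f (x , y , γ)) (run z γ) (run l γ)) p′
  where
  regroup : ∀ a n c → 4 + (2 + (3 + n * 16 + 5) + (a + (3 + n * (22 + c) + 3))) ≡ a + (20 + n * (38 + c))
  regroup = solve-∀

-- Growth bounded by a function of a parameter times a polynomial in a size.

-- The base `suc n` is positive, so the bound is also monotone in the degree and sums can be brought
-- to a common degree.
monomial : ℕ → ℕ → ℕ → ℕ
monomial c d n = c * suc n ^ d

monomial-mono : ∀ c d {m n} → m ≤ n → monomial c d m ≤ monomial c d n
monomial-mono c d m≤n = *-monoʳ-≤ c (^-monoˡ-≤ d (s≤s m≤n))

Bounded : {I P : Set} → (I → P) → (I → ℕ) → (I → ℕ) → Set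
Bounded {I} {P} p s g = Σ[ f ∈ (P → ℕ) ] Σ[ d ∈ ℕ ] ∀ i → g i ≤ monomial (f (p i)) d (s i)

module _ {I P : Set} {p : I → P} {s : I → ℕ} where

  Bounded-≤ : ∀ {g h} → (∀ i → g i ≤ h i) → Bounded p s h → Bounded p s g
  Bounded-≤ le (f , d , bound) = f , d , λ i → ≤-trans (le i) (bound i)

  Bounded-param : ∀ (f : P → ℕ) → Bounded p s (λ i → f (p i))
  Bounded-param f = f , 0 , λ i → ≤-reflexive (sym (*-identityʳ _))

  Bounded-const : ∀ c → Bounded p s (λ _ → c)
  Bounded-const c = Bounded-param (λ _ → c)

  Bounded-size : Bounded p s s
  Bounded-size = (λ _ → 1) , 1 , λ i → ≤-trans (n≤1+n _) (≤-reflexive (sym (trans (*-identityˡ _) (*-identityʳ _))))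

  Bounded-+ : ∀ {g h} → Bounded p s g → Bounded p s h → Bounded p s (λ i → g i + h i)
  Bounded-+ {g} {h} (f , d , le) (f′ , d′ , le′) = (λ q → f q + f′ q) , d + d′ , λ i →
    let k = f (p i) ; k′ = f′ (p i) ; X = suc (s i) in begin
    g i + h i                              ≤⟨ +-mono-≤ (le i) (le′ i) ⟩
    k * X ^ d + k′ * X ^ d′                ≤⟨ +-mono-≤ (*-monoʳ-≤ k (^-monoʳ-≤ X (m≤m+n d d′)))
                                                       (*-monoʳ-≤ k′ (^-monoʳ-≤ X (m≤n+m d′ d))) ⟩
    k * X ^ (d + d′) + k′ * X ^ (d + d′)   ≡⟨ sym (*-distribʳ-+ _ k k′) ⟩
    (k + k′) * X ^ (d + d′)                ∎
    where open ≤-Reasoning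

  Bounded-* : ∀ {g h} → Bounded p s g → Bounded p s h → Bounded p s (λ i → g i * h i)
  Bounded-* {g} {h} (f , d , le) (f′ , d′ , le′) = (λ q → f q * f′ q) , d + d′ , λ i →
    let k = f (p i) ; k′ = f′ (p i) ; X = suc (s i) in begin
    g i * h i                      ≤⟨ *-mono-≤ (le i) (le′ i) ⟩
    (k * X ^ d) * (k′ * X ^ d′)    ≡⟨ regroup k (X ^ d) k′ (X ^ d′) ⟩
    (k * k′) * (X ^ d * X ^ d′)    ≡⟨ cong ((k * k′) *_) (sym (^-distribˡ-+-* X d d′)) ⟩
    (k * k′) * X ^ (d + d′)        ∎
    where
    open ≤-Reasoning
    regroup : ∀ a b c d → (a * b) * (c * d) ≡ (a * c) * (b * d)
    regroup = solve-∀

  Bounded-monomial : ∀ c d {g} → Bounded p s g → Bounded p s (λ i → monomial c d (g i))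
  Bounded-monomial c d {g} b = Bounded-* (Bounded-const c) (power d)
    where
    power : ∀ d → Bounded p s (λ i → suc (g i) ^ d)
    power zero    = Bounded-const 1
    power (suc d) = Bounded-* (Bounded-+ (Bounded-const 1) b) (power d)

-- Powers of 1 + X as coefficient lists

-- The polynomial `a + (1 + X) p`; in the recursion `a` is the preceding coefficient, which the
-- factor X moves up by one place.
times1+X : ℕ → Polynomial → Polynomial
times1+X a []      = a ∷ []
times1+X a (c ∷ p) = a + c ∷ times1+X c p

eval-times1+X : ∀ a p x → evalPoly (times1+X a p) x ≡ a + suc x * evalPoly p x
eval-times1+X a []      x = cong (a +_) (trans (*-zeroʳ x) (sym (*-zeroʳ x)))
eval-times1+X a (c ∷ p) x rewrite eval-times1+X c p x =
  regroup a c x (evalPoly p x)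
  where
  regroup : ∀ a c x e → a + c + x * (c + (1 + x) * e) ≡ a + (1 + x) * (c + x * e)
  regroup = solve-∀

[1+X]^ : ℕ → Polynomial
[1+X]^ zero    = 1 ∷ []
[1+X]^ (suc d) = times1+X 0 ([1+X]^ d)

eval-[1+X]^ : ∀ d x → evalPoly ([1+X]^ d) x ≡ suc x ^ d
eval-[1+X]^ zero    x = cong suc (*-zeroʳ x)
eval-[1+X]^ (suc d) x = trans (eval-times1+X 0 ([1+X]^ d) x) (cong (suc x *_) (eval-[1+X]^ d x))

-- Polynomial time for terms and folds

-- Over the one-element parameter type the factor is a constant, so this is a polynomial bound in
-- `σ`. The measure `σ` is chosen for each term and may ignore arguments that are only copied.
record PolyTime {Γ a} (t : Tm Γ a) (σ : Env Γ → ℕ) : Set where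
  constructor polynomial
  field bound : Bounded (λ _ → tt) σ (time t)

module _ {I P : Set} {p : I → P} {s : I → ℕ} where

  call-Bounded : ∀ {Γ a} {t : Tm Γ a} {σ : Env Γ → ℕ} → PolyTime t σ →
    {γ : I → Env Γ} → Bounded p s (λ i → σ (γ i)) → Bounded p s (λ i → time t (γ i))
  call-Bounded (polynomial (f , d , le)) b = Bounded-≤ (λ i → le _) (Bounded-monomial (f tt) d b)

  time-Bounded : ∀ {Γ a} (t : Tm Γ a) (γ : I → Env Γ) → Bounded p s (λ i → heavy t (γ i)) → Bounded p s (λ i → time t (γ i))
  time-Bounded t γ b = Bounded-≤ (λ i → time≤ t (γ i)) (Bounded-+ (Bounded-const (overhead t)) b)

  foldl-Bounded : ∀ {Γ a b} (f : Tm (a ∷ b ∷ Γ) b) z l (γ : I → Env Γ)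
    (Q : I → ⟦ a ⟧ → Set) (R : I → ℕ → ⟦ b ⟧ → Set) (c : I → ℕ) →
    (∀ i {j x y} → Q i x → R i (suc j) y → heavy f (x , y , γ i) ≤ c i × R i j (run f (x , y , γ i))) →
    (∀ i → All.All (Q i) (run l (γ i))) → (∀ i → R i (List.length (run l (γ i))) (run z (γ i))) →
    Bounded p s (λ i → heavy l (γ i)) → Bounded p s (λ i → heavy z (γ i)) →
    Bounded p s (λ i → List.length (run l (γ i))) → Bounded p s c →
    Bounded p s (λ i → time (foldl f z l) (γ i))
  foldl-Bounded f z l γ Q R c step all start bl bz blen bc = Bounded-≤
    (λ i → proj₁ (foldl-time f z l (γ i) {Q = Q i} (R i) (overhead f + c i)
      (λ {_} {x} {y} q r → ≤-trans (time≤ f (x , y , γ i)) (+-monoʳ-≤ (overhead f) (proj₁ (step i q r))) , proj₂ (step i q r))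
      (all i) (start i)))
    (Bounded-+ (time-Bounded l γ bl) (Bounded-+ (time-Bounded z γ bz)
      (Bounded-+ (Bounded-const 10) (Bounded-* blen (Bounded-+ (Bounded-const 22) (Bounded-+ (Bounded-const (overhead f)) bc))))))

  foldr-Bounded : ∀ {Γ a b} (f : Tm (a ∷ b ∷ Γ) b) z l (γ : I → Env Γ)
    (Q : I → ⟦ a ⟧ → Set) (R : I → ℕ → ⟦ b ⟧ → Set) (c : I → ℕ) →
    (∀ i {j x y} → Q i x → R i (suc j) y → heavy f (x , y , γ i) ≤ c i × R i j (run f (x , y , γ i))) →
    (∀ i → All.All (Q i) (run l (γ i))) → (∀ i → R i (List.length (run l (γ i))) (run z (γ i))) →
    Bounded p s (λ i → heavy l (γ i)) → Bounded p s (λ i → heavy z (γ i)) →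
    Bounded p s (λ i → List.length (run l (γ i))) → Bounded p s c →
    Bounded p s (λ i → time (foldr f z l) (γ i))
  foldr-Bounded f z l γ Q R c step all start bl bz blen bc = Bounded-≤
    (λ i → proj₁ (foldr-time f z l (γ i) {Q = Q i} (R i) (overhead f + c i)
      (λ {_} {x} {y} q r → ≤-trans (time≤ f (x , y , γ i)) (+-monoʳ-≤ (overhead f) (proj₁ (step i q r))) , proj₂ (step i q r))
      (all i) (start i)))
    (Bounded-+ (time-Bounded l γ bl) (Bounded-+ (time-Bounded z γ bz)
      (Bounded-+ (Bounded-const 20) (Bounded-* blen (Bounded-+ (Bounded-const 38) (Bounded-+ (Bounded-const (overhead f)) bc))))))

  foldl-light : ∀ {Γ a b} (f : Tm (a ∷ b ∷ Γ) b) z l (γ : I → Env Γ) → (∀ γ → heavy f γ ≡ 0) →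
    Bounded p s (λ i → heavy l (γ i)) → Bounded p s (λ i → heavy z (γ i)) →
    Bounded p s (λ i → List.length (run l (γ i))) →
    Bounded p s (λ i → time (foldl f z l) (γ i))
  foldl-light f z l γ h bl bz blen = foldl-Bounded f z l γ (λ _ _ → ⊤) (λ _ _ _ → ⊤) (λ _ → 0)
    (λ i _ _ → ≤-reflexive (h _) , tt) (λ i → All.universal (λ _ → tt) _) (λ _ → tt) bl bz blen (Bounded-const 0)

  foldr-light : ∀ {Γ a b} (f : Tm (a ∷ b ∷ Γ) b) z l (γ : I → Env Γ) → (∀ γ → heavy f γ ≡ 0) →
    Bounded p s (λ i → heavy l (γ i)) → Bounded p s (λ i → heavy z (γ i)) →
    Bounded p s (λ i → List.length (run l (γ i))) →
    Bounded p s (λ i → time (foldr f z l) (γ i))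
  foldr-light f z l γ h bl bz blen = foldr-Bounded f z l γ (λ _ _ → ⊤) (λ _ _ _ → ⊤) (λ _ → 0)
    (λ i _ _ → ≤-reflexive (h _) , tt) (λ i → All.universal (λ _ → tt) _) (λ _ → tt) bl bz blen (Bounded-const 0)

-- Programs for reversing and zipping lists

pattern v0 = var here
pattern v1 = var (there here)
pattern v2 = var (there (there here))
pattern v3 = var (there (there (there here)))
pattern v4 = var (there (there (there (there here))))

trivially : ∀ {A : Set} (l : List A) → All.All (λ _ → ⊤) l
trivially = All.universal (λ _ → tt)

len : ∀ {A : Set} → List A → ℕ
len = List.length

len₁ : ∀ {a Γ} → Env (list a ∷ Γ) → ℕ
len₁ (k , _) = len k

len₂ : ∀ {a b Γ} → Env (list a ∷ list b ∷ Γ) → ℕ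
len₂ (k , l , _) = len k + len l

opaque
  revAppend : ∀ {a} → Tm (list a ∷ list a ∷ []) (list a)
  revAppend = foldl (cons v0 v1) v1 v0

  run-revAppend : ∀ {a} (x y : List ⟦ a ⟧) → run (revAppend {a}) (x , y , tt) ≡ x List.ʳ++ y
  run-revAppend x y = refl

  revAppend-time : ∀ {a} → PolyTime (revAppend {a}) len₁
  revAppend-time = polynomial $ foldl-light (cons v0 v1) v1 v0 (λ γ → γ) (λ _ → refl)
    (Bounded-const 0) (Bounded-const 0) Bounded-size

zipPad : ∀ a b → List ⟦ a ⟧ → List ⟦ b ⟧ → List (⟦ a ⟧ × ⟦ b ⟧)
zipPad a b []      []      = []
zipPad a b []      (y ∷ l) = (default a , y) ∷ zipPad a b [] l
zipPad a b (x ∷ k) l       = (x , headOr b l) ∷ zipPad a b k (List.drop 1 l)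

len-drop : ∀ {A : Set} (l : List A) → len (List.drop 1 l) ≤ len l
len-drop []      = z≤n
len-drop (x ∷ l) = n≤1+n _

len-zipPad : ∀ a b k l → len (zipPad a b k l) ≤ len k + len l
len-zipPad a b []      []      = z≤n
len-zipPad a b []      (y ∷ l) = s≤s (len-zipPad a b [] l)
len-zipPad a b (x ∷ k) l       = s≤s (≤-trans (len-zipPad a b k (List.drop 1 l)) (+-monoʳ-≤ (len k) (len-drop l)))

module _ {a b : Ty} where

  zipStep : Tm (a ∷ (list b ⊗ list (a ⊗ b)) ∷ list a ∷ list b ∷ []) (list b ⊗ list (a ⊗ b))
  zipStep = pair (op tl (op fst v1)) (cons (pair v0 (hd (op fst v1))) (op snd v1))

  padStep : Tm (b ∷ list (a ⊗ b) ∷ list b ∷ list (a ⊗ b) ∷ []) (list (a ⊗ b))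
  padStep = cons (pair (con (default a)) v0) v1

  opaque
    -- A fold traverses one list only, so the second list is consumed inside the accumulator, and
    -- `padRest` deals with what remains of it. Both collect their results in reverse; `revAppend`
    -- restores the order.
    zipFirst : Tm (list a ∷ list b ∷ []) (list b ⊗ list (a ⊗ b))
    zipFirst = foldl zipStep (pair v1 (con [])) v0

    padRest : Tm (list b ∷ list (a ⊗ b) ∷ []) (list (a ⊗ b))
    padRest = foldl padStep v1 v0

    padRest-run : ∀ l r → run padRest (l , r , tt) ≡ zipPad a b [] l List.ʳ++ r
    padRest-run []      r = refl
    padRest-run (y ∷ l) r = padRest-run l ((default a , y) ∷ r)

    zipFirst-run : ∀ k l → let (l′ , r) = run zipFirst (k , l , tt) in
      zipPad a b [] l′ List.ʳ++ r ≡ zipPad a b k l List.ʳ++ []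
    zipFirst-run k l = go k l []
      where
      go : ∀ k l (r : List (⟦ a ⟧ × ⟦ b ⟧)) → let p = List.foldl (λ (p : List ⟦ b ⟧ × List (⟦ a ⟧ × ⟦ b ⟧)) x → (List.drop 1 (proj₁ p) , (x , headOr b (proj₁ p)) ∷ proj₂ p)) (l , r) k in
        zipPad a b [] (proj₁ p) List.ʳ++ proj₂ p ≡ zipPad a b k l List.ʳ++ r
      go []      l r = refl
      go (x ∷ k) l r = go k (List.drop 1 l) ((x , headOr b l) ∷ r)

    zipFirst-len : ∀ k l → len (proj₁ (run zipFirst (k , l , tt))) ≤ len l
    zipFirst-len k l = go k l []
      where
      go : ∀ k l (r : List (⟦ a ⟧ × ⟦ b ⟧)) → len (proj₁ (List.foldl (λ (p : List ⟦ b ⟧ × List (⟦ a ⟧ × ⟦ b ⟧)) x → (List.drop 1 (proj₁ p) , (x , headOr b (proj₁ p)) ∷ proj₂ p)) (l , r) k)) ≤ len l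
      go []      l r = ≤-refl
      go (x ∷ k) l r = ≤-trans (go k _ _) (len-drop l)

    zipFirst-time : PolyTime zipFirst len₁
    zipFirst-time = polynomial $ foldl-light zipStep (pair v1 (con [])) v0 (λ γ → γ) (λ _ → refl)
      (Bounded-const 0) (Bounded-const 0) Bounded-size

    padRest-time : PolyTime padRest len₁
    padRest-time = polynomial $ foldl-light padStep v1 v0 (λ γ → γ) (λ _ → refl)
      (Bounded-const 0) (Bounded-const 0) Bounded-size

  ʳ++-cancel : ∀ {A : Set} (x y : List A) → (x List.ʳ++ y) List.ʳ++ [] ≡ y List.ʳ++ x
  ʳ++-cancel []      y = refl
  ʳ++-cancel (c ∷ x) y = ʳ++-cancel x (c ∷ y)

  opaque
    zipTm : Tm (list a ∷ list b ∷ []) (list (a ⊗ b))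
    zipTm = bind (call zipFirst (v0 ∷ v1 ∷ [])) (call revAppend (call padRest (op fst v0 ∷ op snd v0 ∷ []) ∷ con [] ∷ []))

    zipTm-run : ∀ k l → run zipTm (k , l , tt) ≡ zipPad a b k l
    zipTm-run k l = begin
      run revAppend (run padRest (l′ , r , tt) , [] , tt)   ≡⟨ run-revAppend _ _ ⟩
      run padRest (l′ , r , tt) List.ʳ++ []                 ≡⟨ cong (List._ʳ++ []) (trans (padRest-run l′ r) (zipFirst-run k l)) ⟩
      (zipPad a b k l List.ʳ++ []) List.ʳ++ []              ≡⟨ ʳ++-cancel (zipPad a b k l) [] ⟩
      zipPad a b k l                                        ∎
      where
      open ≡-Reasoning
      l′ : List ⟦ b ⟧
      l′ = proj₁ (run zipFirst (k , l , tt))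
      r : List (⟦ a ⟧ × ⟦ b ⟧)
      r  = proj₂ (run zipFirst (k , l , tt))

    zipTm-time : PolyTime zipTm len₂
    zipTm-time = polynomial $ time-Bounded zipTm (λ γ → γ) (Bounded-+
      (call-Bounded zipFirst-time (Bounded-≤ (λ (k , l , _) → m≤m+n (len k) (len l)) Bounded-size))
      (Bounded-+ (Bounded-+
        (call-Bounded padRest-time (Bounded-≤ (λ (k , l , _) → ≤-trans (zipFirst-len k l) (m≤n+m (len l) (len k))) Bounded-size))
        (Bounded-const 0))
      (call-Bounded revAppend-time (Bounded-≤ (λ (k , l , _) → ≤-trans (≤-reflexive (trans
          (cong len (trans (padRest-run (proj₁ (run zipFirst (k , l , tt))) (proj₂ (run zipFirst (k , l , tt)))) (zipFirst-run k l)))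
          (trans (length-ʳ++ (zipPad a b k l)) (+-identityʳ _)))) (len-zipPad a b k l)) Bounded-size))))

-- Binary arithmetic

bit : Bool → ℕ
bit false = 0
bit true  = 1

val : List Bool → ℕ
val []      = 0
val (b ∷ x) = bit b + 2 * val x

-- The bits of `x` are pushed one by one below the number `n`; this evaluates digits that were
-- collected in reverse.
valʳ : List Bool → ℕ → ℕ
valʳ []      n = n
valʳ (b ∷ x) n = valʳ x (bit b + 2 * n)

val-ʳ++ : ∀ x y → val (x List.ʳ++ y) ≡ valʳ x (val y)
val-ʳ++ []      y = refl
val-ʳ++ (b ∷ x) y = val-ʳ++ x (b ∷ y)

xor₃ majority : ∀ {Γ} → Tm (bool ∷ bool ∷ bool ∷ Γ) bool
xor₃     = cond v0 (cond v1 v2 (cond v2 (con false) (con true))) (cond v1 (cond v2 (con false) (con true)) v2)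
majority = cond v0 (cond v1 (con true) v2) (cond v1 v2 (con false))

full-adder : ∀ c y x {Γ} {γ : Env Γ} →
  bit (run xor₃ (c , y , x , γ)) + 2 * bit (run majority (c , y , x , γ)) ≡ bit x + bit y + bit c
full-adder true  true  true  = refl
full-adder true  true  false = refl
full-adder true  false true  = refl
full-adder true  false false = refl
full-adder false true  true  = refl
full-adder false true  false = refl
full-adder false false true  = refl
full-adder false false false = refl

addStep : ∀ {Γ} → Tm ((bool ⊗ bool) ∷ (bool ⊗ list bool) ∷ Γ) (bool ⊗ list bool)
addStep = bind (op fst v0) (bind (op snd v1) (bind (op fst v3) (pair majority (cons xor₃ (op snd v4)))))

pairSum : List (Bool × Bool) → ℕ
pairSum []            = 0
pairSum ((x , y) ∷ l) = bit x + bit y + 2 * pairSum l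

pairSum-zip : ∀ x y → pairSum (zipPad bool bool x y) ≡ val x + val y
pairSum-zip []      []      = refl
pairSum-zip []      (b ∷ y) rewrite pairSum-zip [] y = refl
pairSum-zip (a ∷ x) []      rewrite pairSum-zip x [] = regroup (bit a) (val x)
  where
  regroup : ∀ a x → a + 0 + 2 * (x + 0) ≡ a + 2 * x + 0
  regroup = solve-∀
pairSum-zip (a ∷ x) (b ∷ y) rewrite pairSum-zip x y = regroup (bit a) (val x) (bit b) (val y)
  where
  regroup : ∀ a x b y → a + b + 2 * (x + y) ≡ a + 2 * x + (b + 2 * y)
  regroup = solve-∀

carries : List (Bool × Bool) → Bool × List Bool → Bool × List Bool
carries l s = List.foldl (λ s p → run addStep (p , s , tt)) s l

-- The invariant of addition: the digits written so far keep the same total value together with the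
-- carry and the sum still to be formed above them. The full adder is exactly one step of this.
carries-value : ∀ l c r → let (c′ , r′) = carries l (c , r) in valʳ r′ (bit c′) ≡ valʳ r (bit c + pairSum l)
carries-value []            c r = cong (valʳ r) (sym (+-identityʳ _))
carries-value ((x , y) ∷ l) c r = trans
  (carries-value l (run majority (c , y , x , tt)) (run xor₃ (c , y , x , tt) ∷ r))
  (cong (valʳ r) (trans
    (regroup (bit (run xor₃ (c , y , x , tt))) (bit (run majority (c , y , x , tt))) (pairSum l))
    (trans (cong (_+ 2 * pairSum l) (full-adder c y x {γ = tt})) (regroup′ (bit x + bit y) (bit c) (pairSum l)))))
  where
  regroup : ∀ s c p → s + 2 * (c + p) ≡ s + 2 * c + 2 * p
  regroup = solve-∀
  regroup′ : ∀ a c p → a + c + 2 * p ≡ c + (a + 2 * p)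
  regroup′ = solve-∀

carries-len : ∀ l c r → len (proj₂ (carries l (c , r))) ≡ len l + len r
carries-len []      c r = refl
carries-len ((x , y) ∷ l) c r = trans (carries-len l (run majority (c , y , x , tt)) (run xor₃ (c , y , x , tt) ∷ r)) (+-suc (len l) (len r))

opaque
  carriesTm : Tm (list (bool ⊗ bool) ∷ []) (bool ⊗ list bool)
  carriesTm = foldl addStep (con (false , [])) v0

  carriesTm-run : ∀ l → run carriesTm (l , tt) ≡ carries l (false , [])
  carriesTm-run l = refl

  carriesTm-time : PolyTime carriesTm len₁
  carriesTm-time = polynomial $ foldl-light addStep (con (false , [])) v0 (λ γ → γ) (λ _ → refl)
    (Bounded-const 0) (Bounded-const 0) Bounded-size

opaque
  addTm : Tm (list bool ∷ list bool ∷ []) (list bool)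
  addTm = bind (call carriesTm (call zipTm (v0 ∷ v1 ∷ []) ∷ [])) (call revAppend (op snd v0 ∷ cons (op fst v0) (con []) ∷ []))

  addTm-val : ∀ x y → val (run addTm (x , y , tt)) ≡ val x + val y
  addTm-val x y rewrite zipTm-run {bool} {bool} x y | carriesTm-run (zipPad bool bool x y) = begin
    val (run revAppend (r , c ∷ [] , tt))        ≡⟨ cong val (run-revAppend r (c ∷ [])) ⟩
    val (r List.ʳ++ (c ∷ []))                    ≡⟨ val-ʳ++ r (c ∷ []) ⟩
    valʳ r (bit c + 0)                           ≡⟨ cong (valʳ r) (+-identityʳ _) ⟩
    valʳ r (bit c)                               ≡⟨ carries-value (zipPad bool bool x y) false [] ⟩
    pairSum (zipPad bool bool x y)               ≡⟨ pairSum-zip x y ⟩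
    val x + val y                                ∎
    where
    open ≡-Reasoning
    c : Bool
    c = proj₁ (carries (zipPad bool bool x y) (false , []))
    r : List Bool
    r = proj₂ (carries (zipPad bool bool x y) (false , []))

  len-carries : ∀ x y → len (proj₂ (run carriesTm (run zipTm (x , y , tt) , tt))) ≡ len (zipPad bool bool x y)
  len-carries x y rewrite zipTm-run {bool} {bool} x y | carriesTm-run (zipPad bool bool x y) =
    trans (carries-len (zipPad bool bool x y) false []) (+-identityʳ _)

  -- Having the maximum here instead of the sum makes the numbers in `mulTm` grow by at most two
  -- bits per round.
  addTm-len : ∀ x y → len (run addTm (x , y , tt)) ≤ suc (len x ⊔ len y)
  addTm-len x y = ≤-trans
    (≤-reflexive (trans (cong len (run-revAppend (proj₂ p) (proj₁ p ∷ []))) (trans (length-ʳ++ (proj₂ p)) (cong (_+ 1) (len-carries x y)))))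
    (≤-trans (≤-reflexive (+-comm _ 1)) (s≤s (len-zip⊔ x y)))
    where
    p : Bool × List Bool
    p = run carriesTm (run zipTm (x , y , tt) , tt)
    len-zip⊔ : ∀ x y → len (zipPad bool bool x y) ≤ len x ⊔ len y
    len-zip⊔ []      []      = z≤n
    len-zip⊔ []      (b ∷ y) = s≤s (len-zip⊔ [] y)
    len-zip⊔ (a ∷ x) []      = s≤s (≤-trans (len-zip⊔ x []) (≤-reflexive (⊔-identityʳ _)))
    len-zip⊔ (a ∷ x) (b ∷ y) = s≤s (len-zip⊔ x y)

  addTm-time : PolyTime addTm len₂
  addTm-time = polynomial $ time-Bounded addTm (λ γ → γ) (Bounded-+
    (Bounded-+ (Bounded-+ (call-Bounded zipTm-time Bounded-size) (Bounded-const 0))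
      (call-Bounded carriesTm-time (Bounded-≤ (λ (x , y , _) → ≤-trans (≤-reflexive (cong len (zipTm-run x y))) (len-zipPad bool bool x y)) Bounded-size)))
    (Bounded-+ (Bounded-const 0)
      (call-Bounded revAppend-time (Bounded-≤ (λ (x , y , _) → ≤-trans (≤-reflexive (len-carries x y)) (len-zipPad bool bool x y)) Bounded-size))))

decStep : ∀ {Γ} → Tm (bool ∷ (bool ⊗ list bool) ∷ Γ) (bool ⊗ list bool)
decStep = cond (op fst v1)
  (cond v0 (pair (con false) (cons (con false) (op snd v1))) (pair (con true) (cons (con true) (op snd v1))))
  (pair (con false) (cons v0 (op snd v1)))

opaque
  borrowsTm : Tm (list bool ∷ []) (bool ⊗ list bool)
  borrowsTm = foldl decStep (con (true , [])) v0

  borrows-value : ∀ x → 1 ≤ val x → suc (valʳ (proj₂ (run borrowsTm (x , tt))) 0) ≡ val x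
  borrows-value x 1≤x = go x 1≤x
    where
    borrows : List Bool → Bool × List Bool → Bool × List Bool
    borrows l s = List.foldl (λ s b → run decStep (b , s , tt)) s l
    noBorrow : ∀ x r → valʳ (proj₂ (borrows x (false , r))) 0 ≡ valʳ r (val x)
    noBorrow []      r = refl
    noBorrow (b ∷ x) r = noBorrow x (b ∷ r)
    borrowed : ∀ x r → 1 ≤ val x → valʳ (proj₂ (borrows x (true , r))) 0 ≡ valʳ r (pred (val x))
    borrowed (true  ∷ x) r p = noBorrow x (false ∷ r)
    -- Borrowing through a digit 0 uses `2 m - 1 = 1 + 2 (m - 1)`; as `m` is positive, `pred` is
    -- exact.
    borrowed (false ∷ x) r p with val x in eq
    ... | suc n = trans (borrowed x (true ∷ r) (≤-trans (s≤s z≤n) (≤-reflexive (sym eq))))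
                    (cong (valʳ r) (trans (cong (λ m → 1 + 2 * pred m) eq) (sym (+-suc n (n + 0)))))
    go : ∀ x → 1 ≤ val x → suc (valʳ (proj₂ (borrows x (true , []))) 0) ≡ val x
    go x p with val x in eq
    ... | suc n = cong suc (trans (borrowed x [] (≤-trans p (≤-reflexive (sym eq)))) (cong pred eq))

  borrowsTm-len : ∀ x → len (proj₂ (run borrowsTm (x , tt))) ≡ len x
  borrowsTm-len x = trans (go x true []) (+-identityʳ _)
    where
    go : ∀ x b r → len (proj₂ (List.foldl (λ s b → run decStep (b , s , tt)) (b , r) x)) ≡ len x + len r
    go []          b     r = refl
    go (true  ∷ x) true  r = trans (go x _ _) (+-suc (len x) (len r))
    go (false ∷ x) true  r = trans (go x _ _) (+-suc (len x) (len r))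
    go (c     ∷ x) false r = trans (go x _ _) (+-suc (len x) (len r))

  borrowsTm-time : PolyTime borrowsTm len₁
  borrowsTm-time = polynomial $ foldl-light decStep (con (true , [])) v0 (λ γ → γ) (λ _ → refl)
    (Bounded-const 0) (Bounded-const 0) Bounded-size

-- The result at 0 is junk; in a falling factorial it only occurs after a factor 0.
opaque
  decTm : Tm (list bool ∷ []) (list bool)
  decTm = call revAppend (op snd (call borrowsTm (v0 ∷ [])) ∷ con [] ∷ [])

  decTm-val : ∀ x → 1 ≤ val x → suc (val (run decTm (x , tt))) ≡ val x
  decTm-val x p = trans (cong suc (trans (cong val (run-revAppend r [])) (val-ʳ++ r []))) (borrows-value x p)
    where
    r : List Bool
    r = proj₂ (run borrowsTm (x , tt))

  decTm-len : ∀ x → len (run decTm (x , tt)) ≡ len x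
  decTm-len x = trans (cong len (run-revAppend r [])) (trans (length-ʳ++ r) (trans (+-identityʳ _) (borrowsTm-len x)))
    where
    r : List Bool
    r = proj₂ (run borrowsTm (x , tt))

  decTm-time : PolyTime decTm len₁
  decTm-time = polynomial $ time-Bounded decTm (λ γ → γ) (Bounded-+
    (Bounded-+ (call-Bounded borrowsTm-time Bounded-size) (Bounded-const 0))
    (call-Bounded revAppend-time (Bounded-≤ (λ (x , _) → ≤-reflexive (borrowsTm-len x)) Bounded-size)))

-- Horner's scheme: `foldr` meets the most significant bit first, doubles the accumulator and adds
-- the other factor for a digit 1.
mulStep : Tm (bool ∷ list bool ∷ list bool ∷ list bool ∷ []) (list bool)
mulStep = bind (cons (con false) v1) (cond v1 (call addTm (v4 ∷ v0 ∷ [])) v0)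

opaque
  mulTm : Tm (list bool ∷ list bool ∷ []) (list bool)
  mulTm = foldr mulStep (con []) v0

  mulTm-val : ∀ x y → val (run mulTm (x , y , tt)) ≡ val x * val y
  mulTm-val x y = go x
    where
    go : ∀ z → val (List.foldr (λ b acc → run mulStep (b , acc , x , y , tt)) [] z) ≡ val z * val y
    go []          = refl
    go (true ∷ z)  = trans (addTm-val y _) (trans (cong (λ n → val y + 2 * n) (go z)) (regroup (val z) (val y)))
      where
      regroup : ∀ z y → y + 2 * (z * y) ≡ (1 + 2 * z) * y
      regroup = solve-∀
    go (false ∷ z) = trans (cong (2 *_) (go z)) (sym (*-assoc 2 (val z) (val y)))

  mulStep-len : ∀ b acc x y {n} → len acc ≤ n → len y ≤ n → len (run mulStep (b , acc , x , y , tt)) ≤ 2 + n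
  mulStep-len true  acc x y p q = ≤-trans (addTm-len y (false ∷ acc)) (s≤s (⊔-lub (≤-trans q (n≤1+n _)) (s≤s p)))
  mulStep-len false acc x y p q = s≤s (≤-trans p (n≤1+n _))

  mulTm-len : ∀ x y → len (run mulTm (x , y , tt)) ≤ len y + 2 * len x
  mulTm-len x y = go x
    where
    go : ∀ z → len (List.foldr (λ b acc → run mulStep (b , acc , x , y , tt)) [] z) ≤ len y + 2 * len z
    go []      = z≤n
    go (b ∷ z) = ≤-trans (mulStep-len b _ x y (go z) (m≤m+n _ _)) (≤-reflexive (regroup (len y) (len z)))
      where
      regroup : ∀ y z → 2 + (y + 2 * z) ≡ y + 2 * (1 + z)
      regroup = solve-∀

  mulTm-time : PolyTime mulTm len₂
  mulTm-time = polynomial $ foldr-Bounded mulStep (con []) v0 (λ γ → γ) (λ _ _ → ⊤)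
    -- The larger of the two lengths grows by at most two bits per round, so reserving two bits for
    -- each remaining round gives an invariant.
    (λ (x , y , _) j acc → (len y ⊔ len acc) + 2 * j ≤ len y + 2 * len x)
    (λ (x , y , _) → monomial (proj₁ B tt) (proj₁ (proj₂ B)) (len y + suc (len y + 2 * len x)))
    (λ (x , y , _) {j} {b} {acc} _ R →
        ≤-trans (≤-reflexive (+-identityʳ _)) (≤-trans (proj₂ (proj₂ B) (y , false ∷ acc , tt))
          (monomial-mono (proj₁ B tt) (proj₁ (proj₂ B)) (+-monoʳ-≤ (len y) (s≤s (≤-trans (m≤n⊔m (len y) _) (≤-trans (m≤m+n _ _) R))))))
      , room b acc x y j R)
    (λ _ → trivially _) (λ (x , y , _) → ≤-reflexive (cong (_+ 2 * len x) (⊔-identityʳ (len y))))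
    (Bounded-const 0) (Bounded-const 0) lenx
    (Bounded-monomial (proj₁ B tt) (proj₁ (proj₂ B))
      (Bounded-+ leny (Bounded-+ (Bounded-const 1) (Bounded-+ leny (Bounded-* (Bounded-const 2) lenx)))))
    where
    B : Bounded (λ _ → tt) len₂ (time addTm)
    B = PolyTime.bound addTm-time
    room : ∀ b acc x y j → (len y ⊔ len acc) + 2 * suc j ≤ len y + 2 * len x →
      (len y ⊔ len (run mulStep (b , acc , x , y , tt))) + 2 * j ≤ len y + 2 * len x
    room b acc x y j R = ≤-trans
      (+-monoˡ-≤ (2 * j) (⊔-lub (≤-trans (m≤m⊔n (len y) (len acc)) (m≤n+m _ 2)) (mulStep-len b acc x y (m≤n⊔m (len y) _) (m≤m⊔n _ _))))
      (≤-trans (≤-reflexive (regroup (len y ⊔ len acc) j)) R)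
      where
      regroup : ∀ m j → 2 + m + 2 * j ≡ m + 2 * (1 + j)
      regroup = solve-∀
    lenx : Bounded (λ _ → tt) len₂ (λ (γ : Env (list bool ∷ list bool ∷ [])) → len (proj₁ γ))
    lenx = Bounded-≤ (λ (x , y , _) → m≤m+n (len x) _) Bounded-size
    leny : Bounded (λ _ → tt) len₂ (λ (γ : Env (list bool ∷ list bool ∷ [])) → len (proj₁ (proj₂ γ)))
    leny = Bounded-≤ (λ (x , y , _) → m≤n+m (len y) _) Bounded-size

-- Falling factorials and capacities

falling : ℕ → ℕ → ℕ
falling n zero    = 1
falling n (suc a) = (n ∸ a) * falling n a

falling-zero : ∀ {n a} → n < a → falling n a ≡ 0
falling-zero {n} {suc a} (s≤s n≤a) with m≤n⇒m<n∨m≡n n≤a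
... | inj₁ n<a  = trans (cong ((n ∸ a) *_) (falling-zero n<a)) (*-zeroʳ (n ∸ a))
... | inj₂ refl = cong (_* falling n n) (n∸n≡0 n)

fallStep : ∀ {Γ} → Tm (nat ∷ (list bool ⊗ list bool) ∷ Γ) (list bool ⊗ list bool)
fallStep = pair (call decTm (op fst v1 ∷ [])) (call mulTm (op fst v1 ∷ op snd v1 ∷ []))

sizes₃ : Env (nat ∷ list bool ∷ list bool ∷ []) → ℕ
sizes₃ (a , n , acc , _) = a + (len n + len acc)

opaque
  -- Starting from `acc` instead of 1 lets `capacityTm` thread a single product through all classes.
  fallFold : Tm (nat ∷ list bool ∷ list bool ∷ []) (list bool ⊗ list bool)
  fallFold = foldr fallStep (pair v1 v2) (op units v0)

  fallFold-val : ∀ a n acc → let (c , r) = run fallFold (a , n , acc , tt) in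
    (a ≤ val n → val c + a ≡ val n) × val r ≡ falling (val n) a * val acc
  fallFold-val a n acc = go a
    where
    go : ∀ m → let (c , r) = List.foldr (λ x y → run fallStep (x , y , a , n , acc , tt)) (n , acc) (List.replicate m 0) in
      (m ≤ val n → val c + m ≡ val n) × val r ≡ falling (val n) m * val acc
    go zero    = (λ _ → +-identityʳ _) , sym (+-identityʳ _)
    go (suc m) = let (p , q) = go m in
      (λ m<n → let e  = p (≤-trans (n≤1+n m) m<n)
                   1≤ = +-cancelʳ-≤ m 1 _ (≤-trans m<n (≤-reflexive (sym e)))
               in trans (+-suc _ m) (trans (cong (_+ m) (decTm-val c 1≤)) e)) ,
      trans (mulTm-val c r) (trans (cong (val c *_) q) (trans (sym (*-assoc (val c) _ (val acc))) (cong (_* val acc) (product p))))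
      where
      c r : List Bool
      c = proj₁ (List.foldr (λ x y → run fallStep (x , y , a , n , acc , tt)) (n , acc) (List.replicate m 0))
      r = proj₂ (List.foldr (λ x y → run fallStep (x , y , a , n , acc , tt)) (n , acc) (List.replicate m 0))
      product : (m ≤ val n → val c + m ≡ val n) → val c * falling (val n) m ≡ (val n ∸ m) * falling (val n) m
      product p with ≤-<-connex m (val n)
      ... | inj₁ m≤n = cong (_* falling (val n) m) (trans (sym (m+n∸n≡m (val c) m)) (cong (_∸ m) (p m≤n)))
      ... | inj₂ n<m = trans (zero-right (val c)) (sym (zero-right (val n ∸ m)))
        where
        zero-right : ∀ k → k * falling (val n) m ≡ 0
        zero-right k = trans (cong (k *_) (falling-zero n<m)) (*-zeroʳ k)

  fallFold-len : ∀ a n acc → let (c , r) = run fallFold (a , n , acc , tt) in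
    len c ≡ len n × len r ≤ len acc + a * (2 * len n)
  fallFold-len a n acc = go a
    where
    go : ∀ m → let (c , r) = List.foldr (λ x y → run fallStep (x , y , a , n , acc , tt)) (n , acc) (List.replicate m 0) in
      len c ≡ len n × len r ≤ len acc + m * (2 * len n)
    go zero    = refl , m≤m+n _ 0
    go (suc m) = let (p , q) = go m in
      trans (decTm-len _) p ,
      ≤-trans (mulTm-len _ _) (≤-trans (+-mono-≤ q (≤-reflexive (cong (2 *_) p))) (≤-reflexive (regroup (len acc) (m * (2 * len n)) (2 * len n))))
      where
      regroup : ∀ a b c → a + b + c ≡ a + (c + b)
      regroup = solve-∀

  fallFold-time : PolyTime fallFold sizes₃
  fallFold-time = polynomial $ foldr-Bounded fallStep (pair v1 v2) (op units v0) (λ γ → γ) (λ _ _ → ⊤)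
    -- The counter keeps its length, and by `mulTm-len` each multiplication lengthens the product by
    -- at most twice that length.
    (λ (a , n , acc , _) j (c , r) → len c ≡ len n × len r + j * (2 * len n) ≤ len acc + a * (2 * len n))
    (λ (a , n , acc , _) → monomial (proj₁ D tt) (proj₁ (proj₂ D)) (len n)
      + monomial (proj₁ M tt) (proj₁ (proj₂ M)) (len n + (len acc + a * (2 * len n))))
    (λ (a , n , acc , _) {j} {_} {cr} _ (p , q) → step a n acc j (proj₁ cr) (proj₂ cr) p q)
    (λ (a , _) → trivially _)
    (λ (a , n , acc , _) → refl , ≤-reflexive (cong (λ m → len acc + m * (2 * len n)) (length-replicate a)))
    (Bounded-const 0) (Bounded-const 0) (Bounded-≤ (λ (a , _) → ≤-reflexive (length-replicate a)) ba)
    (Bounded-+ (Bounded-monomial (proj₁ D tt) (proj₁ (proj₂ D)) bn)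
      (Bounded-monomial (proj₁ M tt) (proj₁ (proj₂ M)) (Bounded-+ bn (Bounded-+ bacc (Bounded-* ba (Bounded-* (Bounded-const 2) bn))))))
    where
    D : Bounded (λ _ → tt) len₁ (time decTm)
    D = PolyTime.bound decTm-time
    M : Bounded (λ _ → tt) len₂ (time mulTm)
    M = PolyTime.bound mulTm-time
    step : ∀ a (n acc : List Bool) j (c r : List Bool) → len c ≡ len n → len r + suc j * (2 * len n) ≤ len acc + a * (2 * len n) →
      time decTm (c , tt) + time mulTm (c , r , tt) ≤ monomial (proj₁ D tt) (proj₁ (proj₂ D)) (len n)
        + monomial (proj₁ M tt) (proj₁ (proj₂ M)) (len n + (len acc + a * (2 * len n)))
      × len (run decTm (c , tt)) ≡ len n × len (run mulTm (c , r , tt)) + j * (2 * len n) ≤ len acc + a * (2 * len n)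
    step a n acc j c r p q =
      +-mono-≤ (≤-trans (proj₂ (proj₂ D) (c , tt)) (monomial-mono (proj₁ D tt) (proj₁ (proj₂ D)) (≤-reflexive p)))
        (≤-trans (proj₂ (proj₂ M) (c , r , tt)) (monomial-mono (proj₁ M tt) (proj₁ (proj₂ M)) (+-mono-≤ (≤-reflexive p) (≤-trans (m≤m+n _ _) q))))
      , trans (decTm-len c) p
      , ≤-trans (+-monoˡ-≤ (j * (2 * len n)) (≤-trans (mulTm-len c r) (≤-reflexive (cong (λ m → len r + 2 * m) p))))
          (≤-trans (≤-reflexive (+-assoc (len r) _ _)) q)
    ba : Bounded (λ _ → tt) sizes₃ (λ (a , _) → a)
    ba = Bounded-≤ (λ (a , n , acc , _) → m≤m+n a _) Bounded-size
    bn : Bounded (λ _ → tt) sizes₃ (λ (a , n , _) → len n)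
    bn = Bounded-≤ (λ (a , n , acc , _) → ≤-trans (m≤m+n (len n) (len acc)) (m≤n+m _ a)) Bounded-size
    bacc : Bounded (λ _ → tt) sizes₃ (λ (a , n , acc , _) → len acc)
    bacc = Bounded-≤ (λ (a , n , acc , _) → ≤-trans (m≤n+m (len acc) (len n)) (m≤n+m _ a)) Bounded-size

Number×Number : Ty
Number×Number = list bool ⊗ list bool

-- The capacity of a type a: ∏ aᵢ! times the number of edges of type a.

capacity : List ℕ → List (List Bool × List Bool) → ℕ
capacity (a ∷ as) ((δ , n) ∷ xs) = falling (val n) a * capacity as xs
capacity _        _              = 1

-- The additional 1 per class makes the weight bound the number of classes too. On the input it
-- equals `k + inputSize xs`.
weight : List (List Bool × List Bool) → ℕ
weight []             = 0
weight ((δ , n) ∷ xs) = suc (len δ + len n + weight xs)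

len≤weight : ∀ xs → len xs ≤ weight xs
len≤weight []       = z≤n
len≤weight (x ∷ xs) = s≤s (≤-trans (len≤weight xs) (m≤n+m _ _))

len≤size : ∀ a (l : List ⟦ a ⟧) → len l ≤ size (list a) l
len≤size a []      = z≤n
len≤size a (x ∷ l) = s≤s (≤-trans (len≤size a l) (m≤n+m _ _))

capStep : ∀ {Γ} → Tm ((nat ⊗ Number×Number) ∷ list bool ∷ Γ) (list bool)
capStep = op snd (call fallFold (op fst v0 ∷ op snd (op snd v0) ∷ v1 ∷ []))

capSize : Env (list nat ∷ list Number×Number ∷ []) → ℕ
capSize (as , xs , _) = size (list nat) as + weight xs

opaque
  capacityTm : Tm (list nat ∷ list Number×Number ∷ []) (list bool)
  capacityTm = foldl capStep (con (true ∷ [])) (call zipTm (v0 ∷ v1 ∷ []))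

  capacityTm-val : ∀ as xs → len as ≡ len xs → val (run capacityTm (as , xs , tt)) ≡ capacity as xs
  capacityTm-val as xs eq rewrite zipTm-run {nat} {Number×Number} as xs = trans (go as xs (true ∷ []) eq) (*-identityʳ _)
    where
    go : ∀ bs ys acc → len bs ≡ len ys →
      val (List.foldl (λ y x → run capStep (x , y , as , xs , tt)) acc (zipPad nat Number×Number bs ys)) ≡ capacity bs ys * val acc
    go []       []             acc e = sym (+-identityʳ _)
    go (b ∷ bs) ((δ , n) ∷ ys) acc e = trans (go bs ys _ (suc-injective e))
      (trans (cong (capacity bs ys *_) (proj₂ (fallFold-val b n acc))) (regroup (capacity bs ys) (falling (val n) b) (val acc)))
      where
      regroup : ∀ c f a → c * (f * a) ≡ f * c * a
      regroup = solve-∀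

  -- An allowance of bits for one class: at most `size as` factors of at most `weight xs` bits, each
  -- lengthening the product by twice its own length.
  growth : Env (list nat ∷ list Number×Number ∷ []) → ℕ
  growth (as , xs , _) = size (list nat) as * (2 * weight xs)

  Small : Env (list nat ∷ list Number×Number ∷ []) → ℕ × (List Bool × List Bool) → Set
  Small (as , xs , _) (a , δ , n) = a ≤ size (list nat) as × len n ≤ weight xs

  Room : Env (list nat ∷ list Number×Number ∷ []) → ℕ → List Bool → Set
  Room (as , xs , _) j acc = len acc + j * growth (as , xs , tt) ≤ 1 + (len as + len xs) * growth (as , xs , tt)

  small : ∀ as xs bs ys → size (list nat) bs ≤ size (list nat) as → weight ys ≤ weight xs →
    All.All (Small (as , xs , tt)) (zipPad nat Number×Number bs ys)
  small as xs []       []             p q = []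
  small as xs []       ((δ , n) ∷ ys) p q = (z≤n , ≤-trans (≤-trans (m≤n+m (len n) (len δ)) (≤-trans (m≤m+n _ _) (n≤1+n _))) q) ∷
    small as xs [] ys p (≤-trans (≤-trans (m≤n+m (weight ys) _) (n≤1+n _)) q)
  small as xs (b ∷ bs) []             p q = (≤-trans (≤-trans (m≤m+n b _) (n≤1+n _)) p , z≤n) ∷
    small as xs bs [] (≤-trans (≤-trans (m≤n+m _ b) (n≤1+n _)) p) q
  small as xs (b ∷ bs) ((δ , n) ∷ ys) p q =
    (≤-trans (≤-trans (m≤m+n b _) (n≤1+n _)) p , ≤-trans (≤-trans (m≤n+m (len n) (len δ)) (≤-trans (m≤m+n _ _) (n≤1+n _))) q) ∷
    small as xs bs ys (≤-trans (≤-trans (m≤n+m _ b) (n≤1+n _)) p) (≤-trans (≤-trans (m≤n+m (weight ys) _) (n≤1+n _)) q)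

  room-step : ∀ as xs {j} x {acc} → Small (as , xs , tt) x → Room (as , xs , tt) (suc j) acc →
    Room (as , xs , tt) j (run capStep (x , acc , as , xs , tt))
  room-step as xs {j} (a , δ , n) {acc} (p , q) r = ≤-trans
    (+-monoˡ-≤ (j * growth (as , xs , tt)) (≤-trans (proj₂ (fallFold-len a n acc)) (+-monoʳ-≤ (len acc) (*-mono-≤ p (*-monoʳ-≤ 2 q)))))
    (≤-trans (≤-reflexive (+-assoc (len acc) (growth (as , xs , tt)) _)) r)

  room-start : ∀ as xs → Room (as , xs , tt) (len (run zipTm (as , xs , tt))) (true ∷ [])
  room-start as xs = s≤s (*-monoˡ-≤ (growth (as , xs , tt))
    (≤-trans (≤-reflexive (cong len (zipTm-run as xs))) (len-zipPad nat Number×Number as xs)))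

  all-small : ∀ as xs → All.All (Small (as , xs , tt)) (run zipTm (as , xs , tt))
  all-small as xs = subst (All.All _) (sym (zipTm-run as xs)) (small as xs as xs ≤-refl ≤-refl)

  capacityTm-len : ∀ as xs → len (run capacityTm (as , xs , tt)) ≤ 1 + (len as + len xs) * (size (list nat) as * (2 * weight xs))
  capacityTm-len as xs = ≤-trans (m≤m+n _ 0) (go (run zipTm (as , xs , tt)) (true ∷ []) (all-small as xs) (room-start as xs))
    where
    go : ∀ l acc → All.All (Small (as , xs , tt)) l → Room (as , xs , tt) (len l) acc →
      Room (as , xs , tt) 0 (List.foldl (λ y x → run capStep (x , y , as , xs , tt)) acc l)
    go []      acc []       r = r
    go (x ∷ l) acc (q ∷ qs) r = go l _ qs (room-step as xs {len l} x q r)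

  capacityTm-time : PolyTime capacityTm capSize
  capacityTm-time = polynomial $ foldl-Bounded capStep (con (true ∷ [])) (call zipTm (v0 ∷ v1 ∷ [])) (λ γ → γ) Small Room
    (λ (as , xs , _) → monomial (proj₁ F tt) (proj₁ (proj₂ F)) (size (list nat) as + (weight xs + (1 + (len as + len xs) * growth (as , xs , tt)))))
    (λ (as , xs , _) {j} {x} {acc} q r → step as xs x acc j q r , room-step as xs {j} x q r)
    (λ (as , xs , _) → all-small as xs) (λ (as , xs , _) → room-start as xs)
    (call-Bounded zipTm-time (Bounded-+ blen-as blen-xs))
    (Bounded-const 0)
    (Bounded-≤ (λ (as , xs , _) → ≤-trans (≤-reflexive (cong len (zipTm-run as xs))) (len-zipPad nat Number×Number as xs)) (Bounded-+ blen-as blen-xs))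
    (Bounded-monomial (proj₁ F tt) (proj₁ (proj₂ F)) (Bounded-+ bas (Bounded-+ bxs (Bounded-+ (Bounded-const 1)
      (Bounded-* (Bounded-+ blen-as blen-xs) (Bounded-* bas (Bounded-* (Bounded-const 2) bxs)))))))
    where
    F : Bounded (λ _ → tt) sizes₃ (time fallFold)
    F = PolyTime.bound fallFold-time
    step : ∀ as xs x acc j → Small (as , xs , tt) x → Room (as , xs , tt) (suc j) acc →
      time fallFold (proj₁ x , proj₂ (proj₂ x) , acc , tt) ≤
      monomial (proj₁ F tt) (proj₁ (proj₂ F)) (size (list nat) as + (weight xs + (1 + (len as + len xs) * growth (as , xs , tt))))
    step as xs (a , δ , n) acc j (p , q) r = ≤-trans (proj₂ (proj₂ F) (a , n , acc , tt))
      (monomial-mono (proj₁ F tt) (proj₁ (proj₂ F)) (+-mono-≤ p (+-mono-≤ q (≤-trans (m≤m+n _ _) r))))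
    bas : Bounded (λ _ → tt) capSize (λ (as , _) → size (list nat) as)
    bas = Bounded-≤ (λ (as , xs , _) → m≤m+n _ (weight xs)) Bounded-size
    bxs : Bounded (λ _ → tt) capSize (λ (_ , xs , _) → weight xs)
    bxs = Bounded-≤ (λ (as , xs , _) → m≤n+m _ (size (list nat) as)) Bounded-size
    blen-as : Bounded (λ _ → tt) capSize (λ (as , _) → len as)
    blen-as = Bounded-≤ (λ (as , _) → len≤size nat as) bas
    blen-xs : Bounded (λ _ → tt) capSize (λ (_ , xs , _) → len xs)
    blen-xs = Bounded-≤ (λ (_ , xs , _) → len≤weight xs) bxs

pattern v6 = var (there (there (there (there (there (there here))))))

-- Natural numbers in unary

opaque
  addN : Tm (nat ∷ nat ∷ []) nat
  addN = foldr (op succ v1) v1 (op units v0)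

  addN-run : ∀ m n → run addN (m , n , tt) ≡ m + n
  addN-run zero    n = refl
  addN-run (suc m) n = cong suc (go m)
    where
    go : ∀ j → List.foldr (λ _ y → suc y) n (List.replicate j 0) ≡ j + n
    go zero    = refl
    go (suc j) = cong suc (go j)

opaque
  mulN : Tm (nat ∷ nat ∷ []) nat
  mulN = foldr (call addN (v3 ∷ v1 ∷ [])) (con 0) (op units v0)

  mulN-run : ∀ m n → run mulN (m , n , tt) ≡ m * n
  mulN-run m n = go m
    where
    go : ∀ j → List.foldr (λ _ y → run addN (n , y , tt)) 0 (List.replicate j 0) ≡ j * n
    go zero    = refl
    go (suc j) = trans (addN-run n _) (cong (n +_) (go j))

opaque
  factorialTm : Tm (nat ∷ []) nat
  factorialTm = op snd (foldr (pair (op succ (op fst v1)) (call mulN (op succ (op fst v1) ∷ op snd v1 ∷ []))) (con (0 , 1)) (op units v0))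

  factorialTm-run : ∀ n → run factorialTm (n , tt) ≡ n !
  factorialTm-run n = cong proj₂ (go n)
    where
    go : ∀ j → List.foldr (λ _ (p : ℕ × ℕ) → suc (proj₁ p) , run mulN (suc (proj₁ p) , proj₂ p , tt)) (0 , 1) (List.replicate j 0) ≡ (j , j !)
    go zero    = refl
    go (suc j) rewrite go j = cong (suc j ,_) (mulN-run (suc j) (j !))

opaque
  -- The second number is decremented as often as the first one says. The flag records whether 0 was
  -- met too early, the final test whether something is left.
  eqN : Tm (nat ∷ nat ∷ []) bool
  eqN = bind (foldl (pair (op prec (op fst v1)) (cond (op fst v1) (op snd v1) (con false))) (pair v1 (con true)) (op units v0))
             (cond (op fst v0) (con false) (op snd v0))

  eqN-run : ∀ m n → run eqN (m , n , tt) ≡ (m ≡ᵇ n)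
  eqN-run m n = go m n
    where
    F : ℕ × Bool → ℕ → ℕ × Bool
    F s _ = pred (proj₁ s) , (ifᵇ truthy nat (proj₁ s) then proj₂ s else false)
    final : ℕ × Bool → Bool
    final s = ifᵇ truthy nat (proj₁ s) then false else proj₂ s
    stuck : ∀ j r → final (List.foldl F (r , false) (List.replicate j 0)) ≡ false
    stuck zero    zero    = refl
    stuck zero    (suc r) = refl
    stuck (suc j) zero    = stuck j zero
    stuck (suc j) (suc r) = stuck j r
    go : ∀ j r → final (List.foldl F (r , true) (List.replicate j 0)) ≡ (j ≡ᵇ r)
    go zero    zero    = refl
    go zero    (suc r) = refl
    go (suc j) zero    = stuck j zero
    go (suc j) (suc r) = go j r

opaque
  sumN : Tm (list nat ∷ []) nat
  sumN = foldr (call addN (v0 ∷ v1 ∷ [])) (con 0) v0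

  sumN-run : ∀ v → run sumN (v , tt) ≡ sumˡ v
  sumN-run v = go v
    where
    go : ∀ w → List.foldr (λ x y → run addN (x , y , tt)) 0 w ≡ sumˡ w
    go []      = refl
    go (x ∷ w) = trans (addN-run x _) (cong (x +_) (go w))

-- Vectors are lists that continue with zeros.

infixl 9 _‼_
_‼_ : List ℕ → ℕ → ℕ
[]      ‼ i     = 0
(x ∷ v) ‼ zero  = x
(x ∷ v) ‼ suc i = v ‼ i

infix 4 _≋_
_≋_ : List ℕ → List ℕ → Set
v ≋ w = ∀ i → v ‼ i ≡ w ‼ i

opaque
  addV : Tm (list nat ∷ list nat ∷ []) (list nat)
  addV = foldr (cons (call addN (op fst v0 ∷ op snd v0 ∷ [])) v1) (con []) (call zipTm (v0 ∷ v1 ∷ []))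

  addV-run : ∀ v w i → run addV (v , w , tt) ‼ i ≡ v ‼ i + w ‼ i
  addV-run v w i rewrite zipTm-run {nat} {nat} v w = go v w i
    where
    F : List (ℕ × ℕ) → List ℕ
    F = List.foldr (λ p r → run addN (proj₁ p , proj₂ p , tt) ∷ r) []
    go : ∀ v w i → F (zipPad nat nat v w) ‼ i ≡ v ‼ i + w ‼ i
    go []      []      i       = refl
    go []      (y ∷ w) zero    = addN-run 0 y
    go []      (y ∷ w) (suc i) = go [] w i
    go (x ∷ v) []      zero    = addN-run x 0
    go (x ∷ v) []      (suc i) = go v [] i
    go (x ∷ v) (y ∷ w) zero    = addN-run x y
    go (x ∷ v) (y ∷ w) (suc i) = go v w i

opaque
  eqV : Tm (list nat ∷ list nat ∷ []) bool
  eqV = foldr (cond (call eqN (op fst v0 ∷ op snd v0 ∷ [])) v1 (con false)) (con true) (call zipTm (v0 ∷ v1 ∷ []))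

  private
    eqPairs : List (ℕ × ℕ) → Bool
    eqPairs = List.foldr (λ p r → ifᵇ run eqN (proj₁ p , proj₂ p , tt) then r else false) true

    eqPairs-∷ : ∀ x y l → T (eqPairs ((x , y) ∷ l)) → x ≡ y × T (eqPairs l)
    eqPairs-∷ x y l t with run eqN (x , y , tt) | eqN-run x y
    ... | true | e = ≡ᵇ⇒≡ x y (subst T e tt) , t

    ∷-eqPairs : ∀ x y l → x ≡ y → T (eqPairs l) → T (eqPairs ((x , y) ∷ l))
    ∷-eqPairs x y l p t with run eqN (x , y , tt) | eqN-run x y
    ... | true  | e = t
    ... | false | e = subst T (sym e) (≡⇒≡ᵇ x y p)

  eqV-sound : ∀ v w → T (run eqV (v , w , tt)) → v ≋ w
  eqV-sound v w t = go v w (subst (T ∘ eqPairs) (zipTm-run v w) t)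
    where
    go : ∀ v w → T (eqPairs (zipPad nat nat v w)) → v ≋ w
    go []      []      t i       = refl
    go []      (y ∷ w) t zero    = proj₁ (eqPairs-∷ 0 y (zipPad nat nat [] w) t)
    go []      (y ∷ w) t (suc i) = go [] w (proj₂ (eqPairs-∷ 0 y (zipPad nat nat [] w) t)) i
    go (x ∷ v) []      t zero    = proj₁ (eqPairs-∷ x 0 (zipPad nat nat v []) t)
    go (x ∷ v) []      t (suc i) = go v [] (proj₂ (eqPairs-∷ x 0 (zipPad nat nat v []) t)) i
    go (x ∷ v) (y ∷ w) t zero    = proj₁ (eqPairs-∷ x y (zipPad nat nat v w) t)
    go (x ∷ v) (y ∷ w) t (suc i) = go v w (proj₂ (eqPairs-∷ x y (zipPad nat nat v w) t)) i

  eqV-complete : ∀ v w → v ≋ w → T (run eqV (v , w , tt))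
  eqV-complete v w e = subst (T ∘ eqPairs) (sym (zipTm-run v w)) (go v w e)
    where
    go : ∀ v w → v ≋ w → T (eqPairs (zipPad nat nat v w))
    go []      []      e = tt
    go []      (y ∷ w) e = ∷-eqPairs 0 y (zipPad nat nat [] w) (e 0) (go [] w (e ∘ suc))
    go (x ∷ v) []      e = ∷-eqPairs x 0 (zipPad nat nat v []) (e 0) (go v [] (e ∘ suc))
    go (x ∷ v) (y ∷ w) e = ∷-eqPairs x y (zipPad nat nat v w) (e 0) (go v w (e ∘ suc))

opaque
  memberTm : Tm (list nat ∷ list (list nat) ∷ []) bool
  memberTm = foldr (cond (call eqV (v0 ∷ v2 ∷ [])) (con true) v1) (con false) v1

  memberTm-sound : ∀ v S → T (run memberTm (v , S , tt)) → ∃[ w ] w ∈ˡ S × w ≋ v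
  memberTm-sound v S = go S
    where
    go : ∀ R → T (List.foldr (λ w r → ifᵇ run eqV (w , v , tt) then true else r) false R) → ∃[ w ] w ∈ˡ R × w ≋ v
    go (w ∷ R) t with run eqV (w , v , tt) in eq
    ... | true  = w , here refl , eqV-sound w v (subst T (sym eq) tt)
    ... | false = let (u , u∈R , p) = go R t in u , there u∈R , p

  memberTm-complete : ∀ v S {w} → w ∈ˡ S → w ≋ v → T (run memberTm (v , S , tt))
  memberTm-complete v S = go S
    where
    go : ∀ R {w} → w ∈ˡ R → w ≋ v → T (List.foldr (λ w r → ifᵇ run eqV (w , v , tt) then true else r) false R)
    go (w ∷ R) w∈ e with run eqV (w , v , tt) in eq
    go (w ∷ R) w∈          e | true  = tt
    go (w ∷ R) (here refl) e | false = ⊥-elim (subst T eq (eqV-complete w v e))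
    go (w ∷ R) (there w∈)  e | false = go R w∈ e

-- Enumeration of bounded vectors and of the types

filter-run : ∀ {A : Set} (p : A → Bool) l → List.foldr (λ x r → ifᵇ p x then x ∷ r else r) [] l ≡ List.filterᵇ p l
filter-run p []      = refl
filter-run p (x ∷ l) with p x
... | true  = cong (x ∷_) (filter-run p l)
... | false = filter-run p l

map-run : ∀ {A B : Set} (f : A → B) l r → List.foldr (λ x r → f x ∷ r) r l ≡ List.map f l ++ r
map-run f []      r = refl
map-run f (x ∷ l) r = cong (f x ∷_) (map-run f l r)

prefixes : ℕ → List (List ℕ) → List (List ℕ)
prefixes zero    L = []
prefixes (suc n) L = List.map (n ∷_) L ++ prefixes n L

below : List ℕ → List (List ℕ)
below []      = [] ∷ []
below (x ∷ m) = prefixes (suc x) (below m)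

opaque
  prefixTm : Tm (nat ∷ list (list nat) ∷ list (list nat) ∷ []) (list (list nat))
  prefixTm = foldr (cons (cons v2 v0) v1) v2 v1

  prefixTm-run : ∀ j L r → run prefixTm (j , L , r , tt) ≡ List.map (j ∷_) L ++ r
  prefixTm-run j L r = map-run (j ∷_) L r

opaque
  prefixesTm : Tm (nat ∷ list (list nat) ∷ []) (list (list nat))
  prefixesTm = op snd (foldr (pair (op succ (op fst v1)) (call prefixTm (op fst v1 ∷ v3 ∷ op snd v1 ∷ []))) (con (0 , [])) (op units v0))

  prefixesTm-run : ∀ n L → run prefixesTm (n , L , tt) ≡ prefixes n L
  prefixesTm-run n L = cong proj₂ (go n)
    where
    go : ∀ j → List.foldr (λ _ (p : ℕ × List (List ℕ)) → suc (proj₁ p) , run prefixTm (proj₁ p , L , proj₂ p , tt)) (0 , []) (List.replicate j 0)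
      ≡ (j , prefixes j L)
    go zero    = refl
    go (suc j) rewrite go j = cong (suc j ,_) (prefixTm-run j L _)

opaque
  belowTm : Tm (list nat ∷ []) (list (list nat))
  belowTm = foldr (call prefixesTm (op succ v0 ∷ v1 ∷ [])) (con ([] ∷ [])) v0

  belowTm-run : ∀ m → run belowTm (m , tt) ≡ below m
  belowTm-run m = go m
    where
    go : ∀ w → List.foldr (λ x r → run prefixesTm (suc x , r , tt)) ([] ∷ []) w ≡ below w
    go []      = refl
    go (x ∷ w) = trans (prefixesTm-run (suc x) _) (cong (prefixes (suc x)) (go w))

opaque
  typesTm : Tm (nat ∷ list nat ∷ []) (list (list nat))
  typesTm = foldr (cond (call eqN (call sumN (v0 ∷ []) ∷ v2 ∷ [])) (cons v0 v1) v1) (con []) (call belowTm (v1 ∷ []))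

  typesTm-run : ∀ t m → run typesTm (t , m , tt) ≡ List.filterᵇ (λ a → run eqN (run sumN (a , tt) , t , tt)) (below m)
  typesTm-run t m = trans (filter-run _ (run belowTm (m , tt))) (cong (List.filterᵇ _) (belowTm-run m))

-- Columns of the linear system: for each type a an unknown number of edges of
-- type a and a slack variable; the rows are one capacity constraint for
-- each type, followed by one degree constraint for each class.

∏! : List ℕ → ℕ
∏! []      = 1
∏! (x ∷ a) = x ! * ∏! a

-- The capacity row of `a` comes first, so the columns of `A` are shifted by a zero. The slack
-- column `1 ∷ []` is short because vectors continue with zeros.
columns : List (List ℕ) → List (List ℕ)
columns []      = []
columns (a ∷ A) = (∏! a ∷ List.map (λ _ → 0) A ++ a) ∷ (1 ∷ []) ∷ List.map (0 ∷_) (columns A)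

opaque
  ∏!Tm : Tm (list nat ∷ []) nat
  ∏!Tm = foldr (call mulN (call factorialTm (v0 ∷ []) ∷ v1 ∷ [])) (con 1) v0

  ∏!Tm-run : ∀ a → run ∏!Tm (a , tt) ≡ ∏! a
  ∏!Tm-run a = go a
    where
    go : ∀ b → List.foldr (λ x r → run mulN (run factorialTm (x , tt) , r , tt)) 1 b ≡ ∏! b
    go []      = refl
    go (x ∷ b) = trans (mulN-run _ _) (cong₂ _*_ (factorialTm-run x) (go b))

opaque
  appendTm : ∀ {a} → Tm (list a ∷ list a ∷ []) (list a)
  appendTm = foldr (cons v0 v1) v1 v0

  appendTm-run : ∀ {a} k l → run (appendTm {a}) (k , l , tt) ≡ k ++ l
  appendTm-run []      l = refl
  appendTm-run (x ∷ k) l = cong (x ∷_) (go k)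
    where
    go : ∀ k → List.foldr (λ x r → x ∷ r) l k ≡ k ++ l
    go []      = refl
    go (x ∷ k) = cong (x ∷_) (go k)

  appendTm-time : ∀ {a} → PolyTime (appendTm {a}) len₁
  appendTm-time = polynomial $ foldr-light (cons v0 v1) v1 v0 (λ γ → γ) (λ _ → refl) (Bounded-const 0) (Bounded-const 0) Bounded-size

opaque
  columnsTm : Tm (list (list nat) ∷ []) (list (list nat))
  columnsTm = op fst (foldr
    (pair (cons (cons (call ∏!Tm (v0 ∷ [])) (call appendTm (op snd v1 ∷ v0 ∷ [])))
            (cons (con (1 ∷ [])) (foldr (cons (cons (con 0) v0) v1) (con []) (op fst v1))))
          (cons (con 0) (op snd v1)))
    (con ([] , [])) v0)

  columnsTm-run : ∀ A → run columnsTm (A , tt) ≡ columns A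
  columnsTm-run A = cong proj₁ (go A)
    where
    go : ∀ B → List.foldr (λ a (p : List (List ℕ) × List ℕ) →
        ((run ∏!Tm (a , tt) ∷ run appendTm (proj₂ p , a , tt)) ∷ (1 ∷ []) ∷ List.foldr (λ c r → (0 ∷ c) ∷ r) [] (proj₁ p)) , 0 ∷ proj₂ p)
        ([] , []) B ≡ (columns B , List.map (λ _ → 0) B)
    go []      = refl
    go (a ∷ B) rewrite go B | ∏!Tm-run a | appendTm-run {nat} (List.map (λ _ → 0) B) a =
      cong (λ L → (((∏! a ∷ List.map (λ _ → 0) B ++ a) ∷ (1 ∷ []) ∷ L) , 0 ∷ List.map (λ _ → 0) B)) (trans (map-run (0 ∷_) (columns B) []) (++-identityʳ _))

-- Linear systems and the transitions of the automaton

lin : List (List ℕ) → (ℕ → ℕ) → ℕ → ℕ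
lin []       z i = 0
lin (v ∷ vs) z i = z 0 * v ‼ i + lin vs (z ∘ suc) i

lin-mono : ∀ vs {y z} → (∀ j → y j ≤ z j) → ∀ i → lin vs y i ≤ lin vs z i
lin-mono []       le i = z≤n
lin-mono (v ∷ vs) le i = +-mono-≤ (*-monoˡ-≤ (v ‼ i) (le 0)) (lin-mono vs (le ∘ suc) i)

lin-0 : ∀ vs i → lin vs (λ _ → 0) i ≡ 0
lin-0 []       i = refl
lin-0 (v ∷ vs) i = lin-0 vs i

lin-digits : ∀ vs {y z w} → (∀ j → w j ≡ y j + 2 * z j) → ∀ i → lin vs w i ≡ lin vs y i + 2 * lin vs z i
lin-digits []       e i = refl
lin-digits (v ∷ vs) {y} {z} e i rewrite e 0 | lin-digits vs (e ∘ suc) i = regroup (y 0) (z 0) (v ‼ i) (lin vs (y ∘ suc) i) (lin vs (z ∘ suc) i)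
  where
  regroup : ∀ a b c d e → (a + 2 * b) * c + (d + 2 * e) ≡ a * c + d + 2 * (b * c + e)
  regroup = solve-∀

-- c + M z = b has a solution z, where M has the columns vs.
Solvable : List (List ℕ) → (c b : ℕ → ℕ) → Set
Solvable vs c b = ∃[ z ] ∀ i → c i + lin vs z i ≡ b i

opaque
  columnSumTm : Tm (list (list nat) ∷ []) (list nat)
  columnSumTm = foldr (call addV (v0 ∷ v1 ∷ [])) (con []) v0

  columnSumTm-run : ∀ vs i → run columnSumTm (vs , tt) ‼ i ≡ lin vs (λ _ → 1) i
  columnSumTm-run vs = go vs
    where
    go : ∀ ws i → List.foldr (λ v r → run addV (v , r , tt)) [] ws ‼ i ≡ lin ws (λ _ → 1) i
    go []       i = refl
    go (w ∷ ws) i = trans (addV-run w _ i) (cong₂ _+_ (sym (+-identityʳ _)) (go ws i))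

opaque
  translateTm : Tm (list nat ∷ list (list nat) ∷ []) (list (list nat))
  translateTm = foldr (cons (call addV (v2 ∷ v0 ∷ [])) v1) v1 v1

  translateTm-run : ∀ v S → run translateTm (v , S , tt) ≡ List.map (λ c → run addV (v , c , tt)) S ++ S
  translateTm-run v S = map-run _ S S

opaque
  -- Guessing one bit of every unknown: the sums `c + M y` for `c` in `S` and all 0-1 vectors `y`.
  -- Each column doubles the list, which is harmless as the number of columns depends on the
  -- parameters only.
  subsetSumsTm : Tm (list (list nat) ∷ list (list nat) ∷ []) (list (list nat))
  subsetSumsTm = foldl (call translateTm (v0 ∷ v1 ∷ [])) v1 v0

  subsetSumsTm-sound : ∀ vs S {w} → w ∈ˡ run subsetSumsTm (vs , S , tt) →
    ∃[ c ] ∃[ y ] c ∈ˡ S × (∀ j → y j ≤ 1) × ∀ i → w ‼ i ≡ c ‼ i + lin vs y i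
  subsetSumsTm-sound []       S {w} w∈ = w , (λ _ → 0) , w∈ , (λ _ → z≤n) , λ i → sym (+-identityʳ _)
  subsetSumsTm-sound (v ∷ vs) S {w} w∈ with subsetSumsTm-sound vs (run translateTm (v , S , tt)) w∈
  ... | c , y , c∈ , y≤1 , e with ∈-++⁻ (List.map (λ c → run addV (v , c , tt)) S) (subst (c ∈ˡ_) (translateTm-run v S) c∈)
  ... | inj₂ c∈S = c , (λ { zero → 0 ; (suc j) → y j }) , c∈S , (λ { zero → z≤n ; (suc j) → y≤1 j }) , e
  ... | inj₁ c∈M with ∈-map⁻ _ c∈M
  ... | d , d∈S , refl = d , (λ { zero → 1 ; (suc j) → y j }) , d∈S , (λ { zero → ≤-refl ; (suc j) → y≤1 j }) ,
      λ i → trans (e i) (trans (cong (_+ lin vs y i) (addV-run v d i)) (regroup (v ‼ i) (d ‼ i) (lin vs y i)))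
    where
    regroup : ∀ a b c → a + b + c ≡ b + (1 * a + c)
    regroup = solve-∀

  subsetSumsTm-complete : ∀ vs S {c} y → c ∈ˡ S → (∀ j → y j ≤ 1) →
    ∃[ w ] w ∈ˡ run subsetSumsTm (vs , S , tt) × ∀ i → w ‼ i ≡ c ‼ i + lin vs y i
  subsetSumsTm-complete []       S {c} y c∈ y≤1 = c , c∈ , λ i → sym (+-identityʳ _)
  subsetSumsTm-complete (v ∷ vs) S {c} y c∈ y≤1 with y 0 in eq | y≤1 0
  ... | 0 | _ = subsetSumsTm-complete vs (run translateTm (v , S , tt)) (y ∘ suc)
      (subst (c ∈ˡ_) (sym (translateTm-run v S)) (∈-++⁺ʳ _ c∈)) (y≤1 ∘ suc)
  ... | 1 | _ =
    let w , w∈ , e = subsetSumsTm-complete vs (run translateTm (v , S , tt)) (y ∘ suc)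
          (subst (run addV (v , c , tt) ∈ˡ_) (sym (translateTm-run v S)) (∈-++⁺ˡ (∈-map⁺ _ c∈))) (y≤1 ∘ suc)
    in w , w∈ , λ i → trans (e i) (trans (cong (_+ lin vs (y ∘ suc) i) (addV-run v c i)) (regroup (v ‼ i) (c ‼ i) (lin vs (y ∘ suc) i)))
    where
    regroup : ∀ a b c → a + b + c ≡ b + (1 * a + c)
    regroup = solve-∀
  ... | suc (suc _) | s≤s ()

opaque
  -- Instead of halving the sums, every `c` of `U` is tested for `b + 2 c` occurring among them. The
  -- new list of states is thereby a sublist of `U`, which bounds its size through the whole run.
  stepTm : Tm (list (list nat) ∷ list (list nat) ∷ list (list nat) ∷ list nat ∷ []) (list (list nat))
  stepTm = bind (call subsetSumsTm (v0 ∷ v2 ∷ []))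
    (foldr (cond (call memberTm (call addV (v6 ∷ call addV (v0 ∷ v0 ∷ []) ∷ []) ∷ v2 ∷ [])) (cons v0 v1) v1) (con []) v2)

  private
    successor : List (List ℕ) → List (List ℕ) → List ℕ → List ℕ → Bool
    successor vs S b c = run memberTm (run addV (b , run addV (c , c , tt) , tt) , run subsetSumsTm (vs , S , tt) , tt)

  stepTm-filter : ∀ vs U S b → ∃[ p ] run stepTm (vs , U , S , b , tt) ≡ List.filterᵇ p U
  stepTm-filter vs U S b = successor vs S b , filter-run _ U

  doubled : ∀ b c i → run addV (b , run addV (c , c , tt) , tt) ‼ i ≡ b ‼ i + 2 * c ‼ i
  doubled b c i = trans (addV-run b _ i) (cong (b ‼ i +_) (trans (addV-run c c i) (cong (c ‼ i +_) (sym (+-identityʳ _)))))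

  stepTm-sound : ∀ vs U S b {c} → c ∈ˡ run stepTm (vs , U , S , b , tt) →
    c ∈ˡ U × ∃[ w ] w ∈ˡ run subsetSumsTm (vs , S , tt) × ∀ i → w ‼ i ≡ b ‼ i + 2 * c ‼ i
  stepTm-sound vs U S b {c} c∈ =
    let c∈U , t     = ∈-filter⁻ (T? ∘ successor vs S b) {xs = U} (subst (c ∈ˡ_) (filter-run (successor vs S b) U) c∈)
        w , w∈ , e  = memberTm-sound _ _ t
    in c∈U , w , w∈ , λ i → trans (e i) (doubled b c i)

  stepTm-complete : ∀ vs U S b {c w} → c ∈ˡ U → w ∈ˡ run subsetSumsTm (vs , S , tt) →
    (∀ i → w ‼ i ≡ b ‼ i + 2 * c ‼ i) → c ∈ˡ run stepTm (vs , U , S , b , tt)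
  stepTm-complete vs U S b {c} c∈U w∈ e = subst (c ∈ˡ_) (sym (filter-run (successor vs S b) U))
    (∈-filter⁺ (T? ∘ successor vs S b) c∈U (memberTm-complete _ _ w∈ λ i → trans (e i) (sym (doubled b c i))))

∈-prefixes⁻ : ∀ n L {w} → w ∈ˡ prefixes n L → ∃[ j ] ∃[ v ] j < n × v ∈ˡ L × w ≡ j ∷ v
∈-prefixes⁻ (suc n) L w∈ with ∈-++⁻ (List.map (n ∷_) L) w∈
... | inj₁ w∈M = let v , v∈ , e = ∈-map⁻ _ w∈M in n , v , ≤-refl , v∈ , e
... | inj₂ w∈P = let j , v , j<n , v∈ , e = ∈-prefixes⁻ n L w∈P in j , v , ≤-trans j<n (n≤1+n _) , v∈ , e

∈-prefixes⁺ : ∀ {n L j v} → j < n → v ∈ˡ L → (j ∷ v) ∈ˡ prefixes n L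
∈-prefixes⁺ {suc n} {L} (s≤s j≤n) v∈ with m≤n⇒m<n∨m≡n j≤n
... | inj₁ j<n  = ∈-++⁺ʳ (List.map (n ∷_) L) (∈-prefixes⁺ j<n v∈)
... | inj₂ refl = ∈-++⁺ˡ (∈-map⁺ _ v∈)

∈-below⁻ : ∀ m {w} → w ∈ˡ below m → len w ≡ len m × ∀ i → w ‼ i ≤ m ‼ i
∈-below⁻ []      (here refl) = refl , λ i → z≤n
∈-below⁻ (x ∷ m) w∈ with ∈-prefixes⁻ (suc x) (below m) w∈
... | j , v , s≤s j≤x , v∈ , refl = let l , le = ∈-below⁻ m v∈ in cong suc l , λ { zero → j≤x ; (suc i) → le i }

∈-below⁺ : ∀ m (g : ℕ → ℕ) → (∀ i → g i ≤ m ‼ i) → ∃[ w ] w ∈ˡ below m × ∀ i → w ‼ i ≡ g i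
∈-below⁺ []      g le = [] , here refl , λ i → sym (n≤0⇒n≡0 (le i))
∈-below⁺ (x ∷ m) g le =
  let v , v∈ , e = ∈-below⁺ m (g ∘ suc) (le ∘ suc)
  in g 0 ∷ v , ∈-prefixes⁺ (s≤s (le 0)) v∈ , λ { zero → refl ; (suc i) → e i }

-- One step of the carry automaton

module _ (vs : List (List ℕ)) where

  -- The carries: if c and M y with y ∈ {0,1} are at most M 1, then so is half of their sum.
  U : List (List ℕ)
  U = below (run columnSumTm (vs , tt))

  Carry : (ℕ → ℕ) → Set
  Carry c = ∀ i → c i ≤ lin vs (λ _ → 1) i

  U-carry : ∀ {c} → c ∈ˡ U → Carry (c ‼_)
  U-carry c∈ i = ≤-trans (proj₂ (∈-below⁻ (run columnSumTm (vs , tt)) c∈) i) (≤-reflexive (columnSumTm-run vs i))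

  -- The meaning of a list `S` of states when `b` is the unread rest of the right-hand side: some
  -- carry can still be completed to a solution. Both directions of a transition preserve it.
  SomeSolvable : List (List ℕ) → (ℕ → ℕ) → Set
  SomeSolvable S b = ∃[ c ] c ∈ˡ S × Solvable vs (c ‼_) b

  module _ (S : List (List ℕ)) (carry : ∀ {c} → c ∈ˡ S → Carry (c ‼_)) (β : List ℕ) (β≤1 : ∀ i → β ‼ i ≤ 1)
           (b b′ : ℕ → ℕ) (split : ∀ i → b i ≡ β ‼ i + 2 * b′ i) where

    -- Write the solution as `z = y + 2 z′` with digits `y`. Then `c + M y = β + 2 (b′ - M z′)`, so
    -- the next carry is `b′ - M z′` and `z′` solves the rest.
    step⁺ : SomeSolvable S b → SomeSolvable (run stepTm (vs , U , S , β , tt)) b′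
    step⁺ (c , c∈ , z , sol) =
      let y    = λ j → z j % 2
          z′   = λ j → z j / 2
          digits = λ j → trans (m≡m%n+[m/n]*n (z j) 2) (cong (z j % 2 +_) (*-comm (z j / 2) 2))
          y≤1  = λ j → ≤-pred (m%n<n (z j) 2)
          w , w∈ , ew = subsetSumsTm-complete vs S y c∈ y≤1
          total : ∀ i → w ‼ i + 2 * lin vs z′ i ≡ β ‼ i + 2 * b′ i
          total = λ i → trans (cong (_+ 2 * lin vs z′ i) (ew i)) (trans (+-assoc (c ‼ i) _ _)
                    (trans (cong (c ‼ i +_) (sym (lin-digits vs digits i))) (trans (sol i) (split i))))
          -- The truncated difference is exact: `2 l ≤ β + 2 m` with `β ≤ 1` forces `l ≤ m`.
          g    = λ i → b′ i ∸ lin vs z′ i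
          le   = λ i → halves {w = w ‼ i} {l = lin vs z′ i} (β≤1 i) (total i)
          eg   = λ i → m∸n+n≡m (le i)
          wg : ∀ i → w ‼ i ≡ β ‼ i + 2 * g i
          wg   = λ i → +-cancelʳ-≡ (2 * lin vs z′ i) _ _ (trans (total i)
                   (trans (cong (λ n → β ‼ i + 2 * n) (sym (eg i))) (regroup (β ‼ i) (g i) (lin vs z′ i))))
          g≤   = λ i → *-cancelˡ-≤ 2 (≤-trans (m≤n+m (2 * g i) (β ‼ i)) (≤-trans (≤-reflexive (trans (sym (wg i)) (ew i)))
                   (≤-trans (+-mono-≤ (carry c∈ i) (lin-mono vs y≤1 i)) (≤-reflexive (cong (lin vs (λ _ → 1) i +_) (sym (+-identityʳ _)))))))
          c′ , c′∈ , ec = ∈-below⁺ (run columnSumTm (vs , tt)) g (λ i → ≤-trans (g≤ i) (≤-reflexive (sym (columnSumTm-run vs i))))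
      in c′ , stepTm-complete vs U S β c′∈ w∈ (λ i → trans (wg i) (cong (λ n → β ‼ i + 2 * n) (sym (ec i)))) ,
         z′ , λ i → trans (cong (_+ lin vs z′ i) (ec i)) (eg i)
      where
      halves : ∀ {β w l m} → β ≤ 1 → w + 2 * l ≡ β + 2 * m → l ≤ m
      halves {β} {w} {l} {m} β≤1 e = ≤-pred (*-cancelˡ-< 2 l (suc m)
        (≤-trans (s≤s (≤-trans (m≤n+m (2 * l) w) (≤-trans (≤-reflexive e) (+-monoˡ-≤ (2 * m) β≤1)))) (≤-reflexive (regroup m))))
        where
        regroup : ∀ m → 2 + 2 * m ≡ 2 * (1 + m)
        regroup = solve-∀
      regroup : ∀ β g l → β + 2 * (g + l) ≡ β + 2 * g + 2 * l
      regroup = solve-∀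

    -- The bits `y` behind the transition become the lowest digits below `z′`.
    step⁻ : SomeSolvable (run stepTm (vs , U , S , β , tt)) b′ → SomeSolvable S b
    step⁻ (c′ , c′∈ , z′ , sol) =
      let c′∈U , w , w∈ , ew = stepTm-sound vs U S β c′∈
          c , y , c∈ , _ , ec = subsetSumsTm-sound vs S w∈
      in c , c∈ , (λ j → y j + 2 * z′ j) , λ i → begin
        c ‼ i + lin vs (λ j → y j + 2 * z′ j) i    ≡⟨ cong (c ‼ i +_) (lin-digits vs (λ _ → refl) i) ⟩
        c ‼ i + (lin vs y i + 2 * lin vs z′ i)     ≡⟨ sym (+-assoc (c ‼ i) _ _) ⟩
        c ‼ i + lin vs y i + 2 * lin vs z′ i       ≡⟨ cong (_+ 2 * lin vs z′ i) (trans (sym (ec i)) (ew i)) ⟩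
        β ‼ i + 2 * c′ ‼ i + 2 * lin vs z′ i       ≡⟨ regroup (β ‼ i) (c′ ‼ i) (lin vs z′ i) ⟩
        β ‼ i + 2 * (c′ ‼ i + lin vs z′ i)         ≡⟨ cong (λ n → β ‼ i + 2 * n) (sol i) ⟩
        β ‼ i + 2 * b′ i                           ≡⟨ sym (split i) ⟩
        b i                                        ∎
      where
      open ≡-Reasoning
      regroup : ∀ β c l → β + 2 * c + 2 * l ≡ β + 2 * (c + l)
      regroup = solve-∀

-- Running the automaton over all digits

vals : List (List Bool) → List ℕ
vals = List.map val

opaque
  headsTm : Tm (list (list bool) ∷ []) (list nat)
  headsTm = foldr (cons (cond (hd v0) (con 1) (con 0)) v1) (con []) v0

  tailsTm : Tm (list (list bool) ∷ []) (list (list bool))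
  tailsTm = foldr (cons (op tl v0) v1) (con []) v0

  headsTm-time : PolyTime headsTm len₁
  headsTm-time = polynomial $ foldr-light (cons (cond (hd v0) (con 1) (con 0)) v1) (con []) v0 (λ γ → γ) (λ _ → refl)
    (Bounded-const 0) (Bounded-const 0) Bounded-size

  tailsTm-time : PolyTime tailsTm len₁
  tailsTm-time = polynomial $ foldr-light (cons (op tl v0) v1) (con []) v0 (λ γ → γ) (λ _ → refl)
    (Bounded-const 0) (Bounded-const 0) Bounded-size

  private
    headBit : List Bool → ℕ
    headBit x = ifᵇ headOr bool x then 1 else 0

  headsTm-run : ∀ rows → run headsTm (rows , tt) ≡ List.map headBit rows
  headsTm-run rows = trans (map-run headBit rows []) (++-identityʳ _)

  tailsTm-run : ∀ rows → run tailsTm (rows , tt) ≡ List.map (List.drop 1) rows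
  tailsTm-run rows = trans (map-run (List.drop 1) rows []) (++-identityʳ _)

  headsTm-within : ∀ rows → Within (list nat) (suc (len rows)) (run headsTm (rows , tt))
  headsTm-within rows = subst (Within (list nat) (suc (len rows))) (sym (headsTm-run rows)) (go rows ≤-refl)
    where
    headBit≤1 : ∀ x → headBit x ≤ 1
    headBit≤1 []          = z≤n
    headBit≤1 (true ∷ x)  = ≤-refl
    headBit≤1 (false ∷ x) = z≤n
    go : ∀ rs {n} → len rs ≤ n → Within (list nat) (suc n) (List.map headBit rs)
    go []       le = z≤n , []
    go (r ∷ rs) {suc n} (s≤s le) = let l , ws = go rs (≤-trans le (n≤1+n n)) in
      s≤s (≤-trans (≤-reflexive (length-map headBit rs)) (≤-trans le (n≤1+n n))) ,
      ≤-trans (headBit≤1 r) (s≤s z≤n) ∷ ws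

  heads≤1 : ∀ rows i → run headsTm (rows , tt) ‼ i ≤ 1
  heads≤1 rows i rewrite headsTm-run rows = go rows i
    where
    go : ∀ rs i → List.map headBit rs ‼ i ≤ 1
    go []                  i       = z≤n
    go ([] ∷ rs)           zero    = z≤n
    go ((true ∷ x) ∷ rs)   zero    = ≤-refl
    go ((false ∷ x) ∷ rs)  zero    = z≤n
    go (x ∷ rs)            (suc i) = go rs i

  tailsTm-len : ∀ rows → len (run tailsTm (rows , tt)) ≡ len rows
  tailsTm-len rows = trans (cong len (tailsTm-run rows)) (length-map _ rows)

  tails-shrink : ∀ {n} rows → All.All (λ (x : List Bool) → len x ≤ suc n) rows → All.All (λ (x : List Bool) → len x ≤ n) (run tailsTm (rows , tt))
  tails-shrink {n} rows le = subst (All.All _) (sym (tailsTm-run rows)) (go rows le)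
    where
    go : ∀ (rs : List (List Bool)) → All.All (λ x → len x ≤ suc n) rs → All.All (λ x → len x ≤ n) (List.map (List.drop 1) rs)
    go []             []             = []
    go ([] ∷ rs)      (le ∷ les)     = z≤n ∷ go rs les
    go ((x ∷ r) ∷ rs) (s≤s le ∷ les) = le ∷ go rs les

  vals-split : ∀ rows i → vals rows ‼ i ≡ run headsTm (rows , tt) ‼ i + 2 * vals (run tailsTm (rows , tt)) ‼ i
  vals-split rows i rewrite headsTm-run rows | tailsTm-run rows = go rows i
    where
    go : ∀ rs i → vals rs ‼ i ≡ List.map headBit rs ‼ i + 2 * vals (List.map (List.drop 1) rs) ‼ i
    go []                  i       = refl
    go ([] ∷ rs)           zero    = refl
    go ((true ∷ x) ∷ rs)   zero    = refl
    go ((false ∷ x) ∷ rs)  zero    = refl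
    go (x ∷ rs)            (suc i) = go rs i

loopStep : Tm (bool ∷ (list (list nat) ⊗ list (list bool)) ∷ list (list nat) ∷ list (list nat) ∷ list bool ∷ list (list bool) ∷ [])
              (list (list nat) ⊗ list (list bool))
loopStep = pair (call stepTm (v2 ∷ v3 ∷ op fst v1 ∷ call headsTm (op snd v1 ∷ []) ∷ [])) (call tailsTm (op snd v1 ∷ []))

opaque
  -- The length of the third argument, the ruler, is the number of rounds. It only has to reach the
  -- end of every row, since all further digits are zeros.
  loopTm : Tm (list (list nat) ∷ list (list nat) ∷ list bool ∷ list (list bool) ∷ []) (list (list nat) ⊗ list (list bool))
  loopTm = foldl loopStep (pair (con ([] ∷ [])) v3) v2

  -- Once all rows are exhausted, the rest of the right-hand side is 0, and `c + M z = 0` is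
  -- solvable exactly for `c = 0`. The transitions carry this back to the initial carry 0.
  loopTm-correct : ∀ vs ruler rows → All.All (λ x → len x ≤ len ruler) rows →
    let S = proj₁ (run loopTm (vs , U vs , ruler , rows , tt)) in
    (∃[ c ] c ∈ˡ S × c ≋ [] → Solvable vs (λ _ → 0) (vals rows ‼_)) ×
    (Solvable vs (λ _ → 0) (vals rows ‼_) → ∃[ c ] c ∈ˡ S × c ≋ [])
  loopTm-correct vs ruler rows short =
    (λ p → start (proj₁ (go ruler ([] ∷ []) rows (λ { (here refl) i → z≤n }) short) p)) ,
    (λ (z , sol) → proj₂ (go ruler ([] ∷ []) rows (λ { (here refl) i → z≤n }) short) ([] , here refl , z , sol))
    where
    start : SomeSolvable vs ([] ∷ []) (vals rows ‼_) → Solvable vs (λ _ → 0) (vals rows ‼_)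
    start (c , here refl , s) = s
    zeros : ∀ rs → All.All (λ (x : List Bool) → len x ≤ 0) rs → ∀ i → vals rs ‼ i ≡ 0
    zeros []        []         i       = refl
    zeros ([] ∷ rs) (le ∷ les) zero    = refl
    zeros ([] ∷ rs) (le ∷ les) (suc i) = zeros rs les i
    go : ∀ l S rs → (∀ {c} → c ∈ˡ S → Carry vs (c ‼_)) → All.All (λ x → len x ≤ len l) rs →
      let S′ = proj₁ (List.foldl (λ s (_ : Bool) → run stepTm (vs , U vs , proj₁ s , run headsTm (proj₂ s , tt) , tt) , run tailsTm (proj₂ s , tt)) (S , rs) l) in
      (∃[ c ] c ∈ˡ S′ × c ≋ [] → SomeSolvable vs S (vals rs ‼_)) × (SomeSolvable vs S (vals rs ‼_) → ∃[ c ] c ∈ˡ S′ × c ≋ [])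
    go []      S rs carry short =
      (λ (c , c∈ , c≋) → c , c∈ , (λ _ → 0) , λ i → trans (cong₂ _+_ (c≋ i) (lin-0 vs i)) (sym (zeros rs short i))) ,
      (λ (c , c∈ , z , sol) → c , c∈ , λ i → m+n≡0⇒m≡0 (c ‼ i) (trans (sol i) (zeros rs short i)))
    go (_ ∷ l) S rs carry short =
      let β = run headsTm (rs , tt)
          rs′ = run tailsTm (rs , tt)
          S′ = run stepTm (vs , U vs , S , β , tt)
          p , q = go l S′ rs′ (λ c∈ → U-carry vs (proj₁ (stepTm-sound vs (U vs) S β c∈))) (tails-shrink rs short)
      in (λ h → step⁻ vs S carry β (heads≤1 rs) (vals rs ‼_) (vals rs′ ‼_) (vals-split rs) (p h)) ,
         (λ h → q (step⁺ vs S carry β (heads≤1 rs) (vals rs ‼_) (vals rs′ ‼_) (vals-split rs) h))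

-- Sums over all subsets

∑ˢ : ∀ n → (Subset n → ℕ) → ℕ
∑ˢ zero    g = g []
∑ˢ (suc n) g = ∑ˢ n (λ e → g (false ∷ e)) + ∑ˢ n (λ e → g (true ∷ e))

∑ˢ-cong : ∀ n {g h} → (∀ e → g e ≡ h e) → ∑ˢ n g ≡ ∑ˢ n h
∑ˢ-cong zero    eq = eq []
∑ˢ-cong (suc n) eq = cong₂ _+_ (∑ˢ-cong n (λ e → eq (false ∷ e))) (∑ˢ-cong n (λ e → eq (true ∷ e)))

∑ˢ-mono : ∀ n {g h} → (∀ e → g e ≤ h e) → ∑ˢ n g ≤ ∑ˢ n h
∑ˢ-mono zero    le = le []
∑ˢ-mono (suc n) le = +-mono-≤ (∑ˢ-mono n (λ e → le (false ∷ e))) (∑ˢ-mono n (λ e → le (true ∷ e)))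

interchange : ∀ a b c d → (a + b) + (c + d) ≡ (a + c) + (b + d)
interchange = solve-∀

∑ˢ-+ : ∀ n g h → ∑ˢ n (λ e → g e + h e) ≡ ∑ˢ n g + ∑ˢ n h
∑ˢ-+ zero    g h = refl
∑ˢ-+ (suc n) g h = trans (cong₂ _+_ (∑ˢ-+ n _ _) (∑ˢ-+ n _ _)) (interchange (∑ˢ n (λ e → g (false ∷ e))) _ (∑ˢ n (λ e → g (true ∷ e))) _)

∑ˢ-*ˡ : ∀ n c g → ∑ˢ n (λ e → c * g e) ≡ c * ∑ˢ n g
∑ˢ-*ˡ zero    c g = refl
∑ˢ-*ˡ (suc n) c g = trans (cong₂ _+_ (∑ˢ-*ˡ n c _) (∑ˢ-*ˡ n c _)) (sym (*-distribˡ-+ c (∑ˢ n (λ e → g (false ∷ e))) _))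

∑ˢ-0 : ∀ n → ∑ˢ n (λ _ → 0) ≡ 0
∑ˢ-0 n = ∑ˢ-*ˡ n 0 (λ _ → 0)

_==_ : ∀ {n} → Subset n → Subset n → Bool
[]          == []          = true
(true ∷ x)  == (true ∷ y)  = x == y
(false ∷ x) == (false ∷ y) = x == y
(true ∷ x)  == (false ∷ y) = false
(false ∷ x) == (true ∷ y)  = false

==-sound : ∀ {n} (x y : Subset n) → T (x == y) → x ≡ y
==-sound []          []          t = refl
==-sound (true ∷ x)  (true ∷ y)  t = cong (true ∷_) (==-sound x y t)
==-sound (false ∷ x) (false ∷ y) t = cong (false ∷_) (==-sound x y t)

∑ˢ-== : ∀ n x g → ∑ˢ n (λ e → bit (x == e) * g e) ≡ g x
∑ˢ-== zero    []          g = +-identityʳ _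
∑ˢ-== (suc n) (true ∷ x)  g = trans (cong (_+ ∑ˢ n (λ e → bit (x == e) * g (true ∷ e))) (∑ˢ-0 n)) (∑ˢ-== n x (λ e → g (true ∷ e)))
∑ˢ-== (suc n) (false ∷ x) g = trans (cong (∑ˢ n (λ e → bit (x == e) * g (false ∷ e)) +_) (∑ˢ-0 n)) (trans (+-identityʳ _) (∑ˢ-== n x (λ e → g (false ∷ e))))

search : ∀ n (p : Subset n → Bool) → (∃[ e ] T (p e)) ⊎ (∀ e → ¬ T (p e))
search zero p with p [] in eq
... | true  = inj₁ ([] , subst T (sym eq) _)
... | false = inj₂ λ { [] t → subst T eq t }
search (suc n) p with search n (λ e → p (false ∷ e)) | search n (λ e → p (true ∷ e))
... | inj₁ (e , t) | _            = inj₁ (false ∷ e , t)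
... | inj₂ _       | inj₁ (e , t) = inj₁ (true ∷ e , t)
... | inj₂ f       | inj₂ g       = inj₂ λ { (false ∷ e) → f e ; (true ∷ e) → g e }

-- Transpositions of vertices

transpose : ∀ {n} → Fin n → Fin n → Subset n → Subset n
transpose zero    zero    e       = e
transpose zero    (suc v) (b ∷ e) = lookup e v ∷ (e [ v ]≔ b)
transpose (suc u) zero    (b ∷ e) = lookup e u ∷ (e [ u ]≔ b)
transpose (suc u) (suc v) (b ∷ e) = b ∷ transpose u v e

-- This is a transposition with the first vertex: the Boolean argument of `G` is the membership of
-- that vertex and changes places with the membership of `v`.
∑ˢ-update : ∀ {n} (v : Fin n) (G : Bool → Subset n → ℕ) →
  ∑ˢ n (λ e → G (lookup e v) (e [ v ]≔ false)) + ∑ˢ n (λ e → G (lookup e v) (e [ v ]≔ true)) ≡ ∑ˢ n (G false) + ∑ˢ n (G true)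
∑ˢ-update {suc n} zero    G = interchange (∑ˢ n (λ e → G false (false ∷ e))) (∑ˢ n (λ e → G true (false ∷ e)))
                                          (∑ˢ n (λ e → G false (true ∷ e))) (∑ˢ n (λ e → G true (true ∷ e)))
∑ˢ-update {suc n} (suc v) G = begin
  (P false false + P true false) + (P false true + P true true) ≡⟨ interchange (P false false) _ _ _ ⟩
  (P false false + P false true) + (P true false + P true true) ≡⟨ cong₂ _+_ (∑ˢ-update v (λ b e → G b (false ∷ e))) (∑ˢ-update v (λ b e → G b (true ∷ e))) ⟩
  (Q false false + Q false true) + (Q true false + Q true true) ≡⟨ interchange (Q false false) _ _ _ ⟩
  (Q false false + Q true false) + (Q false true + Q true true) ∎
  where
  open ≡-Reasoning
  P Q : Bool → Bool → ℕ
  P c b = ∑ˢ n (λ e → G (lookup e v) (c ∷ (e [ v ]≔ b)))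
  Q c b = ∑ˢ n (λ e → G b (c ∷ e))

∑ˢ-transpose : ∀ {n} (u v : Fin n) g → ∑ˢ n (λ e → g (transpose u v e)) ≡ ∑ˢ n g
∑ˢ-transpose zero    zero    g = refl
∑ˢ-transpose zero    (suc v) g = ∑ˢ-update v (λ b e → g (b ∷ e))
∑ˢ-transpose (suc u) zero    g = ∑ˢ-update u (λ b e → g (b ∷ e))
∑ˢ-transpose (suc u) (suc v) g = cong₂ _+_ (∑ˢ-transpose u v (λ e → g (false ∷ e))) (∑ˢ-transpose u v (λ e → g (true ∷ e)))

δ : ∀ {n} → Fin n → Fin n → ℕ
δ zero    zero    = 1
δ zero    (suc v) = 0
δ (suc u) zero    = 0
δ (suc u) (suc v) = δ u v

χ : ∀ {n} → Subset n → Fin n → ℕ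
χ e v = bit (lookup e v)

χ-insert : ∀ {n} (e : Subset n) v → lookup e v ≡ false → ∀ w → χ (e [ v ]≔ true) w ≡ χ e w + δ v w
χ-insert (false ∷ e) zero eq zero    = refl
χ-insert (false ∷ e) zero eq (suc w) = sym (+-identityʳ _)
χ-insert (b ∷ e) (suc v) eq zero    = sym (+-identityʳ _)
χ-insert (b ∷ e) (suc v) eq (suc w) = χ-insert e v eq w

χ-remove : ∀ {n} (e : Subset n) v → lookup e v ≡ true → ∀ w → χ (e [ v ]≔ false) w + δ v w ≡ χ e w
χ-remove (true ∷ e) zero eq zero    = refl
χ-remove (true ∷ e) zero eq (suc w) = +-identityʳ _
χ-remove (b ∷ e) (suc v) eq zero    = +-identityʳ _
χ-remove (b ∷ e) (suc v) eq (suc w) = χ-remove e v eq w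

-- The loss at `u` and the gain at `v` are put on opposite sides, which avoids truncated
-- subtraction; `Moves` below has the same form.
χ-transpose : ∀ {n} (u v : Fin n) e → lookup e u ≡ true → lookup e v ≡ false → ∀ w → χ (transpose u v e) w + δ u w ≡ χ e w + δ v w
χ-transpose zero    zero    e       p q w with () ← trans (sym p) q
χ-transpose zero    (suc v) (true ∷ e) p q zero    = cong (λ b → bit b + 1) q
χ-transpose zero    (suc v) (true ∷ e) p q (suc w) = trans (+-identityʳ _) (χ-insert e v q w)
χ-transpose (suc u) zero    (false ∷ e) p q zero   = cong (λ b → bit b + 0) p
χ-transpose (suc u) zero    (false ∷ e) p q (suc w) = trans (χ-remove e u p w) (sym (+-identityʳ _))
χ-transpose (suc u) (suc v) (b ∷ e) p q zero    = refl
χ-transpose (suc u) (suc v) (b ∷ e) p q (suc w) = χ-transpose u v e p q w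

lookup-transpose : ∀ {n} (u v : Fin n) e → lookup (transpose u v e) u ≡ lookup e v × lookup (transpose u v e) v ≡ lookup e u
lookup-transpose zero    zero    e       = refl , refl
lookup-transpose zero    (suc v) (b ∷ e) = refl , lookup∘update v e b
lookup-transpose (suc u) zero    (b ∷ e) = lookup∘update u e b , refl
lookup-transpose (suc u) (suc v) (b ∷ e) = lookup-transpose u v e

-- Sums over the vertices

∑ : ∀ n → (Fin n → ℕ) → ℕ
∑ zero    f = 0
∑ (suc n) f = f zero + ∑ n (f ∘ suc)

∑-cong : ∀ n {f g} → (∀ v → f v ≡ g v) → ∑ n f ≡ ∑ n g
∑-cong zero    eq = refl
∑-cong (suc n) eq = cong₂ _+_ (eq zero) (∑-cong n (eq ∘ suc))

∑-mono : ∀ n {f g} → (∀ v → f v ≤ g v) → ∑ n f ≤ ∑ n g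
∑-mono zero    le = z≤n
∑-mono (suc n) le = +-mono-≤ (le zero) (∑-mono n (le ∘ suc))

∑-strict : ∀ n {f g} → (∀ v → f v ≤ g v) → ∀ u → f u < g u → ∑ n f < ∑ n g
∑-strict (suc n) le zero    lt = +-mono-<-≤ lt (∑-mono n (le ∘ suc))
∑-strict (suc n) le (suc u) lt = +-mono-≤-< (le zero) (∑-strict n (le ∘ suc) u lt)

∑-+ : ∀ n f g → ∑ n (λ v → f v + g v) ≡ ∑ n f + ∑ n g
∑-+ zero    f g = refl
∑-+ (suc n) f g = trans (cong (f zero + g zero +_) (∑-+ n _ _)) (interchange (f zero) (g zero) (∑ n (f ∘ suc)) _)

∑-0 : ∀ n {f} → (∀ v → f v ≡ 0) → ∑ n f ≡ 0
∑-0 zero    eq = refl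
∑-0 (suc n) eq = cong₂ _+_ (eq zero) (∑-0 n (eq ∘ suc))

∑-δ : ∀ n u → ∑ n (δ u) ≡ 1
∑-δ (suc n) zero    = cong suc (∑-0 n (λ _ → refl))
∑-δ (suc n) (suc u) = ∑-δ n u

∑-tight : ∀ n {f g} → (∀ v → f v ≤ g v) → ∑ n f ≡ ∑ n g → ∀ v → f v ≡ g v
∑-tight n {f} {g} le eq v with m≤n⇒m<n∨m≡n (le v)
... | inj₁ lt = ⊥-elim (<⇒≢ (∑-strict n le v lt) eq)
... | inj₂ e  = e

∑-deficit : ∀ n {f g} → ∑ n f ≡ ∑ n g → ∀ u → g u < f u → ∃[ v ] f v < g v
∑-deficit n {f} {g} eq u lt with any? (λ v → f v <? g v)
... | yes p = p
... | no ¬p = ⊥-elim (<⇒≢ (∑-strict n (λ v → ≮⇒≥ (λ q → ¬p (v , q))) u lt) (sym eq))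

∑-∑ˢ : ∀ m n (h : Subset n → Fin m → ℕ) → ∑ m (λ v → ∑ˢ n (λ e → h e v)) ≡ ∑ˢ n (λ e → ∑ m (h e))
∑-∑ˢ zero    n h = sym (∑ˢ-0 n)
∑-∑ˢ (suc m) n h = trans (cong (∑ˢ n (λ e → h e zero) +_) (∑-∑ˢ m n (λ e → h e ∘ suc))) (sym (∑ˢ-+ n _ _))

∑-*ˡ : ∀ n c f → ∑ n (λ v → c * f v) ≡ c * ∑ n f
∑-*ˡ zero    c f = sym (*-zeroʳ c)
∑-*ˡ (suc n) c f = trans (cong (c * f zero +_) (∑-*ˡ n c (f ∘ suc))) (sym (*-distribˡ-+ c (f zero) _))

∣∣≡∑ : ∀ {n} (e : Subset n) → ∣ e ∣ ≡ ∑ n (χ e)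
∣∣≡∑ []          = refl
∣∣≡∑ (true ∷ e)  = cong suc (∣∣≡∑ e)
∣∣≡∑ (false ∷ e) = ∣∣≡∑ e

∣transpose∣ : ∀ {n} (u v : Fin n) e → lookup e u ≡ true → lookup e v ≡ false → ∣ transpose u v e ∣ ≡ ∣ e ∣
∣transpose∣ {n} u v e p q = +-cancelʳ-≡ 1 _ _ (begin
  ∣ transpose u v e ∣ + 1                ≡⟨ cong₂ _+_ (∣∣≡∑ (transpose u v e)) (sym (∑-δ n u)) ⟩
  ∑ n (χ (transpose u v e)) + ∑ n (δ u)  ≡⟨ sym (∑-+ n _ _) ⟩
  ∑ n (λ w → χ (transpose u v e) w + δ u w) ≡⟨ ∑-cong n (χ-transpose u v e p q) ⟩
  ∑ n (λ w → χ e w + δ v w)              ≡⟨ ∑-+ n _ _ ⟩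
  ∑ n (χ e) + ∑ n (δ v)                  ≡⟨ cong₂ _+_ (sym (∣∣≡∑ e)) (∑-δ n v) ⟩
  ∣ e ∣ + 1                              ∎)
  where open ≡-Reasoning

-- Sums over the classes, which are consecutive blocks of vertices

classSums : ∀ {k} (ns : Vec ℕ k) → (Fin (sum ns) → ℕ) → List ℕ
classSums []       f = []
classSums (m ∷ ns) f = ∑ m (λ j → f (j ↑ˡ sum ns)) ∷ classSums ns (λ j → f (m ↑ʳ j))

classSums-cong : ∀ {k} (ns : Vec ℕ k) {f g} → (∀ v → f v ≡ g v) → classSums ns f ≡ classSums ns g
classSums-cong []       eq = refl
classSums-cong (m ∷ ns) eq = cong₂ _∷_ (∑-cong m (λ j → eq _)) (classSums-cong ns (λ j → eq _))

δ-↑ˡ : ∀ {m} (i j : Fin m) n → δ (i ↑ˡ n) (j ↑ˡ n) ≡ δ i j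
δ-↑ˡ zero    zero    n = refl
δ-↑ˡ zero    (suc j) n = refl
δ-↑ˡ (suc i) zero    n = refl
δ-↑ˡ (suc i) (suc j) n = δ-↑ˡ i j n

δ-↑ʳ : ∀ m {n} (i j : Fin n) → δ (m ↑ʳ i) (m ↑ʳ j) ≡ δ i j
δ-↑ʳ zero    i j = refl
δ-↑ʳ (suc m) i j = δ-↑ʳ m i j

δ-↑ˡ-↑ʳ : ∀ {m n} (i : Fin m) (j : Fin n) → δ (i ↑ˡ n) (m ↑ʳ j) ≡ 0
δ-↑ˡ-↑ʳ zero    j = refl
δ-↑ˡ-↑ʳ (suc i) j = δ-↑ˡ-↑ʳ i j

δ-↑ʳ-↑ˡ : ∀ {m n} (i : Fin m) (j : Fin n) → δ (m ↑ʳ j) (i ↑ˡ n) ≡ 0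
δ-↑ʳ-↑ˡ zero    j = refl
δ-↑ʳ-↑ˡ (suc i) j = δ-↑ʳ-↑ˡ i j

sizes : ∀ {k} → Vec (ℕ × ℕ) k → Vec ℕ k
sizes = Vec.map proj₂

target : ∀ {k} (xs : Vec (ℕ × ℕ) k) → Fin (sum (sizes xs)) → ℕ
target xs = lookup (degreeSequence xs)

target-↑ˡ : ∀ {k} δ n (xs : Vec (ℕ × ℕ) k) j → target ((δ , n) ∷ xs) (j ↑ˡ _) ≡ δ
target-↑ˡ δ n xs j = trans (lookup-++ˡ (Vec.replicate n δ) (degreeSequence xs) j) (lookup-replicate j δ)

target-↑ʳ : ∀ {k} δ n (xs : Vec (ℕ × ℕ) k) j → target ((δ , n) ∷ xs) (n ↑ʳ j) ≡ target xs j
target-↑ʳ δ n xs j = lookup-++ʳ (Vec.replicate n δ) (degreeSequence xs) j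

classSums-tight : ∀ {k} (ns : Vec ℕ k) {f g} → (∀ v → f v ≤ g v) → classSums ns f ≡ classSums ns g → ∀ v → f v ≡ g v
classSums-tight (m ∷ ns) {f} {g} le eq v with splitAt m v in s
... | inj₁ j = subst (λ w → f w ≡ g w) (splitAt⁻¹-↑ˡ s) (∑-tight m (λ j → le (j ↑ˡ sum ns)) (∷-injectiveˡ eq) j)
... | inj₂ j = subst (λ w → f w ≡ g w) (splitAt⁻¹-↑ʳ s) (classSums-tight ns (λ j → le (m ↑ʳ j)) (∷-injectiveʳ eq) j)

-- Making a hypergraph regular within the classes

Moves : ∀ {n} → (u v : Fin n) → (f f′ : Fin n → ℕ) → Set
Moves u v f f′ = ∀ w → f′ w + δ u w ≡ f w + δ v w

∑-moves : ∀ n {u v f f′} → Moves u v f f′ → ∑ n f′ ≡ ∑ n f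
∑-moves n {u} {v} {f} {f′} mv = +-cancelʳ-≡ 1 _ _ (trans (cong (∑ n f′ +_) (sym (∑-δ n u)))
  (trans (sym (∑-+ n _ _)) (trans (∑-cong n mv) (trans (∑-+ n _ _) (cong (∑ n f +_) (∑-δ n v))))))

-- Equal totals over the class of `u` force some `v` of that class below its target. That both lie
-- in one class is recorded by its two consequences: their targets agree, and moving a unit from `u`
-- to `v` leaves all class totals unchanged.
deficit : ∀ {k} (xs : Vec (ℕ × ℕ) k) f → classSums (sizes xs) f ≡ classSums (sizes xs) (target xs) →
  ∀ u → target xs u < f u → ∃[ v ] f v < target xs v × target xs u ≡ target xs v ×
    (∀ g g′ → Moves u v g g′ → classSums (sizes xs) g′ ≡ classSums (sizes xs) g)
deficit ((d , n) ∷ xs) f eq u lt with splitAt n u in s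
... | inj₁ j with refl ← splitAt⁻¹-↑ˡ s =
  let j′ , lt′ = ∑-deficit n (∷-injectiveˡ eq) j lt
  in j′ ↑ˡ _ , lt′ , trans (target-↑ˡ d n xs j) (sym (target-↑ˡ d n xs j′)) , λ g g′ mv → cong₂ _∷_
    (∑-moves n {j} {j′} λ w → trans (cong (g′ (w ↑ˡ _) +_) (sym (δ-↑ˡ j w _))) (trans (mv (w ↑ˡ _)) (cong (g (w ↑ˡ _) +_) (δ-↑ˡ j′ w _))))
    (classSums-cong (sizes xs) λ w → trans (sym (+-identityʳ _)) (trans (cong (g′ (n ↑ʳ w) +_) (sym (δ-↑ˡ-↑ʳ j w)))
      (trans (mv (n ↑ʳ w)) (trans (cong (g (n ↑ʳ w) +_) (δ-↑ˡ-↑ʳ j′ w)) (+-identityʳ _)))))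
... | inj₂ j with refl ← splitAt⁻¹-↑ʳ s =
  let v , lt′ , te , pres = deficit xs (λ w → f (n ↑ʳ w))
        (trans (∷-injectiveʳ eq) (classSums-cong (sizes xs) (target-↑ʳ d n xs))) j
        (≤-trans (s≤s (≤-reflexive (sym (target-↑ʳ d n xs j)))) lt)
  in n ↑ʳ v , ≤-trans lt′ (≤-reflexive (sym (target-↑ʳ d n xs v))) ,
     trans (target-↑ʳ d n xs j) (trans te (sym (target-↑ʳ d n xs v))) , λ g g′ mv → cong₂ _∷_
    (∑-cong n λ w → trans (sym (+-identityʳ _)) (trans (cong (g′ (w ↑ˡ _) +_) (sym (δ-↑ʳ-↑ˡ w j)))
      (trans (mv (w ↑ˡ _)) (trans (cong (g (w ↑ˡ _) +_) (δ-↑ʳ-↑ˡ w v)) (+-identityʳ _)))))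
    (pres _ _ λ w → trans (cong (g′ (n ↑ʳ w) +_) (sym (δ-↑ʳ n j w))) (trans (mv (n ↑ʳ w)) (cong (g (n ↑ʳ w) +_) (δ-↑ʳ n v w))))

-- With characteristic functions, degrees are sums over all subsets, which can be reindexed by a
-- transposition; repeated edges are excluded by construction.
Edges : ℕ → Set
Edges n = Subset n → Bool

Uniform : ∀ {n} → ℕ → Edges n → Set
Uniform t H = ∀ e → T (H e) → ∣ e ∣ ≡ t

deg : ∀ {n} → Edges n → Fin n → ℕ
deg {n} H v = ∑ˢ n (λ e → bit (H e) * χ e v)

T⇒≡ : ∀ {b} → T b → b ≡ true
T⇒≡ {true} t = refl

¬T⇒≡ : ∀ {b} → ¬ T b → b ≡ false
¬T⇒≡ {false} t = refl
¬T⇒≡ {true}  t = ⊥-elim (t _)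

module _ {n : ℕ} {t : ℕ} (H : Edges n) (uniform : Uniform t H) (u v : Fin n) (lt : deg H v < deg H u) where

  private
    candidate : Subset n → Bool
    candidate e = H e ∧ (lookup e u ∧ (not (lookup e v) ∧ not (H (transpose u v e))))

    toV toV′ : Subset n → ℕ
    toV  e = bit (H e) * (χ e v * bit (not (lookup e u)))
    toV′ e = bit (H e) * (χ e v * χ e u)

    -- Transposition would embed the edges through u but not v into the edges through v but not u.
    no-candidate : (∀ e → ¬ T (candidate e)) → deg H u ≤ deg H v
    no-candidate none = begin
      ∑ˢ n (λ e → bit (H e) * χ e u)                       ≤⟨ ∑ˢ-mono n pointwise ⟩
      ∑ˢ n (λ e → toV (transpose u v e) + toV′ e)          ≡⟨ ∑ˢ-+ n _ _ ⟩
      ∑ˢ n (λ e → toV (transpose u v e)) + ∑ˢ n toV′       ≡⟨ cong (_+ ∑ˢ n toV′) (∑ˢ-transpose u v toV) ⟩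
      ∑ˢ n toV + ∑ˢ n toV′                                 ≡⟨ sym (∑ˢ-+ n _ _) ⟩
      ∑ˢ n (λ e → toV e + toV′ e)                          ≡⟨ ∑ˢ-cong n (λ e → recombine (H e) (lookup e v) (lookup e u)) ⟩
      ∑ˢ n (λ e → bit (H e) * χ e v)                       ∎
      where
      open ≤-Reasoning
      recombine : ∀ h a b → bit h * (bit a * bit (not b)) + bit h * (bit a * bit b) ≡ bit h * bit a
      recombine true  true  true  = refl
      recombine true  true  false = refl
      recombine true  false b     = refl
      recombine false a     b     = refl
      cases : ∀ h a b h′ → ¬ T (h ∧ (a ∧ (not b ∧ not h′))) → bit h * bit a ≤ bit h′ * (bit a * bit (not b)) + bit h * (bit b * bit a)
      cases false a     b     h′    r = z≤n
      cases true  false b     h′    r = z≤n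
      cases true  true  true  h′    r = m≤n+m 1 _
      cases true  true  false true  r = ≤-refl
      cases true  true  false false r = ⊥-elim (r _)
      pointwise : ∀ e → bit (H e) * χ e u ≤ toV (transpose u v e) + toV′ e
      pointwise e rewrite proj₁ (lookup-transpose u v e) | proj₂ (lookup-transpose u v e) =
        cases (H e) (lookup e u) (lookup e v) (H (transpose u v e)) (none e)

    exchange-at : ∀ e → T (candidate e) → Σ[ H′ ∈ Edges n ] Uniform t H′ × Moves u v (deg H) (deg H′)
    exchange-at e c = H′ , uniform′ , moves
      where
      open Equivalence
      He : H e ≡ true
      He = T⇒≡ (proj₁ (to T-∧ c))
      e∋u : lookup e u ≡ true
      e∋u = T⇒≡ (proj₁ (to T-∧ (proj₂ (to (T-∧ {H e}) c))))
      rest : T (not (lookup e v) ∧ not (H (transpose u v e)))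
      rest = proj₂ (to (T-∧ {lookup e u}) (proj₂ (to (T-∧ {H e}) c)))
      not-T : ∀ {b} → T (not b) → b ≡ false
      not-T {false} t = refl
      e∌v : lookup e v ≡ false
      e∌v = not-T (proj₁ (to T-∧ rest))
      f : Subset n
      f = transpose u v e
      Hf : H f ≡ false
      Hf = not-T (proj₂ (to (T-∧ {not (lookup e v)}) rest))
      H′ : Edges n
      H′ g = (f == g) ∨ (H g ∧ not (e == g))
      uniform′ : Uniform t H′
      uniform′ g h with f == g in eq
      ... | true  with refl ← ==-sound f g (subst T (sym eq) _) = trans (∣transpose∣ u v e e∋u e∌v) (uniform e (subst T (sym He) _))
      ... | false = uniform g (proj₁ (to T-∧ h))
      -- `H′ = H - e + f` in additive form. The edges `e` and `f` differ because only `e` belongs to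
      -- `H`.
      count : ∀ g → bit (H′ g) + bit (e == g) ≡ bit (H g) + bit (f == g)
      count g with f == g in eqf | e == g in eqe
      ... | true | true = ⊥-elim (contra (==-sound f g (subst T (sym eqf) _)) (==-sound e g (subst T (sym eqe) _)))
        where
        contra : f ≡ g → e ≡ g → ⊥
        contra p q with () ← trans (sym He) (trans (cong H (trans q (sym p))) Hf)
      ... | true | false = cong (λ b → bit b + 1) (sym (trans (cong H (sym (==-sound f g (subst T (sym eqf) _)))) Hf))
      ... | false | true rewrite trans (cong H (sym (==-sound e g (subst T (sym eqe) _)))) He = refl
      ... | false | false with H g
      ...   | true  = refl
      ...   | false = refl
      moves : Moves u v (deg H) (deg H′)
      moves w = +-cancelʳ-≡ (χ e w) _ _ (begin
        deg H′ w + δ u w + χ e w                                      ≡⟨ regroup (deg H′ w) (δ u w) (χ e w) ⟩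
        deg H′ w + χ e w + δ u w                                      ≡⟨ cong (_+ δ u w) counted ⟩
        deg H w + χ f w + δ u w                                       ≡⟨ +-assoc (deg H w) _ _ ⟩
        deg H w + (χ f w + δ u w)                                     ≡⟨ cong (deg H w +_) (χ-transpose u v e e∋u e∌v w) ⟩
        deg H w + (χ e w + δ v w)                                     ≡⟨ regroup′ (deg H w) (χ e w) (δ v w) ⟩
        deg H w + δ v w + χ e w                                       ∎)
        where
        open ≡-Reasoning
        regroup : ∀ a b c → a + b + c ≡ a + c + b
        regroup = solve-∀
        regroup′ : ∀ a b c → a + (b + c) ≡ a + c + b
        regroup′ = solve-∀
        add-one : ∀ (G : Edges n) x → ∑ˢ n (λ g → (bit (G g) + bit (x == g)) * χ g w) ≡ deg G w + χ x w
        add-one G x = trans (∑ˢ-cong n (λ g → *-distribʳ-+ (χ g w) (bit (G g)) _)) (trans (∑ˢ-+ n _ _) (cong (deg G w +_) (∑ˢ-== n x (λ g → χ g w))))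
        counted : deg H′ w + χ e w ≡ deg H w + χ f w
        counted = trans (sym (add-one H′ e)) (trans (∑ˢ-cong n (λ g → cong (_* χ g w) (count g))) (add-one H f))

  exchange : Σ[ H′ ∈ Edges n ] Uniform t H′ × Moves u v (deg H) (deg H′)
  exchange with search n candidate
  ... | inj₁ (e , c) = exchange-at e c
  ... | inj₂ none    = ⊥-elim (<⇒≱ lt (no-candidate none))

δ-one : ∀ {n} (u w : Fin n) → δ u w ≡ 0 ⊎ (δ u w ≡ 1 × u ≡ w)
δ-one zero    zero    = inj₂ (refl , refl)
δ-one zero    (suc w) = inj₁ refl
δ-one (suc u) zero    = inj₁ refl
δ-one (suc u) (suc w) with δ-one u w
... | inj₁ p       = inj₁ p
... | inj₂ (p , q) = inj₂ (p , cong suc q)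

-- The excess drops by one at `u`; at `v` it was 0 and remains so, because `v` was strictly below
-- its target. All other vertices are unaffected.
∸-shift : ∀ {n} {u v : Fin n} {f f′ g : Fin n → ℕ} → Moves u v f f′ → g u < f u → f v < g v → ∀ w → f′ w ∸ g w + δ u w ≤ f w ∸ g w
∸-shift {u = u} {v} {f} {f′} {g} mv over under w with δ-one u w | δ-one v w | mv w
... | inj₁ p | inj₁ q | e rewrite p | q | +-identityʳ (f′ w) | +-identityʳ (f w) | e = ≤-reflexive (+-identityʳ _)
... | inj₁ p | inj₂ (q , refl) | e rewrite p | q | +-identityʳ (f′ w) | e =
  ≤-reflexive (trans (+-identityʳ _) (trans (m≤n⇒m∸n≡0 (≤-trans (≤-reflexive (+-comm (f w) 1)) under)) (sym (m≤n⇒m∸n≡0 (<⇒≤ under)))))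
... | inj₂ (p , refl) | inj₁ q | e rewrite p | q | +-identityʳ (f w) | sym e =
  ≤-reflexive (sym (trans (cong (_∸ g w) (+-comm (f′ w) 1)) (trans (+-∸-assoc 1 {f′ w} {g w} (≤-pred (≤-trans over (≤-reflexive (+-comm (f′ w) 1))))) (+-comm 1 _))))
... | inj₂ (p , refl) | inj₂ (q , refl) | e = ⊥-elim (<-asym over under)

-- fuel bounds the total excess, which every exchange decreases.
balance : ∀ {k t} (xs : Vec (ℕ × ℕ) k) fuel (H : Edges (sum (sizes xs))) → Uniform t H →
  classSums (sizes xs) (deg H) ≡ classSums (sizes xs) (target xs) → ∑ _ (λ v → deg H v ∸ target xs v) ≤ fuel →
  Σ[ H′ ∈ Edges (sum (sizes xs)) ] Uniform t H′ × ∀ v → deg H′ v ≡ target xs v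
balance xs fuel H uni eq le with any? (λ u → target xs u <? deg H u)
... | no none = H , uni , classSums-tight (sizes xs) (λ v → ≮⇒≥ (λ p → none (v , p))) eq
balance xs zero H uni eq le | yes (u , over) = ⊥-elim (<⇒≱ (∑-strict _ {λ _ → 0} (λ _ → z≤n) u (m<n⇒0<n∸m over)) (≤-trans le z≤n))
balance xs (suc fuel) H uni eq le | yes (u , over) =
  let v , under , same , preserve = deficit xs (deg H) eq u over
      -- The exchange applies since `deg v < target v = target u < deg u`.
      H′ , uni′ , moves = exchange H uni u v (≤-trans under (≤-trans (≤-reflexive (sym same)) (<⇒≤ over)))
      shrunk = ≤-pred (≤-trans (≤-reflexive (+-comm 1 _)) (≤-trans (≤-reflexive (cong (∑ _ (λ w → deg H′ w ∸ target xs w) +_) (sym (∑-δ _ u))))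
                 (≤-trans (≤-reflexive (sym (∑-+ (sum (sizes xs)) (λ w → deg H′ w ∸ target xs w) (δ u)))) (≤-trans (∑-mono _ (∸-shift {g = target xs} moves over under)) le))))
  in balance xs fuel H′ uni′ (trans (preserve _ _ moves) eq) shrunk

-- Characteristic functions and lists of edges

subsets : ∀ n → List (Subset n)
subsets zero    = [] ∷ []
subsets (suc n) = List.map (false ∷_) (subsets n) List.++ List.map (true ∷_) (subsets n)

subsets-unique : ∀ n → Uniqueˡ.Unique (subsets n)
subsets-unique zero    = [] ∷ []
subsets-unique (suc n) = Uniqueˡ.++⁺ (Uniqueˡ.map⁺ ∷-injectiveʳᵛ (subsets-unique n)) (Uniqueˡ.map⁺ ∷-injectiveʳᵛ (subsets-unique n)) disjoint
  where
  disjoint : ∀ {e} → ¬ (e ∈ˡ List.map (false ∷_) (subsets n) × e ∈ˡ List.map (true ∷_) (subsets n))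
  disjoint (p , q) with ∈-map⁻ _ p | ∈-map⁻ _ q
  ... | _ , _ , refl | _ , _ , ()

sumOver : ∀ {A : Set} → (A → ℕ) → List A → ℕ
sumOver g l = sumˡ (List.map g l)

sumOver-++ : ∀ {A : Set} (g : A → ℕ) k l → sumOver g (k List.++ l) ≡ sumOver g k + sumOver g l
sumOver-++ g []      l = refl
sumOver-++ g (x ∷ k) l = trans (cong (g x +_) (sumOver-++ g k l)) (sym (+-assoc (g x) _ _))

sumOver-map : ∀ {A B : Set} (g : B → ℕ) (f : A → B) l → sumOver g (List.map f l) ≡ sumOver (λ x → g (f x)) l
sumOver-map g f []      = refl
sumOver-map g f (x ∷ l) = cong (g (f x) +_) (sumOver-map g f l)

sumOver-filter : ∀ {A : Set} (g : A → ℕ) p l → sumOver g (List.filterᵇ p l) ≡ sumOver (λ x → bit (p x) * g x) l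
sumOver-filter g p []      = refl
sumOver-filter g p (x ∷ l) with p x
... | true  = cong₂ _+_ (sym (+-identityʳ _)) (sumOver-filter g p l)
... | false = sumOver-filter g p l

sumOver-subsets : ∀ n g → sumOver g (subsets n) ≡ ∑ˢ n g
sumOver-subsets zero    g = +-identityʳ _
sumOver-subsets (suc n) g = trans (sumOver-++ g (List.map (false ∷_) (subsets n)) _)
  (cong₂ _+_ (trans (sumOver-map g (false ∷_) (subsets n)) (sumOver-subsets n _)) (trans (sumOver-map g (true ∷_) (subsets n)) (sumOver-subsets n _)))

degree-sumOver : ∀ {n} v (es : List (Subset n)) → List.length (List.filter (v ∈?_) es) ≡ sumOver (λ e → χ e v) es
degree-sumOver v []       = refl
degree-sumOver v (e ∷ es) with v ∈? e
... | yes v∈e = cong₂ _+_ (cong bit (sym ([]=⇒lookup v∈e))) (degree-sumOver v es)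
... | no  v∉e = cong₂ _+_ (cong bit (sym (¬T⇒≡ (λ t → v∉e (lookup⇒[]= v e (T⇒≡ t)))))) (degree-sumOver v es)

contains : ∀ {n} → List (Subset n) → Edges n
contains []       e = false
contains (x ∷ es) e = (x == e) ∨ contains es e

contains-sound : ∀ {n} (es : List (Subset n)) e → T (contains es e) → e ∈ˡ es
contains-sound (x ∷ es) e t with x == e in eq
... | true  = here (sym (==-sound x e (subst T (sym eq) _)))
... | false = there (contains-sound es e t)

∑ˢ-contains : ∀ {n} (es : List (Subset n)) → Uniqueˡ.Unique es → ∀ g → ∑ˢ n (λ e → bit (contains es e) * g e) ≡ sumOver g es
∑ˢ-contains {n} []       []        g = ∑ˢ-0 n
∑ˢ-contains {n} (x ∷ es) (x∉ ∷ uq) g = trans (∑ˢ-cong n split) (trans (∑ˢ-+ n _ _) (cong₂ _+_ (∑ˢ-== n x g) (∑ˢ-contains es uq g)))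
  where
  split : ∀ e → bit ((x == e) ∨ contains es e) * g e ≡ bit (x == e) * g e + bit (contains es e) * g e
  split e with x == e in eq | contains es e in eq′
  ... | true  | true  = ⊥-elim (All.lookup x∉ (contains-sound es e (subst T (sym eq′) _)) (==-sound x e (subst T (sym eq) _)))
  ... | true  | false = sym (+-identityʳ _)
  ... | false | _     = refl

fromEdges : ∀ {n t} (d : Vec ℕ n) (H : Edges n) → Uniform t H → (∀ v → deg H v ≡ lookup d v) → Hypergraphical t d
fromEdges {n} d H uni eq = record
  { edges   = List.filterᵇ H (subsets n)
  ; simple  = Uniqueˡ.filter⁺ (T? ∘ H) (subsets-unique n)
  ; uniform = All.tabulate (λ {e} e∈ → uni e (proj₂ (∈-filter⁻ (T? ∘ H) {xs = subsets n} e∈)))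
  } , λ v → trans (degree-sumOver v (List.filterᵇ H (subsets n)))
      (trans (sumOver-filter (λ e → χ e v) H (subsets n)) (trans (sumOver-subsets n _) (eq v)))

toEdges : ∀ {n t} (d : Vec ℕ n) → Hypergraphical t d → Σ[ H ∈ Edges n ] Uniform t H × ∀ v → deg H v ≡ lookup d v
toEdges d (G , eq) = contains (edges G) ,
  (λ e c → All.lookup (uniform G) (contains-sound (edges G) e c)) ,
  λ v → trans (∑ˢ-contains (edges G) (simple G) (λ e → χ e v)) (trans (sym (degree-sumOver v (edges G))) (eq v))

-- Types of edges

infix 4 _≈ᵇ_
_≈ᵇ_ : List ℕ → List ℕ → Bool
[]      ≈ᵇ []      = true
[]      ≈ᵇ (y ∷ b) = false
(x ∷ a) ≈ᵇ []      = false
(x ∷ a) ≈ᵇ (y ∷ b) = (x ≡ᵇ y) ∧ (a ≈ᵇ b)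

≈ᵇ-sound : ∀ a b → T (a ≈ᵇ b) → a ≡ b
≈ᵇ-sound []      []      t = refl
≈ᵇ-sound (x ∷ a) (y ∷ b) t =
  cong₂ _∷_ (≡ᵇ⇒≡ x y (proj₁ (Equivalence.to T-∧ t))) (≈ᵇ-sound a b (proj₂ (Equivalence.to (T-∧ {x ≡ᵇ y}) t)))

≈ᵇ-refl : ∀ a → T (a ≈ᵇ a)
≈ᵇ-refl []      = tt
≈ᵇ-refl (x ∷ a) = Equivalence.from T-∧ (≡⇒≡ᵇ x x refl , ≈ᵇ-refl a)

type : ∀ {k} (ns : Vec ℕ k) → Subset (sum ns) → List ℕ
type ns e = classSums ns (χ e)

ofType : ∀ {k} → Vec ℕ k → List ℕ → ℕ
ofType ns a = ∑ˢ (sum ns) (λ e → bit (type ns e ≈ᵇ a))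

-- Binomial coefficients

ofSize : ℕ → ℕ → ℕ
ofSize m a = ∑ˢ m (λ e → bit (∑ m (χ e) ≡ᵇ a))

-- The definition splits off the last factor; an induction on the size of the set needs the first
-- one.
falling-suc : ∀ m a → falling (suc m) (suc a) ≡ suc m * falling m a
falling-suc m zero    = refl
falling-suc m (suc a) = trans (cong ((m ∸ a) *_) (falling-suc m a)) (regroup (m ∸ a) (suc m) (falling m a))
  where
  regroup : ∀ a b c → a * (b * c) ≡ b * (a * c)
  regroup = solve-∀

-- Pascal's rule multiplied by the factorial: a subset of the larger set either omits or contains
-- the first element.
ofSize-falling : ∀ m a → a ! * ofSize m a ≡ falling m a
ofSize-falling zero    zero    = refl
ofSize-falling zero    (suc a) = trans (*-zeroʳ (suc a !)) (sym (cong (_* falling 0 a) (0∸n≡0 a)))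
ofSize-falling (suc m) zero    = trans (+-identityʳ _) (trans (cong (ofSize m 0 +_) (∑ˢ-0 m))
  (trans (+-identityʳ _) (trans (sym (+-identityʳ _)) (ofSize-falling m 0))))
ofSize-falling (suc m) (suc a) = begin
  suc a ! * (ofSize m (suc a) + ofSize m a)                 ≡⟨ regroup (suc a) (a !) (ofSize m (suc a)) (ofSize m a) ⟩
  suc a ! * ofSize m (suc a) + suc a * (a ! * ofSize m a)   ≡⟨ cong₂ _+_ (ofSize-falling m (suc a)) (cong (suc a *_) (ofSize-falling m a)) ⟩
  (m ∸ a) * falling m a + suc a * falling m a               ≡⟨ sym (*-distribʳ-+ (falling m a) (m ∸ a) (suc a)) ⟩
  (m ∸ a + suc a) * falling m a                             ≡⟨ pascal ⟩
  suc m * falling m a                                       ≡⟨ sym (falling-suc m a) ⟩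
  falling (suc m) (suc a)                                   ∎
  where
  open ≡-Reasoning
  regroup : ∀ s f p q → (s * f) * (p + q) ≡ (s * f) * p + s * (f * q)
  regroup = solve-∀
  -- For `a > m` the truncated factor is not `suc m`, but then `falling m a` is 0.
  pascal : (m ∸ a + suc a) * falling m a ≡ suc m * falling m a
  pascal with ≤-<-connex a m
  ... | inj₁ a≤m = cong (_* falling m a) (trans (+-suc (m ∸ a) a) (cong suc (m∸n+n≡m a≤m)))
  ... | inj₂ m<a = trans (cong ((m ∸ a + suc a) *_) (falling-zero m<a)) (trans (*-zeroʳ (m ∸ a + suc a))
                     (sym (trans (cong (suc m *_) (falling-zero m<a)) (*-zeroʳ (suc m)))))

∑ˢ-++ : ∀ m n g → ∑ˢ (m + n) g ≡ ∑ˢ m (λ x → ∑ˢ n (λ y → g (x Vec.++ y)))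
∑ˢ-++ zero    n g = refl
∑ˢ-++ (suc m) n g = cong₂ _+_ (∑ˢ-++ m n _) (∑ˢ-++ m n _)

type-++ : ∀ {k m} (ns : Vec ℕ k) (x : Subset m) y → type (m ∷ ns) (x Vec.++ y) ≡ ∑ m (χ x) ∷ type ns y
type-++ {m = m} ns x y = cong₂ _∷_ (∑-cong m (λ j → cong bit (lookup-++ˡ x y j))) (classSums-cong ns (λ j → cong bit (lookup-++ʳ x y j)))

bit-∧ : ∀ p q → bit (p ∧ q) ≡ bit p * bit q
bit-∧ true  q = sym (+-identityʳ _)
bit-∧ false q = refl

ofType-∷ : ∀ {k} m (ns : Vec ℕ k) a as → ofType (m ∷ ns) (a ∷ as) ≡ ofSize m a * ofType ns as
ofType-∷ m ns a as = begin
  ∑ˢ (m + sum ns) (λ e → bit (type (m ∷ ns) e ≈ᵇ (a ∷ as)))                       ≡⟨ ∑ˢ-++ m (sum ns) _ ⟩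
  ∑ˢ m (λ x → ∑ˢ (sum ns) (λ y → bit (type (m ∷ ns) (x Vec.++ y) ≈ᵇ (a ∷ as))))   ≡⟨ ∑ˢ-cong m inner ⟩
  ∑ˢ m (λ x → ofType ns as * bit (∑ m (χ x) ≡ᵇ a))                                 ≡⟨ ∑ˢ-*ˡ m (ofType ns as) _ ⟩
  ofType ns as * ofSize m a                                                        ≡⟨ *-comm (ofType ns as) (ofSize m a) ⟩
  ofSize m a * ofType ns as                                                        ∎
  where
  open ≡-Reasoning
  inner : ∀ x → ∑ˢ (sum ns) (λ y → bit (type (m ∷ ns) (x Vec.++ y) ≈ᵇ (a ∷ as))) ≡ ofType ns as * bit (∑ m (χ x) ≡ᵇ a)
  inner x = trans (∑ˢ-cong (sum ns) (λ y → trans (cong (λ b → bit (b ≈ᵇ (a ∷ as))) (type-++ ns x y)) (bit-∧ (∑ m (χ x) ≡ᵇ a) (type ns y ≈ᵇ as))))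
    (trans (∑ˢ-*ˡ (sum ns) (bit (∑ m (χ x) ≡ᵇ a)) _) (*-comm (bit (∑ m (χ x) ≡ᵇ a)) _))

fallings : ∀ {k} → List ℕ → Vec ℕ k → ℕ
fallings (a ∷ as) (n ∷ ns) = falling n a * fallings as ns
fallings _        _        = 1

-- The vertices are chosen independently in the classes, and `∏!` clears the denominators of all the
-- binomial coefficients at once.
ofType-fallings : ∀ {k} as (ns : Vec ℕ k) → len as ≡ k → ∏! as * ofType ns as ≡ fallings as ns
ofType-fallings []       []       eq = refl
ofType-fallings (a ∷ as) (n ∷ ns) eq = begin
  a ! * ∏! as * ofType (n ∷ ns) (a ∷ as)             ≡⟨ cong (a ! * ∏! as *_) (ofType-∷ n ns a as) ⟩
  a ! * ∏! as * (ofSize n a * ofType ns as)          ≡⟨ regroup (a !) (∏! as) (ofSize n a) (ofType ns as) ⟩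
  (a ! * ofSize n a) * (∏! as * ofType ns as)        ≡⟨ cong₂ _*_ (ofSize-falling n a) (ofType-fallings as ns (suc-injective eq)) ⟩
  falling n a * fallings as ns                       ∎
  where
  open ≡-Reasoning
  regroup : ∀ a b c d → a * b * (c * d) ≡ (a * c) * (b * d)
  regroup = solve-∀

∏!-nonZero : ∀ a → NonZero (∏! a)
∏!-nonZero []      = _
∏!-nonZero (x ∷ a) = m*n≢0 (x !) (∏! a) {{x !≢0}} {{∏!-nonZero a}}

-- Degree totals of the classes

classSums-∑ˢ : ∀ {k} (ns : Vec ℕ k) n (h : Subset n → Fin (sum ns) → ℕ) i →
  classSums ns (λ v → ∑ˢ n (λ e → h e v)) ‼ i ≡ ∑ˢ n (λ e → classSums ns (h e) ‼ i)
classSums-∑ˢ []       n h i       = sym (∑ˢ-0 n)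
classSums-∑ˢ (m ∷ ns) n h zero    = ∑-∑ˢ m n (λ e j → h e (j ↑ˡ sum ns))
classSums-∑ˢ (m ∷ ns) n h (suc i) = classSums-∑ˢ ns n (λ e j → h e (m ↑ʳ j)) i

classSums-*ˡ : ∀ {k} (ns : Vec ℕ k) c f i → classSums ns (λ v → c * f v) ‼ i ≡ c * classSums ns f ‼ i
classSums-*ˡ []       c f i       = sym (*-zeroʳ c)
classSums-*ˡ (m ∷ ns) c f zero    = ∑-*ˡ m c _
classSums-*ˡ (m ∷ ns) c f (suc i) = classSums-*ˡ ns c _ i

-- Double counting: an edge adds to the total of class `i` its number of vertices there, so the
-- totals depend on the edges through their types only.
classSums-deg : ∀ {k} (ns : Vec ℕ k) (H : Edges (sum ns)) i → classSums ns (deg H) ‼ i ≡ ∑ˢ (sum ns) (λ e → bit (H e) * type ns e ‼ i)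
classSums-deg ns H i = trans (classSums-∑ˢ ns (sum ns) (λ e v → bit (H e) * χ e v) i) (∑ˢ-cong (sum ns) (λ e → classSums-*ˡ ns (bit (H e)) (χ e) i))

len-classSums : ∀ {k} (ns : Vec ℕ k) f → len (classSums ns f) ≡ k
len-classSums []       f = refl
len-classSums (m ∷ ns) f = cong suc (len-classSums ns _)

∑-split : ∀ m n f → ∑ (m + n) f ≡ ∑ m (λ j → f (j ↑ˡ n)) + ∑ n (λ j → f (m ↑ʳ j))
∑-split zero    n f = refl
∑-split (suc m) n f = trans (cong (f zero +_) (∑-split m n (f ∘ suc))) (sym (+-assoc (f zero) _ _))

sum-classSums : ∀ {k} (ns : Vec ℕ k) f → sumˡ (classSums ns f) ≡ ∑ (sum ns) f
sum-classSums []       f = refl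
sum-classSums (m ∷ ns) f = trans (cong (∑ m (λ j → f (j ↑ˡ sum ns)) +_) (sum-classSums ns _)) (sym (∑-split m (sum ns) f))

sum-type : ∀ {k} (ns : Vec ℕ k) e → sumˡ (type ns e) ≡ ∣ e ∣
sum-type ns e = trans (sum-classSums ns (χ e)) (sym (∣∣≡∑ e))

‼-ext : ∀ v w → len v ≡ len w → (∀ i → v ‼ i ≡ w ‼ i) → v ≡ w
‼-ext []      []      l e = refl
‼-ext (x ∷ v) (y ∷ w) l e = cong₂ _∷_ (e 0) (‼-ext v w (suc-injective l) (e ∘ suc))

‼≤sum : ∀ v i → v ‼ i ≤ sumˡ v
‼≤sum []      i       = z≤n
‼≤sum (x ∷ v) zero    = m≤m+n x _
‼≤sum (x ∷ v) (suc i) = ≤-trans (‼≤sum v i) (m≤n+m _ x)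

∑-const : ∀ n c f → (∀ v → f v ≡ c) → ∑ n f ≡ n * c
∑-const zero    c f eq = refl
∑-const (suc n) c f eq = cong₂ _+_ (eq zero) (∑-const n c (f ∘ suc) (eq ∘ suc))

totals : ∀ {k} → Vec (ℕ × ℕ) k → List ℕ
totals []             = []
totals ((d , n) ∷ xs) = n * d ∷ totals xs

classSums-target : ∀ {k} (xs : Vec (ℕ × ℕ) k) → classSums (sizes xs) (target xs) ≡ totals xs
classSums-target []             = refl
classSums-target ((d , n) ∷ xs) = cong₂ _∷_ (∑-const n d _ (target-↑ˡ d n xs))
  (trans (classSums-cong (sizes xs) (target-↑ʳ d n xs)) (classSums-target xs))

-- x j is the number of edges whose type is the j-th element of A.

Feasible : (List ℕ → ℕ) → List (List ℕ) → (ℕ → ℕ) → Set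
Feasible N []      x = ⊤
Feasible N (a ∷ A) x = x 0 ≤ N a × Feasible N A (x ∘ suc)

degrees : List (List ℕ) → (ℕ → ℕ) → ℕ → ℕ
degrees []      x i = 0
degrees (a ∷ A) x i = x 0 * a ‼ i + degrees A (x ∘ suc) i

module _ {k} (ns : Vec ℕ k) where

  private
    n : ℕ
    n = sum ns

  typeCount : Edges n → List ℕ → ℕ
  typeCount H a = ∑ˢ n (λ e → bit (H e) * bit (type ns e ≈ᵇ a))

  counts : Edges n → List (List ℕ) → ℕ → ℕ
  counts H []      j       = 0
  counts H (a ∷ A) zero    = typeCount H a
  counts H (a ∷ A) (suc j) = counts H A j

  counts-feasible : ∀ H A → Feasible (ofType ns) A (counts H A)
  counts-feasible H []      = tt
  counts-feasible H (a ∷ A) = ∑ˢ-mono n (λ e → bound (H e) (bit (type ns e ≈ᵇ a))) , counts-feasible H A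
    where
    bound : ∀ b m → bit b * m ≤ m
    bound true  m = ≤-reflexive (+-identityʳ m)
    bound false m = z≤n

  member : List (List ℕ) → List ℕ → Bool
  member []      b = false
  member (a ∷ A) b = (b ≈ᵇ a) ∨ member A b

  member-sound : ∀ A {b} → T (member A b) → b ∈ˡ A
  member-sound (a ∷ A) {b} t with b ≈ᵇ a in eq
  ... | true  = here (≈ᵇ-sound b a (subst T (sym eq) tt))
  ... | false = there (member-sound A t)

  member-complete : ∀ A {b} → b ∈ˡ A → member A b ≡ true
  member-complete (a ∷ A) (here refl) rewrite T⇒≡ (≈ᵇ-refl a) = refl
  member-complete (a ∷ A) {b} (there b∈) with b ≈ᵇ a
  ... | true  = refl
  ... | false = member-complete A b∈

  -- As `A` has no repetitions, each edge is counted at most once. The factor with `member` discards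
  -- edges of types outside `A`; it disappears when `H` is uniform and `A` complete.
  counts-degrees : ∀ H A → Uniqueˡ.Unique A → ∀ i →
    degrees A (counts H A) i ≡ ∑ˢ n (λ e → bit (H e) * (bit (member A (type ns e)) * type ns e ‼ i))
  counts-degrees H []      []        i = sym (trans (∑ˢ-cong n (λ e → *-zeroʳ (bit (H e)))) (∑ˢ-0 n))
  counts-degrees H (a ∷ A) (a∉ ∷ uq) i = begin
    typeCount H a * a ‼ i + degrees A (counts H A) i         ≡⟨ cong₂ _+_ (trans (*-comm (typeCount H a) (a ‼ i)) (sym (∑ˢ-*ˡ n (a ‼ i) _))) (counts-degrees H A uq i) ⟩
    ∑ˢ n (λ e → a ‼ i * (bit (H e) * bit (type ns e ≈ᵇ a)))
      + ∑ˢ n (λ e → bit (H e) * (bit (member A (type ns e)) * type ns e ‼ i))  ≡⟨ sym (∑ˢ-+ n _ _) ⟩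
    ∑ˢ n (λ e → a ‼ i * (bit (H e) * bit (type ns e ≈ᵇ a))
      + bit (H e) * (bit (member A (type ns e)) * type ns e ‼ i))             ≡⟨ ∑ˢ-cong n (λ e → pointwise (bit (H e)) (type ns e)) ⟩
    ∑ˢ n (λ e → bit (H e) * (bit (member (a ∷ A) (type ns e)) * type ns e ‼ i)) ∎
    where
    open ≡-Reasoning
    pointwise : ∀ h b → a ‼ i * (h * bit (b ≈ᵇ a)) + h * (bit (member A b) * b ‼ i) ≡ h * (bit ((b ≈ᵇ a) ∨ member A b) * b ‼ i)
    pointwise h b with b ≈ᵇ a in eq | member A b in eq′
    ... | true  | true  = ⊥-elim (All.lookup a∉ (member-sound A (subst T (sym eq′) tt)) (sym (≈ᵇ-sound b a (subst T (sym eq) tt))))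
    ... | true  | false rewrite ≈ᵇ-sound b a (subst T (sym eq) tt) = regroup h (a ‼ i)
      where
      regroup : ∀ h x → x * (h * 1) + h * 0 ≡ h * (1 * x)
      regroup = solve-∀
    ... | false | c = cong (_+ h * (bit c * b ‼ i)) (trans (cong (a ‼ i *_) (*-zeroʳ h)) (*-zeroʳ (a ‼ i)))

  choose : ∀ n (p : Edges n) m → m ≤ ∑ˢ n (λ e → bit (p e)) → Σ[ q ∈ Edges n ] (∀ e → T (q e) → T (p e)) × ∑ˢ n (λ e → bit (q e)) ≡ m
  choose zero    p zero    le = (λ _ → false) , (λ _ ()) , refl
  choose zero    p (suc m) le with p [] in eq
  choose zero    p (suc zero) le | true = (λ _ → true) , (λ { [] _ → subst T (sym eq) tt }) , refl
  choose zero    p (suc (suc m)) (s≤s ()) | true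
  -- Greedily: as many subsets as possible without the first vertex, the remaining ones with it.
  choose (suc n) p m le =
    let s  = ∑ˢ n (λ e → bit (p (false ∷ e)))
        q , q⇒p , eq    = choose n (λ e → p (false ∷ e)) (s ⊓ m) (m⊓n≤m s m)
        q′ , q′⇒p , eq′ = choose n (λ e → p (true ∷ e)) (m ∸ s) (≤-trans (∸-monoˡ-≤ s le) (≤-reflexive (m+n∸m≡n s _)))
    in (λ { (false ∷ e) → q e ; (true ∷ e) → q′ e }) , (λ { (false ∷ e) → q⇒p e ; (true ∷ e) → q′⇒p e }) ,
       trans (cong₂ _+_ eq eq′) (m⊓n+n∸m≡n s m)

  -- Edges are chosen for each type separately. The types in `A` are distinct, so the choices are
  -- disjoint and their contributions add up.
  realise : ∀ A x → Uniqueˡ.Unique A → Feasible (ofType ns) A x →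
    Σ[ H ∈ Edges n ] (∀ e → T (H e) → type ns e ∈ˡ A) × ∀ i → ∑ˢ n (λ e → bit (H e) * type ns e ‼ i) ≡ degrees A x i
  realise []      x []        f       = (λ _ → false) , (λ _ ()) , λ i → ∑ˢ-0 n
  realise (a ∷ A) x (a∉ ∷ uq) (f , g) with choose n (λ e → type ns e ≈ᵇ a) (x 0) f | realise A (x ∘ suc) uq g
  ... | P , P⇒a , countP | H , H⇒A , degH = (λ e → P e ∨ H e) , types , λ i →
    trans (∑ˢ-cong n (pointwise i)) (trans (∑ˢ-+ n _ _) (cong₂ _+_
      (trans (∑ˢ-*ˡ n (a ‼ i) _) (trans (cong (a ‼ i *_) countP) (*-comm (a ‼ i) (x 0)))) (degH i)))
    where
    types : ∀ e → T (P e ∨ H e) → type ns e ∈ˡ (a ∷ A)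
    types e t with P e in eq
    ... | true  = here (≈ᵇ-sound (type ns e) a (P⇒a e (subst T (sym eq) tt)))
    ... | false = there (H⇒A e t)
    pointwise : ∀ i e → bit (P e ∨ H e) * type ns e ‼ i ≡ a ‼ i * bit (P e) + bit (H e) * type ns e ‼ i
    pointwise i e with P e in eq | H e in eq′
    ... | true  | true  = ⊥-elim (All.lookup a∉ (H⇒A e (subst T (sym eq′) tt)) (sym (≈ᵇ-sound (type ns e) a (P⇒a e (subst T (sym eq) tt)))))
    ... | true  | false = trans (+-identityʳ _) (trans (cong (_‼ i) (≈ᵇ-sound (type ns e) a (P⇒a e (subst T (sym eq) tt))))
                            (sym (trans (+-identityʳ _) (*-identityʳ _))))
    ... | false | c     = cong (_+ bit c * type ns e ‼ i) (sym (*-zeroʳ (a ‼ i)))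

-- Hypergraphs and feasible numbers of edges

record Admissible (k t : ℕ) (A : List (List ℕ)) : Set where
  field
    unique   : Uniqueˡ.Unique A
    length≡  : ∀ {a} → a ∈ˡ A → len a ≡ k
    sum≡     : ∀ {a} → a ∈ˡ A → sumˡ a ≡ t
    complete : ∀ {a} → len a ≡ k → sumˡ a ≡ t → a ∈ˡ A

module _ {k t A} (adm : Admissible k t A) (xs : Vec (ℕ × ℕ) k) where

  open Admissible adm

  hypergraphical⇒feasible : Hypergraphical t (degreeSequence xs) →
    ∃[ x ] Feasible (ofType (sizes xs)) A x × ∀ i → degrees A x i ≡ totals xs ‼ i
  hypergraphical⇒feasible hyp =
    let H , uni , deg≡ = toEdges (degreeSequence xs) hyp
    in counts (sizes xs) H A , counts-feasible (sizes xs) H A , λ i → begin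
      degrees A (counts (sizes xs) H A) i  ≡⟨ counts-degrees (sizes xs) H A unique i ⟩
      ∑ˢ _ (λ e → bit (H e) * (bit (member (sizes xs) A (type (sizes xs) e)) * type (sizes xs) e ‼ i))
                                           ≡⟨ ∑ˢ-cong _ (λ e → drop-member H uni e i) ⟩
      ∑ˢ _ (λ e → bit (H e) * type (sizes xs) e ‼ i)  ≡⟨ sym (classSums-deg (sizes xs) H i) ⟩
      classSums (sizes xs) (deg H) ‼ i     ≡⟨ cong (_‼ i) (trans (classSums-cong (sizes xs) deg≡) (classSums-target xs)) ⟩
      totals xs ‼ i                        ∎
    where
    open ≡-Reasoning
    drop-member : ∀ H → Uniform t H → ∀ e i →
      bit (H e) * (bit (member (sizes xs) A (type (sizes xs) e)) * type (sizes xs) e ‼ i) ≡ bit (H e) * type (sizes xs) e ‼ i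
    drop-member H uni e i with H e in eq
    ... | false = refl
    ... | true  = cong (_+ 0) (trans (cong (λ b → bit b * type (sizes xs) e ‼ i)
                    (member-complete (sizes xs) A (complete (len-classSums (sizes xs) (χ e))
                      (trans (sum-type (sizes xs) e) (uni e (subst T (sym eq) tt)))))) (+-identityʳ _))

  feasible⇒hypergraphical : ∀ x → Feasible (ofType (sizes xs)) A x → (∀ i → degrees A x i ≡ totals xs ‼ i) →
    Hypergraphical t (degreeSequence xs)
  feasible⇒hypergraphical x f d =
    let H , H⇒A , degH   = realise (sizes xs) A x unique f
        uni              = λ e h → trans (sym (sum-type (sizes xs) e)) (sum≡ (H⇒A e h))
        sums             = ‼-ext (classSums (sizes xs) (deg H)) (classSums (sizes xs) (target xs))
                             (trans (len-classSums (sizes xs) _) (sym (len-classSums (sizes xs) _)))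
                             (λ i → trans (classSums-deg (sizes xs) H i) (trans (degH i) (trans (d i) (cong (_‼ i) (sym (classSums-target xs))))))
        H′ , uni′ , deg≡ = balance xs _ H uni sums ≤-refl
    in fromEdges (degreeSequence xs) H′ uni′ deg≡

-- The degree constraints come after one capacity constraint for each type.

afterTypes : List (List ℕ) → (ℕ → ℕ) → ℕ → ℕ
afterTypes []      g i       = g i
afterTypes (a ∷ A) g zero    = 0
afterTypes (a ∷ A) g (suc i) = afterTypes A g i

afterTypes-‼ : ∀ A v i → (List.map (λ _ → 0) A List.++ v) ‼ i ≡ afterTypes A (v ‼_) i
afterTypes-‼ []      v i       = refl
afterTypes-‼ (a ∷ A) v zero    = refl
afterTypes-‼ (a ∷ A) v (suc i) = afterTypes-‼ A v i

afterTypes-+ : ∀ A c d e i → afterTypes A d i + c * afterTypes A e i ≡ afterTypes A (λ j → d j + c * e j) i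
afterTypes-+ []      c d e i       = refl
afterTypes-+ (a ∷ A) c d e zero    = *-zeroʳ c
afterTypes-+ (a ∷ A) c d e (suc i) = afterTypes-+ A c d e i

lin-shift : ∀ vs z i → lin (List.map (0 ∷_) vs) z (suc i) ≡ lin vs z i
lin-shift []       z i = refl
lin-shift (v ∷ vs) z i = cong (z 0 * v ‼ i +_) (lin-shift vs (z ∘ suc) i)

lin-shift-0 : ∀ vs z → lin (List.map (0 ∷_) vs) z 0 ≡ 0
lin-shift-0 []       z = refl
lin-shift-0 (v ∷ vs) z = cong₂ _+_ (*-zeroʳ (z 0)) (lin-shift-0 vs (z ∘ suc))

-- Below the capacity row of `a`, the unknown `z 0` acts on the degree rows only. Its share is moved
-- into the offset `d`, which leaves the system for `A` with the unknowns shifted by two.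
lin-columns-suc : ∀ a A z d i → afterTypes A d i + lin (columns (a ∷ A)) z (suc i)
  ≡ afterTypes A (λ j → d j + z 0 * a ‼ j) i + lin (columns A) (λ j → z (2 + j)) i
lin-columns-suc a A z d i = begin
  afterTypes A d i + (z 0 * (List.map (λ _ → 0) A List.++ a) ‼ i + (z 1 * 0 + lin (List.map (0 ∷_) (columns A)) z″ (suc i)))
    ≡⟨ cong₂ (λ p q → afterTypes A d i + (z 0 * p + q)) (afterTypes-‼ A a i) (cong₂ _+_ (*-zeroʳ (z 1)) (lin-shift (columns A) z″ i)) ⟩
  afterTypes A d i + (z 0 * afterTypes A (a ‼_) i + lin (columns A) z″ i)
    ≡⟨ sym (+-assoc (afterTypes A d i) _ _) ⟩
  afterTypes A d i + z 0 * afterTypes A (a ‼_) i + lin (columns A) z″ i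
    ≡⟨ cong (_+ lin (columns A) z″ i) (afterTypes-+ A (z 0) d (a ‼_) i) ⟩
  afterTypes A (λ j → d j + z 0 * a ‼ j) i + lin (columns A) z″ i ∎
  where
  open ≡-Reasoning
  z″ : ℕ → ℕ
  z″ j = z (2 + j)

lin-columns-0 : ∀ a A z → lin (columns (a ∷ A)) z 0 ≡ z 0 * ∏! a + z 1
lin-columns-0 a A z = cong (z 0 * ∏! a +_) (trans (cong₂ _+_ (*-identityʳ (z 1)) (lin-shift-0 (columns A) _)) (+-identityʳ _))

rows : (List ℕ → ℕ) → List (List ℕ) → List ℕ → List ℕ
rows cap A ds = List.map cap A List.++ ds

module _ (cap N : List ℕ → ℕ) (ds : List ℕ) where

  -- The offset `d` collects the degrees due to the types already split off, which makes the
  -- induction on `A` go through.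
  solution⇒feasible : ∀ A → (∀ {a} → a ∈ˡ A → cap a ≡ ∏! a * N a) → ∀ d z →
    (∀ i → afterTypes A d i + lin (columns A) z i ≡ rows cap A ds ‼ i) →
    ∃[ x ] Feasible N A x × ∀ i → d i + degrees A x i ≡ ds ‼ i
  solution⇒feasible []      capN d z sol = z , tt , sol
  solution⇒feasible (a ∷ A) capN d z sol =
    let x , f , deg≡ = solution⇒feasible A (capN ∘ there) (λ j → d j + z 0 * a ‼ j) (λ j → z (2 + j))
                         (λ i → trans (sym (lin-columns-suc a A z d i)) (sol (suc i)))
    in (λ { zero → z 0 ; (suc j) → x j }) ,
       -- The first row says that `∏! a` times the unknown plus a slack is `∏! a * N a`; the
       -- positive factor cancels.
       (*-cancelˡ-≤ (∏! a) {{∏!-nonZero a}} (≤-trans (≤-reflexive (*-comm (∏! a) (z 0))) (≤-trans (m≤m+n _ (z 1))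
         (≤-reflexive (trans (sym (lin-columns-0 a A z)) (trans (sol 0) (capN (here refl))))))) , f) ,
       λ i → trans (sym (+-assoc (d i) _ _)) (deg≡ i)

  feasible⇒solution : ∀ A → (∀ {a} → a ∈ˡ A → cap a ≡ ∏! a * N a) → ∀ d x → Feasible N A x →
    (∀ i → d i + degrees A x i ≡ ds ‼ i) → ∃[ z ] ∀ i → afterTypes A d i + lin (columns A) z i ≡ rows cap A ds ‼ i
  feasible⇒solution []      capN d x f       deg≡ = x , deg≡
  feasible⇒solution (a ∷ A) capN d x (p , f) deg≡ =
    let z , sol = feasible⇒solution A (capN ∘ there) (λ j → d j + x 0 * a ‼ j) (x ∘ suc) f
                    (λ i → trans (+-assoc (d i) _ _) (deg≡ i))
        y : ℕ → ℕ
        y = λ { zero → x 0 ; (suc zero) → cap a ∸ x 0 * ∏! a ; (suc (suc j)) → z j }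
    in y , λ
      { zero    → trans (lin-columns-0 a A y) (m+[n∸m]≡n (≤-trans (≤-reflexive (*-comm (x 0) (∏! a)))
                    (≤-trans (*-monoʳ-≤ (∏! a) p) (≤-reflexive (sym (capN (here refl)))))))
      ; (suc i) → trans (lin-columns-suc a A y d i) (sol i) }

afterTypes-0 : ∀ A i → afterTypes A (λ _ → 0) i ≡ 0
afterTypes-0 []      i       = refl
afterTypes-0 (a ∷ A) zero    = refl
afterTypes-0 (a ∷ A) (suc i) = afterTypes-0 A i

module _ {k t A} (adm : Admissible k t A) (xs : Vec (ℕ × ℕ) k) (cap : List ℕ → ℕ)
         (cap≡ : ∀ {a} → a ∈ˡ A → cap a ≡ fallings a (sizes xs)) where

  open Admissible adm

  private
    capN : ∀ {a} → a ∈ˡ A → cap a ≡ ∏! a * ofType (sizes xs) a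
    capN {a} a∈ = trans (cap≡ a∈) (sym (ofType-fallings a (sizes xs) (length≡ a∈)))

  hypergraphical⇒solvable : Hypergraphical t (degreeSequence xs) → Solvable (columns A) (λ _ → 0) (rows cap A (totals xs) ‼_)
  hypergraphical⇒solvable hyp =
    let x , f , deg≡ = hypergraphical⇒feasible adm xs hyp
        z , sol      = feasible⇒solution cap (ofType (sizes xs)) (totals xs) A capN (λ _ → 0) x f deg≡
    in z , λ i → trans (cong (_+ lin (columns A) z i) (sym (afterTypes-0 A i))) (sol i)

  solvable⇒hypergraphical : Solvable (columns A) (λ _ → 0) (rows cap A (totals xs) ‼_) → Hypergraphical t (degreeSequence xs)
  solvable⇒hypergraphical (z , sol) =
    let x , f , deg≡ = solution⇒feasible cap (ofType (sizes xs)) (totals xs) A capN (λ _ → 0) z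
                         (λ i → trans (cong (_+ lin (columns A) z i) (afterTypes-0 A i)) (sol i))
    in feasible⇒hypergraphical adm xs x f deg≡

prefixes-unique : ∀ n L → Uniqueˡ.Unique L → Uniqueˡ.Unique (prefixes n L)
prefixes-unique zero    L uq = []
prefixes-unique (suc n) L uq = Uniqueˡ.++⁺ (Uniqueˡ.map⁺ ∷-injectiveʳ uq) (prefixes-unique n L uq) disjoint
  where
  disjoint : ∀ {w} → ¬ (w ∈ˡ List.map (n ∷_) L × w ∈ˡ prefixes n L)
  disjoint (p , q) with ∈-map⁻ _ p | ∈-prefixes⁻ n L q
  ... | _ , _ , refl | j , v , j<n , _ , eq = <⇒≢ j<n (sym (∷-injectiveˡ eq))

below-unique : ∀ m → Uniqueˡ.Unique (below m)
below-unique []      = [] ∷ []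
below-unique (x ∷ m) = prefixes-unique (suc x) (below m) (below-unique m)

-- The algorithm

digit : Bit → Bool
digit zero       = false
digit (suc zero) = true

bits : ℕ → List Bool
bits n = List.map digit (binary n)

val-bits : ∀ n → val (bits n) ≡ n
val-bits n = trans (go (binary n)) (proj₂ (toDigits 2 n))
  where
  go : ∀ ds → val (List.map digit ds) ≡ fromDigits ds
  go []       = refl
  go (d ∷ ds) = cong₂ _+_ (bit-digit d) (trans (cong (2 *_) (go ds)) (*-comm 2 (fromDigits ds)))
    where
    bit-digit : ∀ d → bit (digit d) ≡ toℕ d
    bit-digit zero       = refl
    bit-digit (suc zero) = refl

enc-bits : ∀ n → enc (list bool) (bits n) ≡ encodeℕ n
enc-bits n = go (binary n)
  where
  go : ∀ ds → enc (list bool) (List.map digit ds) ≡ encodeList encodeBit ds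
  go []              = refl
  go (zero ∷ ds)     = cong (nil ∙_) (go ds)
  go (suc zero ∷ ds) = cong ((nil ∙ nil) ∙_) (go ds)

classBits : ∀ {k} → Vec (ℕ × ℕ) k → List (List Bool × List Bool)
classBits []             = []
classBits ((d , n) ∷ xs) = (bits d , bits n) ∷ classBits xs

enc-input : ∀ {k} t (xs : Vec (ℕ × ℕ) k) → enc (list bool ⊗ list Number×Number) (bits t , classBits xs) ≡ encodeInput t xs
enc-input t xs = cong₂ _∙_ (enc-bits t) (go xs)
  where
  go : ∀ {k} (xs : Vec (ℕ × ℕ) k) → enc (list Number×Number) (classBits xs) ≡ encodeList (λ (d , n) → encodeℕ d ∙ encodeℕ n) (toList xs)
  go []             = refl
  go ((d , n) ∷ xs) = cong₂ _∙_ (cong₂ _∙_ (enc-bits d) (enc-bits n)) (go xs)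

len-classBits : ∀ {k} (xs : Vec (ℕ × ℕ) k) → len (classBits xs) ≡ k
len-classBits []             = refl
len-classBits ((d , n) ∷ xs) = cong suc (len-classBits xs)

weight-classBits : ∀ {k} (xs : Vec (ℕ × ℕ) k) → weight (classBits xs) ≡ k + inputSize xs
weight-classBits         []             = refl
weight-classBits {suc k} ((d , n) ∷ xs) rewrite weight-classBits xs | length-map digit (binary d) | length-map digit (binary n) =
  cong suc (regroup (bitLength d) (bitLength n) k (inputSize xs))
  where
  regroup : ∀ a b k s → a + b + (k + s) ≡ k + (a + b + s)
  regroup = solve-∀

capacity-classBits : ∀ {k} as (xs : Vec (ℕ × ℕ) k) → capacity as (classBits xs) ≡ fallings as (sizes xs)
capacity-classBits []       xs             = refl
capacity-classBits (a ∷ as) []             = refl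
capacity-classBits (a ∷ as) ((d , n) ∷ xs) = cong₂ _*_ (cong (λ m → falling m a) (val-bits n)) (capacity-classBits as xs)

opaque
  -- The result is exponential in the length of the argument, which is admissible because it is
  -- applied to the parameter `t`.
  unaryTm : Tm (list bool ∷ []) nat
  unaryTm = foldr (cond v0 (op succ (call addN (v1 ∷ v1 ∷ []))) (call addN (v1 ∷ v1 ∷ []))) (con 0) v0

  unaryTm-run : ∀ x → run unaryTm (x , tt) ≡ val x
  unaryTm-run x = go x
    where
    twice : ∀ m → run addN (m , m , tt) ≡ 2 * m
    twice m = trans (addN-run m m) (cong (m +_) (sym (+-identityʳ m)))
    go : ∀ z → List.foldr (λ b n → ifᵇ b then suc (run addN (n , n , tt)) else run addN (n , n , tt)) 0 z ≡ val z
    go []          = refl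
    go (true ∷ z)  = cong suc (trans (twice _) (cong (2 *_) (go z)))
    go (false ∷ z) = trans (twice _) (cong (2 *_) (go z))

opaque
  boundsTm : Tm (nat ∷ list Number×Number ∷ []) (list nat)
  boundsTm = foldr (cons v2 v1) (con []) v1

  boundsTm-run : ∀ t xs → run boundsTm (t , xs , tt) ≡ List.replicate (len xs) t
  boundsTm-run t xs = go xs
    where
    go : ∀ (ys : List (List Bool × List Bool)) → List.foldr (λ _ r → t ∷ r) [] ys ≡ List.replicate (len ys) t
    go []       = refl
    go (y ∷ ys) = cong (t ∷_) (go ys)

  boundsTm-time : PolyTime boundsTm (λ (t , xs , _) → len xs)
  boundsTm-time = polynomial $ foldr-light (cons v2 v1) (con []) v1 (λ γ → γ) (λ _ → refl) (Bounded-const 0) (Bounded-const 0) Bounded-size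

opaque
  setupTm : Tm (nat ∷ list nat ∷ []) (list (list nat) ⊗ (list (list nat) ⊗ list (list nat)))
  setupTm = bind (call typesTm (v0 ∷ v1 ∷ [])) (bind (call columnsTm (v0 ∷ []))
    (bind (call belowTm (call columnSumTm (v0 ∷ []) ∷ [])) (pair v2 (pair v1 v0))))

  setupTm-run : ∀ t m → let A = run typesTm (t , m , tt) in run setupTm (t , m , tt) ≡ (A , columns A , U (columns A))
  setupTm-run t m rewrite columnsTm-run (run typesTm (t , m , tt)) | belowTm-run (run columnSumTm (columns (run typesTm (t , m , tt)) , tt)) = refl

types : ℕ × ℕ → List (List ℕ)
types (k , t) = run typesTm (t , List.replicate k t , tt)

admissible : ∀ k t → Admissible k t (types (k , t))
admissible k t = record
  { unique   = subst Uniqueˡ.Unique (sym eq) (Uniqueˡ.filter⁺ (T? ∘ p) (below-unique (List.replicate k t)))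
  ; length≡  = λ a∈ → trans (proj₁ (∈-below⁻ (List.replicate k t) (proj₁ (∈f a∈)))) (length-replicate k)
  ; sum≡     = λ {a} a∈ → trans (sym (sumN-run a)) (≡ᵇ⇒≡ _ t (subst T (eqN-run _ t) (proj₂ (∈f a∈))))
  ; complete = λ {a} l s → subst (a ∈ˡ_) (sym eq) (∈-filter⁺ (T? ∘ p) (in-below a l s)
      (subst T (sym (eqN-run _ t)) (≡⇒≡ᵇ _ t (trans (sumN-run a) s))))
  }
  where
  p : List ℕ → Bool
  p a = run eqN (run sumN (a , tt) , t , tt)
  eq : types (k , t) ≡ List.filterᵇ p (below (List.replicate k t))
  eq = typesTm-run t (List.replicate k t)
  ∈f : ∀ {a} → a ∈ˡ types (k , t) → a ∈ˡ below (List.replicate k t) × T (p a)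
  ∈f {a} a∈ = ∈-filter⁻ (T? ∘ p) {xs = below (List.replicate k t)} (subst (a ∈ˡ_) eq a∈)
  -- No entry exceeds the sum `t`, so the box with all bounds equal to `t` contains every type.
  replicate-‼ : ∀ k a → len a ≡ k → sumˡ a ≡ t → ∀ i → a ‼ i ≤ List.replicate k t ‼ i
  replicate-‼ k a l s i = go k a l (λ j → ≤-trans (‼≤sum a j) (≤-reflexive s)) i
    where
    go : ∀ k a → len a ≡ k → (∀ j → a ‼ j ≤ t) → ∀ i → a ‼ i ≤ List.replicate k t ‼ i
    go zero    []      l le i       = z≤n
    go (suc k) (x ∷ a) l le zero    = le 0
    go (suc k) (x ∷ a) l le (suc i) = go k a (suc-injective l) (le ∘ suc) i
  in-below : ∀ a → len a ≡ k → sumˡ a ≡ t → a ∈ˡ below (List.replicate k t)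
  in-below a l s =
    let w , w∈ , e = ∈-below⁺ (List.replicate k t) (a ‼_) (replicate-‼ k a l s)
    in subst (_∈ˡ _) (‼-ext w a (trans (proj₁ (∈-below⁻ (List.replicate k t) w∈)) (trans (length-replicate k) (sym l))) e) w∈

-- The right-hand side of the system

size-elements : ∀ A {n} → size (list (list nat)) A ≤ n → All.All (λ a → size (list nat) a ≤ n) A
size-elements []      le = []
size-elements (a ∷ A) le = ≤-trans (m≤m+n _ _) (≤-trans (n≤1+n _) le) ∷
  size-elements A (≤-trans (m≤n+m _ (size (list nat) a)) (≤-trans (n≤1+n _) le))

opaque
  capacitiesTm : Tm (list (list nat) ∷ list Number×Number ∷ []) (list (list bool))
  capacitiesTm = foldr (cons (call capacityTm (v0 ∷ v3 ∷ [])) v1) (con []) v0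

  capacitiesTm-run : ∀ A xs → run capacitiesTm (A , xs , tt) ≡ List.map (λ a → run capacityTm (a , xs , tt)) A
  capacitiesTm-run A xs = trans (map-run _ A []) (++-identityʳ _)

  capacitiesTm-time : PolyTime capacitiesTm (λ (A , xs , _) → size (list (list nat)) A + weight xs)
  capacitiesTm-time = polynomial $ foldr-Bounded (cons (call capacityTm (v0 ∷ v3 ∷ [])) v1) (con []) v0 (λ γ → γ)
    (λ (A , _) a → size (list nat) a ≤ size (list (list nat)) A) (λ _ _ _ → ⊤)
    (λ (A , xs , _) → monomial (proj₁ B tt) (proj₁ (proj₂ B)) (size (list (list nat)) A + weight xs))
    (λ (A , xs , _) {j} {a} q _ → (≤-trans (≤-reflexive (+-identityʳ _)) (≤-trans (proj₂ (proj₂ B) (a , xs , tt))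
      (monomial-mono (proj₁ B tt) (proj₁ (proj₂ B)) (+-monoˡ-≤ (weight xs) q)))) , tt)
    (λ (A , _) → size-elements A ≤-refl) (λ _ → tt)
    (Bounded-const 0) (Bounded-const 0)
    (Bounded-≤ (λ (A , xs , _) → ≤-trans (len≤size (list nat) A) (m≤m+n _ (weight xs))) Bounded-size)
    (Bounded-monomial (proj₁ B tt) (proj₁ (proj₂ B)) Bounded-size)
    where
    B : Bounded (λ _ → tt) capSize (time capacityTm)
    B = PolyTime.bound capacityTm-time

opaque
  totalsTm : Tm (list Number×Number ∷ []) (list (list bool))
  totalsTm = foldr (cons (call mulTm (op snd v0 ∷ op fst v0 ∷ [])) v1) (con []) v0

  totalsTm-run : ∀ xs → run totalsTm (xs , tt) ≡ List.map (λ (d , n) → run mulTm (n , d , tt)) xs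
  totalsTm-run xs = trans (map-run _ xs []) (++-identityʳ _)

  heaviest : ∀ xs {n} → weight xs ≤ n → All.All (λ (x : List Bool × List Bool) → len (proj₁ x) + len (proj₂ x) ≤ n) xs
  heaviest []             le = []
  heaviest ((d , n) ∷ xs) le = ≤-trans (m≤m+n _ _) (≤-trans (n≤1+n _) le) ∷ heaviest xs (≤-trans (m≤n+m _ (len d + len n)) (≤-trans (n≤1+n _) le))

  totalsTm-time : PolyTime totalsTm (λ (xs , _) → weight xs)
  totalsTm-time = polynomial $ foldr-Bounded (cons (call mulTm (op snd v0 ∷ op fst v0 ∷ [])) v1) (con []) v0 (λ γ → γ)
    (λ (xs , _) x → len (proj₁ x) + len (proj₂ x) ≤ weight xs) (λ _ _ _ → ⊤)
    (λ (xs , _) → monomial (proj₁ B tt) (proj₁ (proj₂ B)) (weight xs))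
    (λ (xs , _) {j} {x} q _ → (≤-trans (≤-reflexive (+-identityʳ _)) (≤-trans (proj₂ (proj₂ B) (proj₂ x , proj₁ x , tt))
      (monomial-mono (proj₁ B tt) (proj₁ (proj₂ B)) (≤-trans (≤-reflexive (+-comm (len (proj₂ x)) _)) q)))) , tt)
    (λ (xs , _) → heaviest xs ≤-refl) (λ _ → tt)
    (Bounded-const 0) (Bounded-const 0)
    (Bounded-≤ (λ (xs , _) → len≤weight xs) Bounded-size)
    (Bounded-monomial (proj₁ B tt) (proj₁ (proj₂ B)) Bounded-size)
    where
    B : Bounded (λ _ → tt) len₂ (time mulTm)
    B = PolyTime.bound mulTm-time

opaque
  rowsTm : Tm (list (list nat) ∷ list Number×Number ∷ []) (list (list bool))
  rowsTm = call appendTm (call capacitiesTm (v0 ∷ v1 ∷ []) ∷ call totalsTm (v1 ∷ []) ∷ [])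

  rowsTm-run : ∀ A xs → run rowsTm (A , xs , tt) ≡
    List.map (λ a → run capacityTm (a , xs , tt)) A ++ List.map (λ (d , n) → run mulTm (n , d , tt)) xs
  rowsTm-run A xs = trans (appendTm-run {list bool} _ _) (cong₂ _++_ (capacitiesTm-run A xs) (totalsTm-run xs))

  rowsTm-time : PolyTime rowsTm (λ (A , xs , _) → size (list (list nat)) A + weight xs)
  rowsTm-time = polynomial $ time-Bounded rowsTm (λ γ → γ) (Bounded-+
    (Bounded-+ (call-Bounded capacitiesTm-time Bounded-size)
      (Bounded-+ (call-Bounded totalsTm-time (Bounded-≤ (λ (A , xs , _) → m≤n+m (weight xs) _) Bounded-size)) (Bounded-const 0)))
    (call-Bounded appendTm-time (Bounded-≤ (λ (A , xs , _) → ≤-trans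
      (≤-reflexive (trans (cong len (capacitiesTm-run A xs)) (length-map _ A)))
      (≤-trans (len≤size (list nat) A) (m≤m+n _ (weight xs)))) Bounded-size)))

rowsTm-vals : ∀ {k t} (xs : Vec (ℕ × ℕ) k) →
  vals (run rowsTm (types (k , t) , classBits xs , tt)) ≡ rows (λ a → val (run capacityTm (a , classBits xs , tt))) (types (k , t)) (totals xs)
rowsTm-vals {k} {t} xs rewrite rowsTm-run (types (k , t)) (classBits xs) =
  trans (map-++ val (List.map _ (types (k , t))) _) (cong₂ _++_ (sym (map-∘ (types (k , t)))) (go xs))
  where
  go : ∀ {k} (xs : Vec (ℕ × ℕ) k) → vals (List.map (λ (d , n) → run mulTm (n , d , tt)) (classBits xs)) ≡ totals xs
  go []             = refl
  go ((d , n) ∷ xs) = cong₂ _∷_ (trans (mulTm-val (bits n) (bits d)) (cong₂ _*_ (val-bits n) (val-bits d))) (go xs)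

rowsTm-len : ∀ A xs → len (run rowsTm (A , xs , tt)) ≡ len A + len xs
rowsTm-len A xs rewrite rowsTm-run A xs = trans (length-++ (List.map _ A)) (cong₂ _+_ (length-map _ A) (length-map _ xs))

opaque
  -- The concatenation is at least as long as each row, which is all that is asked of a ruler, and
  -- it needs no comparison of lengths.
  rulerTm : Tm (list (list bool) ∷ []) (list bool)
  rulerTm = foldr (call appendTm (v0 ∷ v1 ∷ [])) (con []) v0

  rulerTm-run : ∀ rs → run rulerTm (rs , tt) ≡ List.concat rs
  rulerTm-run rs = go rs
    where
    go : ∀ rs → List.foldr (λ r acc → run (appendTm {bool}) (r , acc , tt)) [] rs ≡ List.concat rs
    go []       = refl
    go (r ∷ rs) = trans (appendTm-run {bool} r _) (cong (r ++_) (go rs))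

  short : ∀ rs {n} → len (List.concat rs) ≤ n → All.All (λ (r : List Bool) → len r ≤ n) rs
  short []       le = []
  short (r ∷ rs) {n} le = ≤-trans (m≤m+n (len r) (len (List.concat rs))) le′ ∷ short rs (≤-trans (m≤n+m _ (len r)) le′)
    where
    le′ : len r + len (List.concat rs) ≤ n
    le′ = ≤-trans (≤-reflexive (sym (length-++ r))) le

  rulerTm-time : PolyTime rulerTm (λ (rs , _) → len rs + len (List.concat rs))
  rulerTm-time = polynomial $ foldr-Bounded (call appendTm (v0 ∷ v1 ∷ [])) (con []) v0 (λ γ → γ)
    (λ (rs , _) r → len r ≤ len (List.concat rs)) (λ _ _ _ → ⊤)
    (λ (rs , _) → monomial (proj₁ B tt) (proj₁ (proj₂ B)) (len (List.concat rs)))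
    (λ (rs , _) {j} {r} {acc} q _ → ≤-trans (proj₂ (proj₂ B) (r , acc , tt)) (monomial-mono (proj₁ B tt) (proj₁ (proj₂ B)) q) , tt)
    (λ (rs , _) → short rs ≤-refl) (λ _ → tt)
    (Bounded-const 0) (Bounded-const 0) (Bounded-≤ (λ (rs , _) → m≤m+n (len rs) _) Bounded-size)
    (Bounded-monomial (proj₁ B tt) (proj₁ (proj₂ B)) (Bounded-≤ (λ (rs , _) → m≤n+m _ (len rs)) Bounded-size))
    where
    B : Bounded (λ _ → tt) len₁ (time (appendTm {bool}))
    B = PolyTime.bound appendTm-time

-- Running time of the automaton

Within-filter : ∀ a {h} p (l : List ⟦ a ⟧) → Within (list a) h l → Within (list a) h (List.filterᵇ p l)
Within-filter a p l (le , ws) = ≤-trans (length-filter (T? ∘ p) l) le , All.filter⁺ (T? ∘ p) ws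

-- If the matrix and the number of rows depend on the parameter only, so does the time of each step.
module _ {I P : Set} {p : I → P} {s : I → ℕ} (vs : P → List (List ℕ)) (r : P → ℕ)
         (ruler : I → List Bool) (rs : I → List (List Bool)) (rs-len : ∀ i → len (rs i) ≡ r (p i)) where

  private
    -- It bounds the states, which form a sublist of `U`, as well as the list of current digits. The
    -- `suc` makes room for the initial list `[] ∷ []` and for a digit 1.
    h : P → ℕ
    h q = suc (size (list (list nat)) (U (vs q)) + r q)

    stepBounded : ∀ q → ∃[ B ] ∀ x → Within (list (list nat) ⊗ list nat) (h q) x → time stepTm (vs q , U (vs q) , proj₁ x , proj₂ x , tt) ≤ B
    stepBounded q = bounded (list (list nat) ⊗ list nat) (h q) _

    env : I → Env (list (list nat) ∷ list (list nat) ∷ list bool ∷ list (list bool) ∷ [])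
    env i = vs (p i) , U (vs (p i)) , ruler i , rs i , tt

    R : I → ℕ → List (List ℕ) × List (List Bool) → Set
    R i j (S , rows) = Within (list (list nat)) (h (p i)) S × len rows ≡ r (p i)

    start : ∀ i j → R i j (([] ∷ []) , rs i)
    start i j = (s≤s z≤n , (z≤n , []) ∷ []) , rs-len i

    next-within : ∀ i j S rows → R i (suc j) (S , rows) → R i j (run loopStep (true , (S , rows) , env i))
    next-within i j S rows (w , l) = subst (Within (list (list nat)) (h (p i))) (sym (proj₂ filtered))
      (Within-filter (list nat) (proj₁ filtered) (U (vs (p i)))
        (Within-mono (list (list nat)) (U (vs (p i))) (≤-trans (m≤m+n _ (r (p i))) (n≤1+n _)) (within-size (list (list nat)) (U (vs (p i)))))) ,
      trans (tailsTm-len rows) l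
      where
      filtered : ∃[ f ] run stepTm (vs (p i) , U (vs (p i)) , S , run headsTm (rows , tt) , tt) ≡ List.filterᵇ f (U (vs (p i)))
      filtered = stepTm-filter (vs (p i)) (U (vs (p i))) S (run headsTm (rows , tt))

    cH : Bounded (λ _ → tt) len₁ (time headsTm)
    cH = PolyTime.bound headsTm-time
    cT : Bounded (λ _ → tt) len₁ (time tailsTm)
    cT = PolyTime.bound tailsTm-time

    stepCost : P → ℕ
    stepCost q = monomial (proj₁ cH tt) (proj₁ (proj₂ cH)) (r q) + proj₁ (stepBounded q) + monomial (proj₁ cT tt) (proj₁ (proj₂ cT)) (r q)

    step-cost : ∀ i j S rows → R i (suc j) (S , rows) → heavy loopStep (true , (S , rows) , env i) ≤ stepCost (p i)
    step-cost i j S rows (w , l) = +-mono-≤ (+-mono-≤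
      (≤-trans (≤-reflexive (+-identityʳ _)) (≤-trans (proj₂ (proj₂ cH) (rows , tt)) (≤-reflexive (cong (monomial (proj₁ cH tt) (proj₁ (proj₂ cH))) l))))
      (proj₂ (stepBounded (p i)) (S , run headsTm (rows , tt)) (w ,
        Within-mono (list nat) (run headsTm (rows , tt)) (s≤s (≤-trans (≤-reflexive l) (m≤n+m (r (p i)) _))) (headsTm-within rows))))
      (≤-trans (proj₂ (proj₂ cT) (rows , tt)) (≤-reflexive (cong (monomial (proj₁ cT tt) (proj₁ (proj₂ cT))) l)))

  opaque
    unfolding loopTm

    loopTm-time : Bounded p s (λ i → len (ruler i)) → Bounded p s (λ i → time loopTm (env i))
    loopTm-time bl = foldl-Bounded loopStep (pair (con ([] ∷ [])) v3) v2 env (λ _ _ → ⊤) R (λ i → stepCost (p i))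
      (λ i {j} {_} {y} _ q → step-cost i j (proj₁ y) (proj₂ y) q , next-within i j (proj₁ y) (proj₂ y) q)
      (λ i → trivially (ruler i)) (λ i → start i (len (ruler i))) (Bounded-const 0) (Bounded-const 0) bl (Bounded-param stepCost)

    loopTm-within : ∀ i → Within (list (list nat)) (h (p i)) (proj₁ (run loopTm (env i)))
    loopTm-within i = proj₁ (go (ruler i) (([] ∷ []) , rs i) (start i (len (ruler i))))
      where
      go : ∀ l y → R i (len l) y → R i 0 (List.foldl (λ y x → run loopStep (x , y , env i)) y l)
      go []      y q = q
      go (x ∷ l) y q = go l _ (next-within i (len l) (proj₁ y) (proj₂ y) q)

  acceptance-time : Bounded p s (λ i → time memberTm ([] , proj₁ (run loopTm (env i)) , tt))
  acceptance-time = Bounded-≤ (λ i → proj₂ (acc (p i)) _ (loopTm-within i)) (Bounded-param (λ q → proj₁ (acc q)))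
    where
    acc : ∀ q → ∃[ B ] ∀ S → Within (list (list nat)) (h q) S → time memberTm ([] , S , tt) ≤ B
    acc q = bounded (list (list nat)) (h q) _

-- The complete decision procedure

opaque
  decideTm : Tm (list (list nat) ∷ list (list nat) ∷ list (list bool) ∷ []) bool
  decideTm = call memberTm (con [] ∷ op fst (call loopTm (v0 ∷ v1 ∷ call rulerTm (v2 ∷ []) ∷ v2 ∷ [])) ∷ [])

  decideTm-sound : ∀ vs rs → T (run decideTm (vs , U vs , rs , tt)) → Solvable vs (λ _ → 0) (vals rs ‼_)
  decideTm-sound vs rs t = proj₁ (loopTm-correct vs (run rulerTm (rs , tt)) rs (short rs (≤-reflexive (cong len (sym (rulerTm-run rs))))))
    (memberTm-sound [] _ t)

  decideTm-complete : ∀ vs rs → Solvable vs (λ _ → 0) (vals rs ‼_) → T (run decideTm (vs , U vs , rs , tt))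
  decideTm-complete vs rs sol =
    let c , c∈ , e = proj₂ (loopTm-correct vs (run rulerTm (rs , tt)) rs (short rs (≤-reflexive (cong len (sym (rulerTm-run rs)))))) sol
    in memberTm-complete [] _ c∈ e

  decideTm-time : ∀ {I P : Set} {p : I → P} {s : I → ℕ} (vs : P → List (List ℕ)) (r : P → ℕ) (rs : I → List (List Bool)) →
    (∀ i → len (rs i) ≡ r (p i)) → Bounded p s (λ i → len (List.concat (rs i))) →
    Bounded p s (λ i → time decideTm (vs (p i) , U (vs (p i)) , rs i , tt))
  decideTm-time {I} {P} {p} {s} vs r rs rs-len bl = time-Bounded decideTm (λ i → vs (p i) , U (vs (p i)) , rs i , tt)
    (Bounded-+
      (Bounded-+ (Bounded-+ (Bounded-+ (call-Bounded rulerTm-time brs) (Bounded-const 0))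
        (loopTm-time vs r ruler rs rs-len (Bounded-≤ (λ i → ≤-reflexive (cong len (rulerTm-run (rs i)))) bl))) (Bounded-const 0))
      (acceptance-time vs r ruler rs rs-len))
    where
    ruler : I → List Bool
    ruler i = run rulerTm (rs i , tt)
    brs : Bounded p s (λ i → len (rs i) + len (List.concat (rs i)))
    brs = Bounded-+ (Bounded-≤ (λ i → ≤-reflexive (rs-len i)) (Bounded-param r)) bl

opaque
  mainTm : Tm ((list bool ⊗ list Number×Number) ∷ []) bool
  mainTm = bind (call unaryTm (op fst v0 ∷ [])) (bind (call boundsTm (v0 ∷ op snd v1 ∷ [])) (bind (call setupTm (v1 ∷ v0 ∷ []))
    (call decideTm (op fst (op snd v0) ∷ op snd (op snd v0) ∷ call rowsTm (op fst v0 ∷ op snd v3 ∷ []) ∷ []))))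

record Instance : Set where
  constructor instance-of
  field
    uniformity : ℕ
    {classes}  : ℕ
    classList  : Vec (ℕ × ℕ) classes

open Instance

parameters : Instance → ℕ × ℕ
parameters i = classes i , uniformity i

instanceSize : Instance → ℕ
instanceSize i = inputSize (classList i)

input : Instance → Env ((list bool ⊗ list Number×Number) ∷ [])
input i = (bits (uniformity i) , classBits (classList i)) , tt

rightHandSide : Instance → List (List Bool)
rightHandSide i = run rowsTm (types (parameters i) , classBits (classList i) , tt)

decision : Instance → Bool
decision i = run decideTm (columns (types (parameters i)) , U (columns (types (parameters i))) , rightHandSide i , tt)

unary-uniformity : ∀ i → run unaryTm (bits (uniformity i) , tt) ≡ uniformity i
unary-uniformity i = trans (unaryTm-run (bits (uniformity i))) (val-bits (uniformity i))

bounds-uniformity : ∀ i → run boundsTm (uniformity i , classBits (classList i) , tt) ≡ List.replicate (classes i) (uniformity i)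
bounds-uniformity i = trans (boundsTm-run (uniformity i) (classBits (classList i)))
  (cong (λ k → List.replicate k (uniformity i)) (len-classBits (classList i)))

-- The last summand comes from `mulTm-len` for the degree totals, the others from `capacityTm-len`.
row-bound : ℕ → ℕ → ℕ
row-bound a w = 1 + (a + w) * (a * (2 * w)) + 2 * w

rightHandSide-short : ∀ A xs → All.All (λ r → len r ≤ row-bound (size (list (list nat)) A) (weight xs)) (run rowsTm (A , xs , tt))
rightHandSide-short A xs rewrite rowsTm-run A xs = All.++⁺
  (All.map⁺ (All.map (λ {a} q → ≤-trans (capacityTm-len a xs) (≤-trans
    (s≤s (*-mono-≤ (+-mono-≤ (≤-trans (len≤size nat a) q) (len≤weight xs)) (*-monoˡ-≤ (2 * weight xs) q)))
    (m≤m+n (1 + (size (list (list nat)) A + weight xs) * (size (list (list nat)) A * (2 * weight xs))) (2 * weight xs)))) (size-elements A ≤-refl)))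
  (All.map⁺ (All.map (λ {x} q → ≤-trans (mulTm-len (proj₂ x) (proj₁ x)) (≤-trans (product (len (proj₁ x)) (len (proj₂ x)) q)
    (m≤n+m (2 * weight xs) (1 + (size (list (list nat)) A + weight xs) * (size (list (list nat)) A * (2 * weight xs)))))) (heaviest xs ≤-refl)))
  where
  product : ∀ d n {w} → d + n ≤ w → d + 2 * n ≤ 2 * w
  product d n le = ≤-trans (+-monoˡ-≤ (2 * n) (m≤m+n d (d + 0))) (≤-trans (≤-reflexive (sym (*-distribˡ-+ 2 d n))) (*-monoʳ-≤ 2 le))

len-concat : ∀ (rs : List (List Bool)) {n} → All.All (λ r → len r ≤ n) rs → len (List.concat rs) ≤ len rs * n
len-concat []       []       = z≤n
len-concat (r ∷ rs) (q ∷ qs) = ≤-trans (≤-reflexive (length-++ r)) (+-mono-≤ q (len-concat rs qs))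

opaque
  unfolding mainTm

  mainTm-run : ∀ i → run mainTm (input i) ≡ decision i
  mainTm-run i rewrite unary-uniformity i | bounds-uniformity i | setupTm-run (uniformity i) (List.replicate (classes i) (uniformity i)) = refl

  -- Reading `t` in unary and setting up types, matrix and states involve nothing but `(k , t)`;
  -- their times are functions of the parameter as they stand. The other parts have bounds in terms
  -- of `k`, the weight of the input and the lengths of the rows.
  mainTm-time : Bounded parameters instanceSize (λ i → time mainTm (input i))
  mainTm-time = time-Bounded mainTm input (Bounded-≤ canonical (Bounded-+
      (Bounded-param (λ (k , t) → time unaryTm (bits t , tt)))
    (Bounded-+ (call-Bounded boundsTm-time (Bounded-≤ (λ i → ≤-reflexive (len-classBits (classList i))) (Bounded-param proj₁)))
    (Bounded-+ (Bounded-param (λ (k , t) → time setupTm (t , List.replicate k t , tt)))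
    (Bounded-+ (call-Bounded rowsTm-time (Bounded-+ bA bw))
      (decideTm-time (λ q → columns (types q)) (λ q → len (types q) + proj₁ q) rightHandSide
        (λ i → trans (rowsTm-len (types (parameters i)) (classBits (classList i))) (cong (len (types (parameters i)) +_) (len-classBits (classList i))))
        (Bounded-≤ (λ i → len-concat (rightHandSide i) (rightHandSide-short (types (parameters i)) (classBits (classList i))))
          (Bounded-* (Bounded-≤ (λ i → ≤-reflexive (rowsTm-len (types (parameters i)) (classBits (classList i))))
              (Bounded-+ (Bounded-param (λ q → len (types q))) (Bounded-≤ (λ i → len≤weight (classBits (classList i))) bw)))
            (Bounded-+ (Bounded-+ (Bounded-const 1) (Bounded-* (Bounded-+ bA bw) (Bounded-* bA (Bounded-* (Bounded-const 2) bw))))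
              (Bounded-* (Bounded-const 2) bw))))))))))
    where
    bA : Bounded parameters instanceSize (λ i → size (list (list nat)) (types (parameters i)))
    bA = Bounded-param (λ q → size (list (list nat)) (types q))
    bw : Bounded parameters instanceSize (λ i → weight (classBits (classList i)))
    bw = Bounded-≤ (λ i → ≤-reflexive (weight-classBits (classList i))) (Bounded-+ (Bounded-param proj₁) Bounded-size)
    -- Intermediate values of the program are replaced by the expressions in `k` and `t` that they
    -- equal, which exposes the times that depend on the parameter only.
    canonical : ∀ i → heavy mainTm (input i) ≤
      time unaryTm (bits (uniformity i) , tt) +
      (time boundsTm (uniformity i , classBits (classList i) , tt) +
      (time setupTm (uniformity i , List.replicate (classes i) (uniformity i) , tt) +
      (time rowsTm (types (parameters i) , classBits (classList i) , tt) +
       time decideTm (columns (types (parameters i)) , U (columns (types (parameters i))) , rightHandSide i , tt))))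
    canonical i rewrite unary-uniformity i | bounds-uniformity i | setupTm-run (uniformity i) (List.replicate (classes i) (uniformity i)) =
      +-monoʳ-≤ (time unaryTm (bits (uniformity i) , tt)) (+-monoʳ-≤ (time boundsTm (uniformity i , classBits (classList i) , tt))
        (+-monoʳ-≤ (time setupTm (uniformity i , List.replicate (classes i) (uniformity i) , tt))
          (≤-reflexive (cong (_+ time decideTm (columns (types (parameters i)) , U (columns (types (parameters i))) , rightHandSide i , tt)) (+-identityʳ _)))))

-- Correctness of the decision

reflects : ∀ {A : Set} b → (T b → A) → (A → T b) → Reflects A b
reflects true  f g = ofʸ (f tt)
reflects false f g = ofⁿ g

decision-correct : ∀ i → Reflects (Hypergraphical (uniformity i) (degreeSequence (classList i))) (decision i)
decision-correct i = reflects (decision i)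
  (λ d → solvable⇒hypergraphical (admissible (classes i) (uniformity i)) (classList i) cap cap≡
    (subst (Solvable vs (λ _ → 0)) vals≡ (decideTm-sound vs (rightHandSide i) d)))
  (λ h → decideTm-complete vs (rightHandSide i) (subst (Solvable vs (λ _ → 0)) (sym vals≡)
    (hypergraphical⇒solvable (admissible (classes i) (uniformity i)) (classList i) cap cap≡ h)))
  where
  vs : List (List ℕ)
  vs = columns (types (parameters i))
  cap : List ℕ → ℕ
  cap a = val (run capacityTm (a , classBits (classList i) , tt))
  cap≡ : ∀ {a} → a ∈ˡ types (parameters i) → cap a ≡ fallings a (sizes (classList i))
  cap≡ {a} a∈ = trans
    (capacityTm-val a (classBits (classList i)) (trans (Admissible.length≡ (admissible (classes i) (uniformity i)) a∈) (sym (len-classBits (classList i)))))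
    (capacity-classBits a (classList i))
  vals≡ : (vals (rightHandSide i) ‼_) ≡ (rows cap (types (parameters i)) (totals (classList i)) ‼_)
  vals≡ = cong _‼_ (rowsTm-vals {t = uniformity i} (classList i))

program : Program
-- The first assignment makes the input the only variable of the environment; it costs the 4 units
-- added to the time of `mainTm`.
program = record { body = E := cons (var V) nil ⨾ compile mainTm }

program-outputs : ∀ i → program on encodeInput (uniformity i) (classList i) outputs encodeBool (decision i) inTime (4 + time mainTm (input i))
program-outputs i = encEnv _ (input i) ∷ nil ∷ [] ,
  subst (λ x → ⟨ Program.body program , x ∷ nil ∷ nil ∷ [] ⟩⇓⟨ encodeBool (decision i) ∷ encEnv _ (input i) ∷ nil ∷ [] , 4 + time mainTm (input i) ⟩)
    (enc-input (uniformity i) (classList i))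
    (subst (λ b → ⟨ Program.body program , encoded ∷ nil ∷ nil ∷ [] ⟩⇓⟨ encodeBool b ∷ encEnv _ (input i) ∷ nil ∷ [] , 4 + time mainTm (input i) ⟩)
      (mainTm-run i) (seq assign (compile-correct mainTm (input i) encoded nil)))
  where
  encoded : Tree
  encoded = enc (list bool ⊗ list Number×Number) (proj₁ (input i))

theorem2 : Σ[ f ∈ (ℕ → ℕ → ℕ) ] Σ[ poly ∈ Polynomial ] Σ[ P ∈ Program ]
    (∀ (t k : ℕ) (xs : Vec (ℕ × ℕ) k) →
    Unique (map proj₁ xs) →
    All (1 ≤_) (map proj₂ xs) →
    P on encodeInput t xs
    decides Hypergraphical t (degreeSequence xs)
    within (f k t * evalPoly poly (inputSize xs)))
theorem2 =
  let f , d , bound = Bounded-+ (Bounded-const 4) mainTm-time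
  in (λ k t → f (k , t)) , [1+X]^ d , program , λ t k xs _ _ →
    let i = instance-of t xs
    in decision i , 4 + time mainTm (input i) , program-outputs i ,
       ≤-trans (bound i) (≤-reflexive (cong (f (k , t) *_) (sym (eval-[1+X]^ d (inputSize xs))))) ,
       decision-correct i
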